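{- Let $NC(6n+3,3)$ be the number of non-isomorphic cyclic Steiner triple systems of order $6n+3$. Then there is an integer $N$ such that for all $n\ge N$: - if $n\equiv 3,5,24,26 \pmod{28}$, then $NC(6n+3,3)\ge (3.35)^n$; - if $n\not\equiv 3,5,24,26 \pmod{28}$, then $NC(6n+3,3)\ge (2.49)^n$.
   Context: A Steiner triple system of order $v$, $STS(v)$, is a $3$-cycle system of the complete graph $K_v$: a set $\mathcal{B}$ of $3$-cycles (triangles) of $K_v$ whose edges partition the edge-set of $K_v$. It is cyclic if the vertex-set can be identified with $\mathbb{Z}_v$ in such a way that $B\in\mathcal{B}$ implies $B+z\in\mathcal{B}$ for all $z\in\mathbb{Z}_v$, where $(b_1,b_2,b_3)+z=(b_1+z,b_2+z,b_3+z)$. Two such systems with cycle sets $\mathcal{B}$ and $\mathcal{B}'$ are isomorphic if there is a permutation of the vertex-set turning $\mathcal{B}$ into $\mathcal{B}'$. $NC(v,3)$ is the number of cyclic $STS(v)$s up to isomorphism. -}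

module Defs where

open import Data.Fin.Base using (Fin; toℕ; finToFun; funToFin)
open import Data.Fin.Permutation using (Permutation′; permutation; _⟨$⟩ʳ_; _⟨$⟩ˡ_; _∘ₚ_; flip; inverseˡ; inverseʳ)
  renaming (id to idₚ)
open import Data.Fin.Properties using (_≟_; any?; all?; nonZeroIndex; finToFun-funToFin)
open import Data.List.Base using (List; []; _∷_; [_]; map; _++_; filter; length; deduplicate; allFin; cartesianProduct)
open import Data.List.Membership.Propositional renaming (_∈_ to _∈ₚ_)
open import Data.List.Membership.Propositional.Properties
  using (∈-allFin; ∈-cartesianProduct⁺; ∈-++⁺ˡ; ∈-++⁺ʳ; ∈-map⁺; ∈-filter⁺)
import Data.List.Membership.Setoid as Membership
import Data.List.Membership.Setoid.Properties as Membershipₚ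
open import Data.List.Properties using (map-cong; map-∘; map-id)
open import Data.List.Relation.Unary.All using (All)
open import Data.List.Relation.Unary.All.Properties using (all-filter; deduplicate⁺)
open import Data.List.Relation.Unary.AllPairs using (AllPairs)
import Data.List.Relation.Unary.Any as Any
open import Data.List.Relation.Unary.Any using (Any; here)
open import Data.List.Relation.Unary.Unique.DecSetoid.Properties using (deduplicate-!)
open import Data.Nat.Base using (ℕ; _+_)
open import Data.Nat.DivMod using (_mod_)
open import Data.Product using (∃; ∃!; ∃-syntax; _×_; _,_; proj₂)
open import Data.Sum using (_⊎_; inj₁; inj₂)
open import Function.Base using (_∘_)
open import Function.Bundles using (_⇔_; mk⇔; Equivalence)
import Function.Properties.Equivalence as ⇔
open import Level using (0ℓ)
open import Relation.Binary.Bundles using (Setoid; DecSetoid)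
open import Relation.Binary.Definitions using (Decidable)
open import Relation.Binary.Properties.Setoid using (respʳ-flip)
open import Relation.Binary.PropositionalEquality
  using (_≡_; _≢_; _≗_; refl; sym; trans; cong; cong₂; subst)
open import Relation.Binary.Structures using (IsEquivalence)
open import Relation.Nullary using (¬_; Dec; yes; no)
open import Relation.Nullary.Decidable using (map′; _×-dec_; _⊎-dec_; _→-dec_; ¬?)
open import Relation.Unary using (Pred) renaming (Decidable to Decidable₁)

open Equivalence using (to; from)

private
  variable
    v w u : ℕ

------------------------------------------------------------------------
-- Triangles of the complete graph on Fin v

-- (a , b , c) is the closed walk a – b – c – a; it is a 3-cycle when its
-- vertices are distinct.
Triple : ℕ → Set
Triple v = Fin v × Fin v × Fin v

IsTriangle : Triple v → Set
IsTriangle (a , b , c) = a ≢ b × b ≢ c × c ≢ a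

SamePair : (x y a b : Fin v) → Set
SamePair x y a b = (x ≡ a × y ≡ b) ⊎ (x ≡ b × y ≡ a)

Edge : Triple v → Fin v → Fin v → Set
Edge (a , b , c) x y = SamePair x y a b ⊎ SamePair x y b c ⊎ SamePair x y c a

-- The six triples with the same vertices are one and the same 3-cycle.
infix 4 _≈_
_≈_ : Triple v → Triple v → Set
C ≈ D = ∀ x y → Edge C x y ⇔ Edge D x y

cycleSetoid : ℕ → Setoid 0ℓ 0ℓ
cycleSetoid v = record
  { Carrier       = Triple v
  ; _≈_           = _≈_
  ; isEquivalence = record
    { refl  = λ x y → ⇔.refl
    ; sym   = λ p x y → ⇔.sym (p x y)
    ; trans = λ p q x y → ⇔.trans (p x y) (q x y)
    }
  }

relabel : (Fin v → Fin w) → Triple v → Triple w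
relabel f (a , b , c) = f a , f b , f c

------------------------------------------------------------------------
-- Sets of triangles

-- A list stands for the set of its entries: order, repetition and the
-- choice of triple for a 3-cycle are ignored by _∈_ and _≋_.
System : ℕ → Set
System v = List (Triple v)

infix 4 _∈_ _≋_
_∈_ : Triple v → System v → Set
_∈_ {v} = Membership._∈_ (cycleSetoid v)

_≋_ : System v → System v → Set
ℬ ≋ ℬ′ = ∀ C → C ∈ ℬ ⇔ C ∈ ℬ′

relabelAll : (Fin v → Fin w) → System v → System w
relabelAll f = map (relabel f)

record IsSTS {v : ℕ} (ℬ : System v) : Set where
  field
    triangles : ∀ C → C ∈ ℬ → IsTriangle C
    partition : ∀ x y → x ≢ y → ∃! _≈_ λ C → C ∈ ℬ × Edge C x y

-- Addition in ℤ_v.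
infixl 6 _⊕_
_⊕_ : Fin v → Fin v → Fin v
_⊕_ {v} x z = _mod_ (toℕ x + toℕ z) v {{nonZeroIndex x}}

TranslationInvariant : System v → Set
TranslationInvariant ℬ = ∀ z B → B ∈ ℬ → relabel (_⊕ z) B ∈ ℬ

-- π is the identification of the vertex-set with ℤ_v.
IsCyclic : System v → Set
IsCyclic {v} ℬ = ∃[ π ] TranslationInvariant (relabelAll (_⟨$⟩ʳ_ {v} {v} π) ℬ)

IsCyclicSTS : System v → Set
IsCyclicSTS ℬ = IsSTS ℬ × IsCyclic ℬ

infix 4 _≅_
_≅_ : System v → System v → Set
_≅_ {v} ℬ ℬ′ = ∃[ π ] relabelAll (_⟨$⟩ʳ_ {v} {v} π) ℬ ≋ ℬ′

------------------------------------------------------------------------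
-- _≅_ is an equivalence relation

module _ (f : Fin v → Fin w) where

  edge-relabel⁺ : ∀ C {x y} → Edge C x y → Edge (relabel f C) (f x) (f y)
  edge-relabel⁺ C (inj₁ (inj₁ (refl , refl)))        = inj₁ (inj₁ (refl , refl))
  edge-relabel⁺ C (inj₁ (inj₂ (refl , refl)))        = inj₁ (inj₂ (refl , refl))
  edge-relabel⁺ C (inj₂ (inj₁ (inj₁ (refl , refl)))) = inj₂ (inj₁ (inj₁ (refl , refl)))
  edge-relabel⁺ C (inj₂ (inj₁ (inj₂ (refl , refl)))) = inj₂ (inj₁ (inj₂ (refl , refl)))
  edge-relabel⁺ C (inj₂ (inj₂ (inj₁ (refl , refl)))) = inj₂ (inj₂ (inj₁ (refl , refl)))
  edge-relabel⁺ C (inj₂ (inj₂ (inj₂ (refl , refl)))) = inj₂ (inj₂ (inj₂ (refl , refl)))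

  edge-relabel⁻ : ∀ C {x y} → Edge (relabel f C) x y →
                  ∃[ p ] ∃[ q ] x ≡ f p × y ≡ f q × Edge C p q
  edge-relabel⁻ C (inj₁ (inj₁ (p , q)))        = _ , _ , p , q , inj₁ (inj₁ (refl , refl))
  edge-relabel⁻ C (inj₁ (inj₂ (p , q)))        = _ , _ , p , q , inj₁ (inj₂ (refl , refl))
  edge-relabel⁻ C (inj₂ (inj₁ (inj₁ (p , q)))) = _ , _ , p , q , inj₂ (inj₁ (inj₁ (refl , refl)))
  edge-relabel⁻ C (inj₂ (inj₁ (inj₂ (p , q)))) = _ , _ , p , q , inj₂ (inj₁ (inj₂ (refl , refl)))
  edge-relabel⁻ C (inj₂ (inj₂ (inj₁ (p , q)))) = _ , _ , p , q , inj₂ (inj₂ (inj₁ (refl , refl)))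
  edge-relabel⁻ C (inj₂ (inj₂ (inj₂ (p , q)))) = _ , _ , p , q , inj₂ (inj₂ (inj₂ (refl , refl)))

  relabel-cong : {C D : Triple v} → C ≈ D → relabel f C ≈ relabel f D
  relabel-cong {C} {D} C≈D x y =
    mk⇔ (half C D (λ {p} {q} → to (C≈D p q))) (half D C (λ {p} {q} → from (C≈D p q)))
    where
    half : ∀ C D → (∀ {p q} → Edge C p q → Edge D p q) →
           Edge (relabel f C) x y → Edge (relabel f D) x y
    half C D imp e with edge-relabel⁻ C e
    ... | p , q , refl , refl , e′ = edge-relabel⁺ D (imp e′)

  relabelAll-cong : {ℬ ℬ′ : System v} → ℬ ≋ ℬ′ → relabelAll f ℬ ≋ relabelAll f ℬ′
  relabelAll-cong {ℬ} {ℬ′} eq C =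
    mk⇔ (half (λ {D} → to (eq D))) (half (λ {D} → from (eq D)))
    where
    half : {ℬ ℬ′ : System v} → (∀ {D} → D ∈ ℬ → D ∈ ℬ′) →
           C ∈ relabelAll f ℬ → C ∈ relabelAll f ℬ′
    half imp C∈ with Membershipₚ.∈-map⁻ (cycleSetoid v) (cycleSetoid w) C∈
    ... | D , D∈ , C≈fD =
      Membershipₚ.∈-resp-≈ (cycleSetoid w) (Setoid.sym (cycleSetoid w) {C} C≈fD)
        (Membershipₚ.∈-map⁺ (cycleSetoid v) (cycleSetoid w)
          (λ {A} {B} → relabel-cong {A} {B}) (imp D∈))

≡⇒≋ : {ℬ ℬ′ : System v} → ℬ ≡ ℬ′ → ℬ ≋ ℬ′
≡⇒≋ refl C = ⇔.refl

≋-sym : {ℬ ℬ′ : System v} → ℬ ≋ ℬ′ → ℬ′ ≋ ℬ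
≋-sym p C = ⇔.sym (p C)

≋-trans : {ℬ ℬ′ ℬ″ : System v} → ℬ ≋ ℬ′ → ℬ′ ≋ ℬ″ → ℬ ≋ ℬ″
≋-trans p q C = ⇔.trans (p C) (q C)

relabelAll-≗ : {f g : Fin v → Fin w} → f ≗ g → relabelAll f ≗ relabelAll g
relabelAll-≗ f≗g = map-cong λ (a , b , c) → cong₂ _,_ (f≗g a) (cong₂ _,_ (f≗g b) (f≗g c))

relabelAll-id : {f : Fin v → Fin v} → (∀ x → f x ≡ x) → ∀ ℬ → relabelAll f ℬ ≡ ℬ
relabelAll-id f≗id ℬ = trans (relabelAll-≗ f≗id ℬ) (map-id ℬ)

relabelAll-∘ : (g : Fin w → Fin u) (f : Fin v → Fin w) (ℬ : System v) →
               relabelAll (g ∘ f) ℬ ≡ relabelAll g (relabelAll f ℬ)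
relabelAll-∘ g f ℬ = map-∘ ℬ

≋⇒≅ : {ℬ ℬ′ : System v} → ℬ ≋ ℬ′ → ℬ ≅ ℬ′
≋⇒≅ {ℬ = ℬ} p = idₚ , ≋-trans (≡⇒≋ (relabelAll-id (λ _ → refl) ℬ)) p

≅-isEquivalence : IsEquivalence (_≅_ {v})
≅-isEquivalence = record
  { refl  = ≋⇒≅ (≡⇒≋ refl)
  ; sym   = λ {ℬ} (π , p) → flip π ,
      ≋-trans (relabelAll-cong (π ⟨$⟩ˡ_) (≋-sym p))
        (≡⇒≋ (trans (sym (relabelAll-∘ (π ⟨$⟩ˡ_) (π ⟨$⟩ʳ_) ℬ))
                    (relabelAll-id (λ _ → inverseˡ π) ℬ)))
  ; trans = λ {ℬ} (π , p) (ρ , q) → π ∘ₚ ρ ,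
      ≋-trans (≡⇒≋ (relabelAll-∘ (ρ ⟨$⟩ʳ_) (π ⟨$⟩ʳ_) ℬ))
        (≋-trans (relabelAll-cong (ρ ⟨$⟩ʳ_) p) q)
  }

------------------------------------------------------------------------
-- Decidability

anyTriple? : {P : Pred (Triple v) 0ℓ} → Decidable₁ P → Dec (∃ P)
anyTriple? P? =
  map′ (λ (a , b , c , p) → (a , b , c) , p) (λ ((a , b , c) , p) → a , b , c , p)
    (any? λ a → any? λ b → any? λ c → P? (a , b , c))

allTriples? : {P : Pred (Triple v) 0ℓ} → Decidable₁ P → Dec (∀ C → P C)
allTriples? P? =
  map′ (λ h (a , b , c) → h a b c) (λ h a b c → h (a , b , c))
    (all? λ a → all? λ b → all? λ c → P? (a , b , c))

infixr 1 _⇔-dec_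
_⇔-dec_ : {A B : Set} → Dec A → Dec B → Dec (A ⇔ B)
a? ⇔-dec b? =
  map′ (λ (f , g) → mk⇔ f g) (λ e → to e , from e) ((a? →-dec b?) ×-dec (b? →-dec a?))

samePair? : (x y a b : Fin v) → Dec (SamePair x y a b)
samePair? x y a b = (x ≟ a ×-dec y ≟ b) ⊎-dec (x ≟ b ×-dec y ≟ a)

edge? : (C : Triple v) (x y : Fin v) → Dec (Edge C x y)
edge? (a , b , c) x y = samePair? x y a b ⊎-dec samePair? x y b c ⊎-dec samePair? x y c a

_≈?_ : Decidable (_≈_ {v})
C ≈? D = all? λ x → all? λ y → edge? C x y ⇔-dec edge? D x y

_∈?_ : Decidable (_∈_ {v})
C ∈? ℬ = Any.any? (C ≈?_) ℬ

_≋?_ : Decidable (_≋_ {v})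
ℬ ≋? ℬ′ = allTriples? λ C → (C ∈? ℬ) ⇔-dec (C ∈? ℬ′)

isTriangle? : Decidable₁ (IsTriangle {v})
isTriangle? (a , b , c) = ¬? (a ≟ b) ×-dec ¬? (b ≟ c) ×-dec ¬? (c ≟ a)

∃!? : {P : Pred (Triple v) 0ℓ} → Decidable₁ P → Dec (∃! _≈_ P)
∃!? P? =
  map′ (λ (C , p , h) → C , p , λ {D} → h D) (λ (C , p , h) → C , p , λ D → h {D})
    (anyTriple? λ C → P? C ×-dec allTriples? λ D → P? D →-dec C ≈? D)

isSTS? : Decidable₁ (IsSTS {v})
isSTS? ℬ =
  map′ (λ (t , p) → record { triangles = t ; partition = p })
       (λ s → IsSTS.triangles s , IsSTS.partition s)
    ((allTriples? λ C → (C ∈? ℬ) →-dec isTriangle? C) ×-dec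
     (all? λ x → all? λ y → ¬? (x ≟ y) →-dec ∃!? λ C → (C ∈? ℬ) ×-dec edge? C x y))

translationInvariant? : Decidable₁ (TranslationInvariant {v})
translationInvariant? ℬ =
  all? λ z → allTriples? λ B → (B ∈? ℬ) →-dec (relabel (_⊕ z) B ∈? ℬ)

anyPermutation? : {P : Pred (System v) 0ℓ} → Decidable₁ P → (ℬ : System v) →
                  Dec (∃[ π ] P (relabelAll (_⟨$⟩ʳ_ {v} {v} π) ℬ))
anyPermutation? {v} {P} P? ℬ = map′ toπ fromπ
  (any? λ i → any? λ j →
    (all? λ x → finToFun i (finToFun j x) ≟ x) ×-dec
    (all? λ x → finToFun j (finToFun i x) ≟ x) ×-dec
    P? (relabelAll (finToFun i) ℬ))
  where
  toπ   = λ (i , j , l , r , p) → permutation (finToFun i) (finToFun j) l r , p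
  fromπ = λ (π , p) →
    let f≗ = finToFun-funToFin (π ⟨$⟩ʳ_)
        g≗ = finToFun-funToFin (π ⟨$⟩ˡ_)
    in funToFin (π ⟨$⟩ʳ_) , funToFin (π ⟨$⟩ˡ_)
     , (λ x → trans (f≗ _) (trans (cong (π ⟨$⟩ʳ_) (g≗ x)) (inverseʳ π)))
     , (λ x → trans (g≗ _) (trans (cong (π ⟨$⟩ˡ_) (f≗ x)) (inverseˡ π)))
     , subst P (sym (relabelAll-≗ f≗ ℬ)) p

isCyclicSTS? : Decidable₁ (IsCyclicSTS {v})
isCyclicSTS? ℬ = isSTS? ℬ ×-dec anyPermutation? translationInvariant? ℬ

_≅?_ : Decidable (_≅_ {v})
ℬ ≅? ℬ′ = anyPermutation? (_≋? ℬ′) ℬ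

≅-decSetoid : ℕ → DecSetoid 0ℓ 0ℓ
≅-decSetoid v = record
  { Carrier          = System v
  ; _≈_              = _≅_
  ; isDecEquivalence = record { isEquivalence = ≅-isEquivalence ; _≟_ = _≅?_ }
  }

------------------------------------------------------------------------
-- The number of cyclic STS(v)s up to isomorphism

sublists : {A : Set} → List A → List (List A)
sublists []       = [ [] ]
sublists (x ∷ xs) = map (x ∷_) (sublists xs) ++ sublists xs

allTriples : ∀ v → List (Triple v)
allTriples v = cartesianProduct (allFin v) (cartesianProduct (allFin v) (allFin v))

cyclicSTSs : ∀ v → List (System v)
cyclicSTSs v = filter isCyclicSTS? (sublists (allTriples v))

representatives : ∀ v → List (System v)
representatives v = deduplicate _≅?_ (cyclicSTSs v)

NC : ℕ → ℕ
NC v = length (representatives v)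

------------------------------------------------------------------------
-- representatives v is a transversal of the isomorphism classes

representatives-cyclicSTS : ∀ v → All IsCyclicSTS (representatives v)
representatives-cyclicSTS v =
  deduplicate⁺ _≅?_ (all-filter isCyclicSTS? (sublists (allTriples v)))

representatives-distinct : ∀ v → AllPairs (λ ℬ ℬ′ → ¬ (ℬ ≅ ℬ′)) (representatives v)
representatives-distinct v = deduplicate-! (≅-decSetoid v) (cyclicSTSs v)

IsSTS-resp-≋ : {ℬ ℬ′ : System v} → ℬ ≋ ℬ′ → IsSTS ℬ → IsSTS ℬ′
IsSTS-resp-≋ eq s = record
  { triangles = λ C C∈ → IsSTS.triangles s C (from (eq C) C∈)
  ; partition = λ x y x≢y →
      let C , (C∈ , e) , h = IsSTS.partition s x y x≢y
      in C , (to (eq C) C∈ , e) , λ {D} (D∈ , e′) → h {D} (from (eq D) D∈ , e′)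
  }

IsCyclic-resp-≋ : {ℬ ℬ′ : System v} → ℬ ≋ ℬ′ → IsCyclic ℬ → IsCyclic ℬ′
IsCyclic-resp-≋ {ℬ = ℬ} {ℬ′} eq (π , inv) = π , λ z B B∈ →
  to (eq′ (relabel (_⊕ z) B)) (inv z B (from (eq′ B) B∈))
  where
  eq′ : relabelAll (π ⟨$⟩ʳ_) ℬ ≋ relabelAll (π ⟨$⟩ʳ_) ℬ′
  eq′ = relabelAll-cong (π ⟨$⟩ʳ_) eq

filter∈sublists : {A : Set} {P : Pred A 0ℓ} (P? : Decidable₁ P) (xs : List A) →
                  filter P? xs ∈ₚ sublists xs
filter∈sublists P? []       = here refl
filter∈sublists P? (x ∷ xs) with P? x
... | yes _ = ∈-++⁺ˡ (∈-map⁺ (x ∷_) (filter∈sublists P? xs))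
... | no  _ = ∈-++⁺ʳ (map (x ∷_) (sublists xs)) (filter∈sublists P? xs)

∈-allTriples : (C : Triple v) → C ∈ₚ allTriples v
∈-allTriples (a , b , c) =
  ∈-cartesianProduct⁺ (∈-allFin a) (∈-cartesianProduct⁺ (∈-allFin b) (∈-allFin c))

canonical : System v → System v
canonical {v} ℬ = filter (_∈? ℬ) (allTriples v)

canonical-≋ : (ℬ : System v) → ℬ ≋ canonical ℬ
canonical-≋ {v} ℬ C = mk⇔
  (λ C∈ → Any.map (λ { refl → Setoid.refl S {C} }) (∈-filter⁺ (_∈? ℬ) (∈-allTriples C) C∈))
  (λ C∈ → proj₂ (Membershipₚ.∈-filter⁻ S (_∈? ℬ) (Membershipₚ.∈-resp-≈ S) {C} {allTriples v} C∈))
  where S = cycleSetoid v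

representatives-complete : (ℬ : System v) → IsCyclicSTS ℬ → Any (ℬ ≅_) (representatives v)
representatives-complete {v} ℬ (sts , cyc) =
  Membershipₚ.∈-deduplicate⁺ S _≅?_ (λ {x} {y} {z} → respʳ-flip S {x} {y} {z})
    (Any.map (λ { refl → ≋⇒≅ eq })
      (∈-filter⁺ isCyclicSTS? (filter∈sublists (_∈? ℬ) (allTriples v))
        (IsSTS-resp-≋ eq sts , IsCyclic-resp-≋ eq cyc)))
  where
  S  = DecSetoid.setoid (≅-decSetoid v)
  eq = canonical-≋ ℬ

{-# OPTIONS --safe #-}
module Submission where

-- A cyclic STS(v) on ℤ_v amounts to an involution g of ℤ_v with g 0 = 0 and
-- g (− d) = g d − d, where 0, d and g d form a block.  For v = 6n + 3 such
-- involutions come from partitions of {1,…,3n+1} ∖ {2n+1} into triples with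
-- a + b = c or a + b + c = v, each taken in one of two orientations.  If p and
-- x ↦ x + p(x) permute {−4,…,4}, then the intervals of length 9 centred at a, b
-- and a + b split into the nine triples (a + x , b + p(x) , a + b + x + p(x)).
-- A Skolem-type arrangement of such triples of intervals covers all but O(1)
-- numbers, and these are partitioned by a table depending on n mod 36.  Using
-- 128 of the 244 possible p, every nine triples allow 128 · 2⁹ = 2¹⁶ choices,
-- so about 2^(16n/9) > 3.42ⁿ distinct systems arise.  Only v^O(log v) of them
-- lie in one isomorphism class: the translation x ↦ x + 1, carried along an
-- isomorphism, is an automorphism of a fixed system, and automorphisms are
-- determined by their values at log₂ v points, because adjoining a point to a
-- subsystem at least doubles it.

open import Defs renaming (_∈_ to _∈ₛ_)
open import Algebra.Bundles using (AbelianGroup)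
import Algebra.Properties.AbelianGroup as AbelianGroupₚ
open import Data.Empty using (⊥-elim)
open import Data.Fin.Base
  using (Fin; zero; suc; toℕ; fromℕ<; punchOut; combine; remQuot; opposite; finToFun; funToFin)
open import Data.Fin.Permutation using (Permutation′; _⟨$⟩ʳ_; _⟨$⟩ˡ_; _∘ₚ_; flip; inverseˡ; inverseʳ)
  renaming (id to idₚ)
open import Data.Fin.Properties
  using (_≟_; any?; all?; toℕ<n; toℕ-injective; toℕ-fromℕ<; toℕ-combine; injective⇒≤; punchOut-injective
        ; combine-remQuot; remQuot-combine; opposite-prop; opposite-involutive; funToFin-finToFin)
import Data.Integer.Base as ℤ
import Data.Integer.Properties as ℤₚ
open import Data.List.Base
  using (List; []; _∷_; _++_; map; concatMap; filter; tabulate; allFin; cartesianProduct; length; lookup)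
open import Data.List.Membership.Propositional using (_∈_; _∉_; find; lose)
open import Data.List.Membership.Propositional.Properties
  using (∈-allFin; ∈-cartesianProduct⁺; ∈-map⁺; ∈-map⁻; ∈-filter⁺; ∈-filter⁻; ∈-lookup; ∈-++⁺ˡ; ∈-++⁺ʳ; ∈-++⁻
        ; ∈-concatMap⁺; ∈-concatMap⁻; ∈-tabulate⁺)
import Data.List.Membership.Setoid.Properties as Membershipₚ
open import Data.List.Properties using (length-++; length-map; length-tabulate; filter-notAll)
open import Data.List.Relation.Binary.Subset.Propositional using (_⊆_)
open import Data.List.Relation.Unary.All as All using (All)
import Data.List.Relation.Unary.AllPairs as AllPairs
open import Data.List.Relation.Unary.Any as Any using (Any; here; there)
import Data.List.Relation.Unary.Any.Properties as Anyₚ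
open import Data.List.Relation.Unary.Unique.Propositional using (Unique)
import Data.List.Relation.Unary.Unique.Propositional.Properties as Uniqueₚ
open import Data.Nat.Base as ℕ
  using (ℕ; zero; suc; pred; NonZero; _+_; _*_; _∸_; _%_; _≤_; _<_; _≥_; z≤n; s≤s)
open import Data.Nat.DivMod
  using (_mod_; m≡m%n+[m/n]*n; m%n<n; m<n⇒m%n≡m; %-distribˡ-+; [m+n]%n≡m%n)
import Data.Nat.Properties as ℕₚ
open import Data.Nat.Tactic.RingSolver using (solve-∀)
open import Data.Product.Base using (∃-syntax; _×_; _,_; proj₁; proj₂; uncurry)
open import Data.Rational.Base as ℚ using (toℚᵘ; +-*-rawSemiring)
import Data.Rational.Properties as ℚₚ
open import Data.Rational.Unnormalised.Base as ℚᵘ using (mkℚᵘ; *≤*)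
import Data.Rational.Unnormalised.Properties as ℚᵘₚ
open import Algebra.Definitions.RawSemiring +-*-rawSemiring using () renaming (_^_ to _ℚ^_)
open import Data.Sum.Base using (_⊎_; inj₁; inj₂)
open import Data.Vec.Base as Vec using (Vec; []; _∷_)
open import Function.Base using (_∘_)
open import Function.Bundles using (mk⇔; Equivalence)
open import Level using (0ℓ)
open import Relation.Binary.Bundles using (Setoid)
open import Relation.Binary.PropositionalEquality hiding (J; [_])
open import Relation.Binary.Structures using (IsEquivalence)
open import Relation.Nullary using (¬_; Dec; yes; no; ¬?; from-yes)
open import Relation.Nullary.Decidable using (_×-dec_; _⊎-dec_; _→-dec_; map′)

-- Nine is the least length that reaches 3.35 in this way. The length must be odd, since x + p(x)
-- has to run through as many consecutive integers as x and p(x) do; length 7 admits only 28 maps p,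
-- and (28 · 2⁷)^(1/7) ≈ 3.22. Length 9 leaves enough room to keep 128 = 2⁷ of the 244 maps and to
-- count in powers of two. As 36 · log₂ 3.35 ≈ 62.8, every 36 triples, worth 2⁶⁴ choices, can give
-- up a factor 2. The resulting 2^κ, with κ about n/36, outweighs both the v^O(log v) systems of one
-- class and the choices to which the O(1) leftover triples contribute nothing. Disjointness of the
-- differences is never verified. The n base triangles and the short orbit list exactly 6n + 3 = v
-- pairs (d , g d); if every residue occurs as a first component, each occurs only once. So the
-- arrangement only has to be shown to cover {1,...,3n+1}.

private variable
  v N M : ℕ
  X : Set

-- Residues modulo v as an abelian group

module ℤ/ (v : ℕ) {{_ : NonZero v}} where

  ⟦_⟧ : ℕ → Fin v
  ⟦ m ⟧ = m mod v

  toℕ-⟦⟧ : ∀ m → toℕ ⟦ m ⟧ ≡ m % v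
  toℕ-⟦⟧ m = toℕ-fromℕ< _

  toℕ-⟦⟧-< : ∀ {m} → m < v → toℕ ⟦ m ⟧ ≡ m
  toℕ-⟦⟧-< m<v = trans (toℕ-⟦⟧ _) (m<n⇒m%n≡m m<v)

  ⟦⟧-cong-% : ∀ {k m} → k % v ≡ m % v → ⟦ k ⟧ ≡ ⟦ m ⟧
  ⟦⟧-cong-% eq = toℕ-injective (trans (toℕ-⟦⟧ _) (trans eq (sym (toℕ-⟦⟧ _))))

  ⟦toℕ⟧ : ∀ x → ⟦ toℕ x ⟧ ≡ x
  ⟦toℕ⟧ x = toℕ-injective (toℕ-⟦⟧-< (toℕ<n x))

  ⟦⟧-+ : ∀ k m → ⟦ k + m ⟧ ≡ ⟦ k ⟧ ⊕ ⟦ m ⟧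
  ⟦⟧-+ k m = ⟦⟧-cong-% (trans (%-distribˡ-+ k m v)
    (cong₂ (λ i j → (i + j) % v) (sym (toℕ-⟦⟧ k)) (sym (toℕ-⟦⟧ m))))

  ⟦v⟧≡⟦0⟧ : ⟦ v ⟧ ≡ ⟦ 0 ⟧
  ⟦v⟧≡⟦0⟧ = ⟦⟧-cong-% ([m+n]%n≡m%n 0 v)

  infix 8 ⊖_
  ⊖_ : Fin v → Fin v
  ⊖ x = ⟦ v ∸ toℕ x ⟧

  ⊕-comm : ∀ x y → x ⊕ y ≡ y ⊕ x
  ⊕-comm x y = cong ⟦_⟧ (ℕₚ.+-comm (toℕ x) (toℕ y))

  ⊕-identityˡ : ∀ x → ⟦ 0 ⟧ ⊕ x ≡ x
  ⊕-identityˡ x = trans (cong (⟦ 0 ⟧ ⊕_) (sym (⟦toℕ⟧ x))) (trans (sym (⟦⟧-+ 0 (toℕ x))) (⟦toℕ⟧ x))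

  ⊕-identityʳ : ∀ x → x ⊕ ⟦ 0 ⟧ ≡ x
  ⊕-identityʳ x = trans (⊕-comm x ⟦ 0 ⟧) (⊕-identityˡ x)

  ⊕-assoc : ∀ x y z → (x ⊕ y) ⊕ z ≡ x ⊕ (y ⊕ z)
  ⊕-assoc x y z = begin
    (x ⊕ y) ⊕ z                    ≡⟨ cong (x ⊕ y ⊕_) (⟦toℕ⟧ z) ⟨
    ⟦ toℕ x + toℕ y ⟧ ⊕ ⟦ toℕ z ⟧  ≡⟨ ⟦⟧-+ (toℕ x + toℕ y) (toℕ z) ⟨
    ⟦ toℕ x + toℕ y + toℕ z ⟧      ≡⟨ cong ⟦_⟧ (ℕₚ.+-assoc (toℕ x) (toℕ y) (toℕ z)) ⟩
    ⟦ toℕ x + (toℕ y + toℕ z) ⟧    ≡⟨ ⟦⟧-+ (toℕ x) (toℕ y + toℕ z) ⟩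
    ⟦ toℕ x ⟧ ⊕ (y ⊕ z)            ≡⟨ cong (_⊕ (y ⊕ z)) (⟦toℕ⟧ x) ⟩
    x ⊕ (y ⊕ z)                    ∎
    where open ≡-Reasoning

  ⊕-inverseˡ : ∀ x → ⊖ x ⊕ x ≡ ⟦ 0 ⟧
  ⊕-inverseˡ x = begin
    ⊖ x ⊕ x                 ≡⟨ cong (⊖ x ⊕_) (⟦toℕ⟧ x) ⟨
    ⊖ x ⊕ ⟦ toℕ x ⟧         ≡⟨ ⟦⟧-+ (v ∸ toℕ x) (toℕ x) ⟨
    ⟦ v ∸ toℕ x + toℕ x ⟧   ≡⟨ cong ⟦_⟧ (ℕₚ.m∸n+n≡m (ℕₚ.<⇒≤ (toℕ<n x))) ⟩
    ⟦ v ⟧                   ≡⟨ ⟦v⟧≡⟦0⟧ ⟩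
    ⟦ 0 ⟧                   ∎
    where open ≡-Reasoning

  ⊕-abelianGroup : AbelianGroup 0ℓ 0ℓ
  ⊕-abelianGroup = record
    { Carrier = Fin v ; _≈_ = _≡_ ; _∙_ = _⊕_ ; ε = ⟦ 0 ⟧ ; _⁻¹ = ⊖_
    ; isAbelianGroup = record
      { isGroup = record
        { isMonoid = record
          { isSemigroup = record
            { isMagma = record { isEquivalence = isEquivalence ; ∙-cong = cong₂ _⊕_ }
            ; assoc = ⊕-assoc
            }
          ; identity = ⊕-identityˡ , ⊕-identityʳ
          }
        ; inverse = ⊕-inverseˡ , λ x → trans (⊕-comm x (⊖ x)) (⊕-inverseˡ x)
        ; ⁻¹-cong = cong ⊖_
        }
      ; comm = ⊕-comm
      }
    }

  open AbelianGroup ⊕-abelianGroup public using () renaming (inverseʳ to ⊕-inverseʳ)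
  open AbelianGroupₚ ⊕-abelianGroup public
    using (xyx⁻¹≈y; ⁻¹-∙-comm; ⁻¹-involutive; inverseʳ-unique; inverseˡ-unique; ε⁻¹≈ε; ⁻¹-anti-homo-∙; ⁻¹-injective; \\-leftDividesʳ; \\-leftDividesˡ
          ; ⁻¹-anti-homo-//; //-rightDividesʳ; //-rightDividesˡ; ∙-cancelˡ; ∙-cancelʳ)

  ⟦⟧-⊖ : ∀ {k m} → k + m ≡ v → ⟦ m ⟧ ≡ ⊖ ⟦ k ⟧
  ⟦⟧-⊖ {k} {m} eq = inverseʳ-unique ⟦ k ⟧ ⟦ m ⟧
    (trans (sym (⟦⟧-+ k m)) (trans (cong ⟦_⟧ eq) ⟦v⟧≡⟦0⟧))

-- Steiner quasigroups and their triple systems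

-- The operation of a Steiner quasigroup: x ∙ y is the third point of the
-- block through x and y.
record IsSteiner (_∙_ : Fin v → Fin v → Fin v) : Set where
  field
    idem  : ∀ x → x ∙ x ≡ x
    comm  : ∀ x y → x ∙ y ≡ y ∙ x
    invol : ∀ x y → x ∙ (x ∙ y) ≡ y

  x∙y≢x : ∀ {x y} → x ≢ y → x ∙ y ≢ x
  x∙y≢x {x} {y} x≢y eq = x≢y (trans (sym (idem x)) (trans (cong (x ∙_) (sym eq)) (invol x y)))

  x∙y≢y : ∀ {x y} → x ≢ y → x ∙ y ≢ y
  x∙y≢y {x} {y} x≢y eq = x∙y≢x (x≢y ∘ sym) (trans (comm y x) eq)

  ∙-cancelˡ : ∀ x {y z} → x ∙ y ≡ x ∙ z → y ≡ z
  ∙-cancelˡ x {y} {z} eq = trans (sym (invol x y)) (trans (cong (x ∙_) eq) (invol x z))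

≈-refl : (C : Triple v) → C ≈ C
≈-refl {v} C = Setoid.refl (cycleSetoid v) {C}

≈-sym : (C D : Triple v) → C ≈ D → D ≈ C
≈-sym {v} C D = Setoid.sym (cycleSetoid v) {C} {D}

≈-trans : (C D E : Triple v) → C ≈ D → D ≈ E → C ≈ E
≈-trans {v} C D E = Setoid.trans (cycleSetoid v) {C} {D} {E}

rotate : (a b c : Fin v) → (a , b , c) ≈ (b , c , a)
rotate a b c x y = mk⇔
  (λ { (inj₁ p) → inj₂ (inj₂ p) ; (inj₂ (inj₁ p)) → inj₁ p ; (inj₂ (inj₂ p)) → inj₂ (inj₁ p) })
  (λ { (inj₁ p) → inj₂ (inj₁ p) ; (inj₂ (inj₁ p)) → inj₂ (inj₂ p) ; (inj₂ (inj₂ p)) → inj₁ p })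

transpose : (a b c : Fin v) → (a , b , c) ≈ (b , a , c)
transpose a b c x y = mk⇔ (exchange a b) (exchange b a)
  where
  swap : ∀ {p q} → SamePair x y p q → SamePair x y q p
  swap (inj₁ e) = inj₂ e
  swap (inj₂ e) = inj₁ e
  exchange : ∀ a b → Edge (a , b , c) x y → Edge (b , a , c) x y
  exchange a b (inj₁ p)        = inj₁ (swap p)
  exchange a b (inj₂ (inj₁ p)) = inj₂ (inj₂ (swap p))
  exchange a b (inj₂ (inj₂ p)) = inj₂ (inj₁ (swap p))

-- Together with its converse this makes distinctness of the vertices a property of the edge
-- relation alone, so that it passes between triples that are `≈`.
loopless⇒triangle : ∀ (C : Triple v) → (∀ x → ¬ Edge C x x) → IsTriangle C
loopless⇒triangle (a , b , c) ¬loop =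
    (λ { refl → ¬loop a (inj₁ (inj₁ (refl , refl))) })
  , (λ { refl → ¬loop b (inj₂ (inj₁ (inj₁ (refl , refl)))) })
  , (λ { refl → ¬loop c (inj₂ (inj₂ (inj₁ (refl , refl)))) })

triangle⇒loopless : ∀ (C : Triple v) → IsTriangle C → ∀ x → ¬ Edge C x x
triangle⇒loopless C (a≢b , b≢c , c≢a) x (inj₁ (inj₁ (p , q)))        = a≢b (trans (sym p) q)
triangle⇒loopless C (a≢b , b≢c , c≢a) x (inj₁ (inj₂ (p , q)))        = a≢b (trans (sym q) p)
triangle⇒loopless C (a≢b , b≢c , c≢a) x (inj₂ (inj₁ (inj₁ (p , q)))) = b≢c (trans (sym p) q)
triangle⇒loopless C (a≢b , b≢c , c≢a) x (inj₂ (inj₁ (inj₂ (p , q)))) = b≢c (trans (sym q) p)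
triangle⇒loopless C (a≢b , b≢c , c≢a) x (inj₂ (inj₂ (inj₁ (p , q)))) = c≢a (trans (sym p) q)
triangle⇒loopless C (a≢b , b≢c , c≢a) x (inj₂ (inj₂ (inj₂ (p , q)))) = c≢a (trans (sym q) p)

third-unique : {a b c d : Fin v} → IsTriangle (a , b , c) → (a , b , c) ≈ (a , b , d) → c ≡ d
third-unique {b = b} {c} (a≢b , b≢c , c≢a) eq
  with Equivalence.to (eq b c) (inj₂ (inj₁ (inj₁ (refl , refl))))
... | inj₁ (inj₁ (p , _))        = ⊥-elim (a≢b (sym p))
... | inj₁ (inj₂ (_ , q))        = ⊥-elim (c≢a q)
... | inj₂ (inj₁ (inj₁ (_ , q))) = q
... | inj₂ (inj₁ (inj₂ (_ , q))) = ⊥-elim (b≢c (sym q))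
... | inj₂ (inj₂ (inj₁ (_ , q))) = ⊥-elim (c≢a q)
... | inj₂ (inj₂ (inj₂ (p , _))) = ⊥-elim (a≢b (sym p))

block : (Fin v → Fin v → Fin v) → Fin v × Fin v → Triple v
block _∙_ (x , y) = x , y , x ∙ y

distinct? : (p : Fin v × Fin v) → _
distinct? (x , y) = ¬? (x ≟ y)

-- Every block is listed six times, once for each ordered pair of its points. A `System` ignores the
-- repetition, and membership of the block through two given points is immediate.
system : (Fin v → Fin v → Fin v) → System v
system {v} _∙_ = map (block _∙_) (filter distinct? (cartesianProduct (allFin v) (allFin v)))

∈-resp-≈ : {ℬ : System v} {C D : Triple v} → C ≈ D → C ∈ₛ ℬ → D ∈ₛ ℬ
∈-resp-≈ {v} {ℬ} {C} {D} = Membershipₚ.∈-resp-≈ (cycleSetoid v) {ℬ} {C} {D}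

module _ {_∙_ : Fin v → Fin v → Fin v} where

  block∈system : ∀ {x y} → x ≢ y → block _∙_ (x , y) ∈ₛ system _∙_
  block∈system {x} {y} x≢y = Any.map (λ { refl → ≈-refl (block _∙_ (x , y)) })
    (∈-map⁺ (block _∙_) (∈-filter⁺ distinct? (∈-cartesianProduct⁺ (∈-allFin x) (∈-allFin y)) x≢y))

  ∈system⁻ : ∀ {C} → C ∈ₛ system _∙_ → ∃[ x ] ∃[ y ] x ≢ y × C ≈ block _∙_ (x , y)
  ∈system⁻ C∈ with find (Anyₚ.map⁻ C∈)
  ... | (x , y) , xy∈ , C≈ =
    x , y , proj₂ (∈-filter⁻ distinct? {xs = cartesianProduct (allFin v) (allFin v)} xy∈) , C≈

module Steiner {_∙_ : Fin v → Fin v → Fin v} (S : IsSteiner _∙_) where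
  open IsSteiner S

  block-triangle : ∀ {x y} → x ≢ y → IsTriangle (block _∙_ (x , y))
  block-triangle x≢y = x≢y , x∙y≢y x≢y ∘ sym , x∙y≢x x≢y

  -- With r = p ∙ q also q ∙ r = p and r ∙ p = q, so each of the six ordered edges generates a
  -- rotation of the block or the reverse of one.
  block-unique : ∀ {p q x y} → Edge (block _∙_ (p , q)) x y → block _∙_ (x , y) ≈ block _∙_ (p , q)
  block-unique {p} {q} e = go e
    where
    r = p ∙ q
    B = block _∙_ (p , q)
    q∙r : q ∙ r ≡ p
    q∙r = trans (cong (q ∙_) (comm p q)) (invol q p)
    r∙p : r ∙ p ≡ q
    r∙p = trans (comm r p) (invol p q)
    third : ∀ {x y z} → x ∙ y ≡ z → (x , y , z) ≈ B → block _∙_ (x , y) ≈ B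
    third refl eq = eq
    reversed : ∀ {x y z} → x ∙ y ≡ z → (x , y , z) ≈ B → block _∙_ (y , x) ≈ B
    reversed {x} {y} {z} eq h =
      third (trans (comm y x) eq) (≈-trans (y , x , z) (x , y , z) B (transpose y x z) h)
    h₁ = ≈-refl B
    h₂ : (q , r , p) ≈ B
    h₂ = ≈-sym B (q , r , p) (rotate p q r)
    h₃ : (r , p , q) ≈ B
    h₃ = rotate r p q
    go : ∀ {x y} → Edge B x y → block _∙_ (x , y) ≈ B
    go (inj₁ (inj₁ (refl , refl)))        = h₁
    go (inj₁ (inj₂ (refl , refl)))        = reversed refl h₁
    go (inj₂ (inj₁ (inj₁ (refl , refl)))) = third q∙r h₂
    go (inj₂ (inj₁ (inj₂ (refl , refl)))) = reversed q∙r h₂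
    go (inj₂ (inj₂ (inj₁ (refl , refl)))) = third r∙p h₃
    go (inj₂ (inj₂ (inj₂ (refl , refl)))) = reversed r∙p h₃

  ∈system-unique : ∀ {C x y} → C ∈ₛ system _∙_ → Edge C x y → block _∙_ (x , y) ≈ C
  ∈system-unique {C} {x} {y} C∈ e with ∈system⁻ {_∙_ = _∙_} {C = C} C∈
  ... | p , q , _ , C≈ = ≈-trans (block _∙_ (x , y)) (block _∙_ (p , q)) C
    (block-unique (Equivalence.to (C≈ x y) e)) (≈-sym C (block _∙_ (p , q)) C≈)

  system-triangle : ∀ C → C ∈ₛ system _∙_ → IsTriangle C
  system-triangle C C∈ with ∈system⁻ {_∙_ = _∙_} {C = C} C∈
  ... | p , q , p≢q , C≈ = loopless⇒triangle C λ x e →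
    triangle⇒loopless (block _∙_ (p , q)) (block-triangle p≢q) x (Equivalence.to (C≈ x x) e)

  system-IsSTS : IsSTS (system _∙_)
  system-IsSTS = record
    { triangles = system-triangle
    ; partition = λ x y x≢y → block _∙_ (x , y)
        , (block∈system x≢y , inj₁ (inj₁ (refl , refl)))
        , λ {D} (D∈ , e) → ∈system-unique {D} D∈ e
    }

  triple∈system : ∀ {x y z} → (x , y , z) ∈ₛ system _∙_ → x ∙ y ≡ z
  triple∈system {x} {y} {z} t∈ =
    third-unique (block-triangle (proj₁ (system-triangle _ t∈)))
      (∈system-unique {x , y , z} t∈ (inj₁ (inj₁ (refl , refl))))

-- The block through x and y is carried to a block of the second system, where `triple∈system` reads
-- off its third point; on the diagonal both sides collapse by idempotence.
isomorphism⇒homomorphism : {_∙_ _∘′_ : Fin v → Fin v → Fin v} → IsSteiner _∙_ → IsSteiner _∘′_ →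
  (π : Permutation′ v) → relabelAll (π ⟨$⟩ʳ_) (system _∙_) ≋ system _∘′_ →
  ∀ x y → π ⟨$⟩ʳ (x ∙ y) ≡ (π ⟨$⟩ʳ x) ∘′ (π ⟨$⟩ʳ y)
isomorphism⇒homomorphism {v} {_∙_} {_∘′_} S S′ π eq x y with x ≟ y
... | yes refl = trans (cong (π ⟨$⟩ʳ_) (IsSteiner.idem S x)) (sym (IsSteiner.idem S′ _))
... | no x≢y = sym (Steiner.triple∈system S′ (Equivalence.to (eq _)
  (Membershipₚ.∈-map⁺ (cycleSetoid v) (cycleSetoid v)
    (λ {A} {B} → relabel-cong (π ⟨$⟩ʳ_) {A} {B}) {block _∙_ (x , y)} (block∈system {_∙_ = _∙_} x≢y))))

record IsCyclicSteiner (_∙_ : Fin v → Fin v → Fin v) : Set where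
  field
    isSteiner : IsSteiner _∙_
    shift     : ∀ x y z → (x ⊕ z) ∙ (y ⊕ z) ≡ (x ∙ y) ⊕ z

module _ {{_ : NonZero v}} {_∙_ : Fin v → Fin v → Fin v} (S : IsCyclicSteiner _∙_) where
  open IsCyclicSteiner S
  open ℤ/ v

  system-translation : TranslationInvariant (system _∙_)
  system-translation z C C∈ with ∈system⁻ {_∙_ = _∙_} {C = C} C∈
  ... | x , y , x≢y , C≈ =
    ∈-resp-≈ {C = block _∙_ (x ⊕ z , y ⊕ z)} {D = relabel (_⊕ z) C}
      (subst (λ w → (x ⊕ z , y ⊕ z , w) ≈ relabel (_⊕ z) C) (sym (shift x y z))
        (relabel-cong (_⊕ z) {block _∙_ (x , y)} {C} (≈-sym C (block _∙_ (x , y)) C≈)))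
      (block∈system (x≢y ∘ ∙-cancelʳ z x y))

  system-IsCyclicSTS : IsCyclicSTS (system _∙_)
  system-IsCyclicSTS = Steiner.system-IsSTS isSteiner
    , idₚ , subst TranslationInvariant (sym (relabelAll-id (λ _ → refl) (system _∙_))) system-translation

-- Isomorphism classes

unique-lookup-injective : {xs : List X} → Unique xs → ∀ {i j} → lookup xs i ≡ lookup xs j → i ≡ j
unique-lookup-injective (_ AllPairs.∷ _)  {zero}  {zero}  _  = refl
unique-lookup-injective (x∉ AllPairs.∷ _) {zero}  {suc j} eq = ⊥-elim (All.lookup x∉ (∈-lookup j) eq)
unique-lookup-injective (x∉ AllPairs.∷ _) {suc i} {zero}  eq = ⊥-elim (All.lookup x∉ (∈-lookup i) (sym eq))
unique-lookup-injective (_ AllPairs.∷ u)  {suc i} {suc j} eq = cong suc (unique-lookup-injective u eq)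

unique-⊆⇒length≤ : {xs ys : List X} → Unique xs → xs ⊆ ys → length xs ≤ length ys
unique-⊆⇒length≤ {xs = xs} {ys} u xs⊆ys =
  injective⇒≤ {f = λ i → Any.index (xs⊆ys (∈-lookup i))} λ {i} {j} eq →
    unique-lookup-injective u (trans (Anyₚ.lookup-index (xs⊆ys (∈-lookup i)))
      (trans (cong (lookup ys) eq) (sym (Anyₚ.lookup-index (xs⊆ys (∈-lookup j))))))

length-filter-split : {P : X → Set} (P? : ∀ x → Dec (P x)) (xs : List X) →
  length xs ≡ length (filter P? xs) + length (filter (¬? ∘ P?) xs)
length-filter-split P? [] = refl
length-filter-split P? (x ∷ xs) with P? x
... | yes _ = cong suc (length-filter-split P? xs)
... | no  _ = trans (cong suc (length-filter-split P? xs)) (sym (ℕₚ.+-suc _ _))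

ConstantOn : {C : Set} → (X → C) → List X → Set
ConstantOn f xs = ∀ {a b} → a ∈ xs → b ∈ xs → f a ≡ f b

-- Pigeonhole, removing the fibre of the largest value first. The bound is asked of every
-- duplicate-free sublist on which `f` is constant, so that it survives the removal.
fibres-bound : (f : X → Fin N) {xs : List X} → Unique xs →
  (∀ {ys} → Unique ys → ys ⊆ xs → ConstantOn f ys → length ys ≤ M) → length xs ≤ N * M
fibres-bound {X = X} {N} {M} f {xs} u bound = go N xs u (λ a∈ → a∈) (λ _ → toℕ<n _)
  where
  go : ∀ n ys → Unique ys → ys ⊆ xs → (∀ {a} → a ∈ ys → toℕ (f a) < n) → length ys ≤ n * M
  go zero [] _ _ _ = z≤n
  go zero (y ∷ ys) _ _ <n = ⊥-elim (ℕₚ.n≮0 (<n (here refl)))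
  go (suc n) ys u ⊆xs <n = begin
    length ys                                              ≡⟨ length-filter-split top? ys ⟩
    length (filter top? ys) + length (filter (¬? ∘ top?) ys) ≤⟨ ℕₚ.+-mono-≤
      (bound (Uniqueₚ.filter⁺ top? u) (⊆xs ∘ proj₁ ∘ ∈-filter⁻ top?)
        (λ a∈ b∈ → toℕ-injective (trans (proj₂ (∈-filter⁻ top? {xs = ys} a∈)) (sym (proj₂ (∈-filter⁻ top? {xs = ys} b∈))))))
      (go n (filter (¬? ∘ top?) ys) (Uniqueₚ.filter⁺ (¬? ∘ top?) u) (⊆xs ∘ proj₁ ∘ ∈-filter⁻ (¬? ∘ top?))
        (λ a∈ → let a∈ys , ≢n = ∈-filter⁻ (¬? ∘ top?) {xs = ys} a∈ in ℕₚ.≤∧≢⇒< (ℕₚ.≤-pred (<n a∈ys)) ≢n)) ⟩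
    M + n * M ∎
    where
    open ℕₚ.≤-Reasoning
    top? : ∀ a → Dec (toℕ (f a) ≡ n)
    top? a = toℕ (f a) ℕₚ.≟ n

-- Counting homomorphisms by the set on which they agree

module _ {_∙_ : Fin v → Fin v → Fin v} (S : IsSteiner _∙_) (σ : X → Fin v → Fin v) where
  open IsSteiner S

  -- With `c` a member of `xs`, these are the points at which all maps of the list coincide. For
  -- homomorphisms they form a subsystem, by `agrees-∙`.
  Agrees : X → List X → Fin v → Set
  Agrees c xs x = All (λ a → σ a x ≡ σ c x) xs

  agrees? : ∀ c xs x → Dec (Agrees c xs x)
  agrees? c xs x = All.all? (λ a → σ a x ≟ σ c x) xs

  agreed : X → List X → List (Fin v)
  agreed c xs = filter (agrees? c xs) (allFin v)

  Homomorphic : List X → Set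
  Homomorphic xs = ∀ {a} → a ∈ xs → ∀ x y → σ a (x ∙ y) ≡ σ a x ∙ σ a y

  Separated : List X → Set
  Separated xs = ∀ {a b} → a ∈ xs → b ∈ xs → (∀ x → σ a x ≡ σ b x) → a ≡ b

  agrees-∙ : ∀ {c xs} → c ∈ xs → Homomorphic xs → ∀ {x y} →
             Agrees c xs x → Agrees c xs y → Agrees c xs (x ∙ y)
  agrees-∙ c∈ hom {x} {y} ax ay = All.tabulate λ {a} a∈ →
    trans (hom a∈ x y) (trans (cong₂ _∙_ (All.lookup ax a∈) (All.lookup ay a∈)) (sym (hom c∈ x y)))

  -- If x lies outside the set P of agreement, the maps taking one value at x
  -- agree on P, x and x ∙ P, which are disjoint because P is closed under _∙_.
  agreed-doubles : ∀ {c d xs ys x} → c ∈ xs → d ∈ ys → ys ⊆ xs → Homomorphic xs →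
    ¬ Agrees c xs x → ConstantOn (λ a → σ a x) ys →
    1 + (length (agreed c xs) + length (agreed c xs)) ≤ length (agreed d ys)
  agreed-doubles {c} {d} {xs} {ys} {x} c∈ d∈ ys⊆xs hom ¬ax const =
    subst (_≤ length (agreed d ys)) (cong suc (trans (length-++ P) (cong (length P +_) (length-map (x ∙_) P))))
      (unique-⊆⇒length≤ unique λ p∈ → ∈-filter⁺ (agrees? d ys) (∈-allFin _) (agrees p∈))
    where
    P = agreed c xs
    P⇒ : ∀ {p} → p ∈ P → Agrees c xs p
    P⇒ p∈ = proj₂ (∈-filter⁻ (agrees? c xs) {xs = allFin v} p∈)
    -- Since q ∙ (x ∙ q) = x, agreement at both q and x ∙ q would force agreement at x.
    new : ∀ {p} → p ∈ map (x ∙_) P → ¬ Agrees c xs p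
    new p∈ ap with ∈-map⁻ (x ∙_) p∈
    ... | q , q∈ , refl =
      ¬ax (subst (Agrees c xs) (trans (cong (q ∙_) (comm x q)) (invol q x)) (agrees-∙ c∈ hom (P⇒ q∈) ap))
    x∉ : ∀ {p} → p ∈ P ++ map (x ∙_) P → x ≢ p
    x∉ p∈ refl with ∈-++⁻ P p∈
    ... | inj₁ x∈P = ¬ax (P⇒ x∈P)
    ... | inj₂ x∈xP with ∈-map⁻ (x ∙_) x∈xP
    ...   | q , q∈ , eq = ¬ax (subst (Agrees c xs) (∙-cancelˡ x (trans (sym eq) (sym (idem x)))) (P⇒ q∈))
    unique : Unique (x ∷ P ++ map (x ∙_) P)
    unique =
      All.tabulate x∉ AllPairs.∷ Uniqueₚ.++⁺ P! (Uniqueₚ.map⁺ (∙-cancelˡ x) P!) (λ (p∈P , p∈xP) → new p∈xP (P⇒ p∈P))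
      where P! = Uniqueₚ.filter⁺ (agrees? c xs) (Uniqueₚ.allFin⁺ v)
    ax : Agrees d ys x
    ax = All.tabulate λ a∈ → const a∈ d∈
    restrict : ∀ {p} → Agrees c xs p → Agrees d ys p
    restrict ap = All.tabulate λ a∈ → trans (All.lookup ap (ys⊆xs a∈)) (sym (All.lookup ap (ys⊆xs d∈)))
    agrees : ∀ {p} → p ∈ x ∷ P ++ map (x ∙_) P → Agrees d ys p
    agrees (here refl) = ax
    agrees (there p∈) with ∈-++⁻ P p∈
    ... | inj₁ p∈P = restrict (P⇒ p∈P)
    ... | inj₂ p∈xP with ∈-map⁻ (x ∙_) p∈xP
    ...   | q , q∈ , refl = agrees-∙ d∈ (hom ∘ ys⊆xs) ax (restrict (P⇒ q∈))

  -- Fixing the value at a point of disagreement splits the list into at most v sublists and, by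
  -- `agreed-doubles`, replaces the number s of agreed points by at least 2s + 1. Thus 1 + s at
  -- least doubles, which is why the hypothesis speaks of 1 + s. Once it exceeds v no disagreement
  -- is left, and separation leaves a single map.
  homomorphisms-bound : {{_ : NonZero v}} → ∀ k {c xs} → c ∈ xs → Unique xs → Homomorphic xs → Separated xs →
    v < (1 + length (agreed c xs)) * 2 ℕ.^ k → length xs ≤ v ℕ.^ k
  homomorphisms-bound k {c} {xs} c∈ u hom sep v< with any? (¬? ∘ agrees? c xs)
  ... | no all-agree = ℕₚ.≤-trans
    (unique-⊆⇒length≤ {ys = c ∷ []} u λ a∈ → here (sep a∈ c∈ λ x → All.lookup (agree x) a∈))
    (ℕₚ.m^n>0 v k)
    where
    agree : ∀ x → Agrees c xs x
    agree x with agrees? c xs x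
    ... | yes ax = ax
    ... | no ¬ax = ⊥-elim (all-agree (x , ¬ax))
  -- Here v < 1 + s says that all v points agree, against `x`.
  homomorphisms-bound zero {c} {xs} c∈ u hom sep v< | yes (x , ¬ax) =
    ⊥-elim (ℕₚ.<⇒≱ v< (subst (_≤ v) (sym (ℕₚ.*-identityʳ _))
      (subst (length (agreed c xs) <_) (length-tabulate {n = v} (λ z → z))
        (filter-notAll (agrees? c xs) (allFin v) (Any.map (λ { refl → ¬ax }) (∈-allFin x))))))
  homomorphisms-bound (suc k) {c} {xs} c∈ u hom sep v< | yes (x , ¬ax) =
    fibres-bound (λ a → σ a x) u fibre
    where
    fibre : ∀ {ys} → Unique ys → ys ⊆ xs → ConstantOn (λ a → σ a x) ys → length ys ≤ v ℕ.^ k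
    fibre {[]} _ _ _ = z≤n
    fibre {ys@(d ∷ _)} u′ ys⊆xs const = homomorphisms-bound k (here refl) u′ (hom ∘ ys⊆xs)
      (λ a∈ b∈ → sep (ys⊆xs a∈) (ys⊆xs b∈)) (ℕₚ.<-≤-trans v< (begin
        (1 + s) * 2 ℕ.^ suc k       ≡⟨ ℕₚ.*-assoc (1 + s) 2 (2 ℕ.^ k) ⟨
        (1 + s) * 2 * 2 ℕ.^ k
          ≡⟨ cong (_* 2 ℕ.^ k) (trans (ℕₚ.*-comm (1 + s) 2) (cong (λ t → 1 + s + t) (ℕₚ.+-identityʳ (1 + s)))) ⟩
        (1 + (s + (1 + s))) * 2 ℕ.^ k ≡⟨ cong (λ t → (1 + t) * 2 ℕ.^ k) (ℕₚ.+-suc s s) ⟩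
        (1 + (1 + (s + s))) * 2 ℕ.^ k
          ≤⟨ ℕₚ.*-monoˡ-≤ (2 ℕ.^ k) (s≤s (agreed-doubles c∈ (here refl) ys⊆xs hom ¬ax const)) ⟩
        (1 + length (agreed d ys)) * 2 ℕ.^ k ∎))
      where
      open ℕₚ.≤-Reasoning
      s = length (agreed c xs)

common-target : {ℬ ℬ′ ℬ″ : System v} (π ρ : Permutation′ v) →
  relabelAll (π ⟨$⟩ʳ_) ℬ ≋ ℬ″ → relabelAll (ρ ⟨$⟩ʳ_) ℬ′ ≋ ℬ″ → relabelAll ((π ∘ₚ flip ρ) ⟨$⟩ʳ_) ℬ ≋ ℬ′
common-target {ℬ = ℬ} {ℬ′} {ℬ″} π ρ p q = proj₂
  (IsEquivalence.trans ≅-isEquivalence {i = ℬ} {j = ℬ″} {k = ℬ′} (π , p)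
    (IsEquivalence.sym ≅-isEquivalence {x = ℬ′} {y = ℬ″} (ρ , q)))

module Classes {{_ : NonZero v}} {I : Set} (T : I → Fin v → Fin v → Fin v) (T-cyclic : ∀ i → IsCyclicSteiner (T i))
  (ℛ : Fin N → System v) (class : I → Fin N) (iso : I → Permutation′ v)
  (iso-≋ : ∀ i → relabelAll (iso i ⟨$⟩ʳ_) (system (T i)) ≋ ℛ (class i)) where
  open ℤ/ v
  private
    T-steiner : ∀ i → IsSteiner (T i)
    T-steiner i = IsCyclicSteiner.isSteiner (T-cyclic i)

  module _ (c : I) where
    -- The systems of a class are compared with a member `c` of the class and not with the
    -- representative in `ℛ`: `system (T c)` comes with a quasigroup operation, the representative
    -- only as a list of triples.
    ρ : I → Permutation′ v
    ρ i = iso i ∘ₚ flip (iso c)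

    ρ-hom : ∀ {i} → class i ≡ class c → ∀ x y → ρ i ⟨$⟩ʳ (T i x y) ≡ T c (ρ i ⟨$⟩ʳ x) (ρ i ⟨$⟩ʳ y)
    ρ-hom {i} eq = isomorphism⇒homomorphism (T-steiner i) (T-steiner c) (ρ i)
      (common-target {ℬ = system (T i)} {ℬ′ = system (T c)} (iso i) (iso c) (iso-≋ i)
        (subst (λ j → relabelAll (iso c ⟨$⟩ʳ_) (system (T c)) ≋ ℛ j) (sym eq) (iso-≋ c)))

    -- The translation by 1 of the i-th system, transported to the c-th.
    σ : I → Fin v → Fin v
    σ i x = ρ i ⟨$⟩ʳ ((ρ i ⟨$⟩ˡ x) ⊕ ⟦ 1 ⟧)

    σ-hom : ∀ {i} → class i ≡ class c → ∀ x y → σ i (T c x y) ≡ T c (σ i x) (σ i y)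
    σ-hom {i} eq x y = begin
      ρ i ⟨$⟩ʳ ((ρ i ⟨$⟩ˡ T c x y) ⊕ ⟦ 1 ⟧)
        ≡⟨ cong (λ z → ρ i ⟨$⟩ʳ ((ρ i ⟨$⟩ˡ z) ⊕ ⟦ 1 ⟧)) (cong₂ (T c) (inverseʳ (ρ i)) (inverseʳ (ρ i))) ⟨
      ρ i ⟨$⟩ʳ ((ρ i ⟨$⟩ˡ T c (ρ i ⟨$⟩ʳ x′) (ρ i ⟨$⟩ʳ y′)) ⊕ ⟦ 1 ⟧)
        ≡⟨ cong (λ z → ρ i ⟨$⟩ʳ ((ρ i ⟨$⟩ˡ z) ⊕ ⟦ 1 ⟧)) (ρ-hom eq x′ y′) ⟨
      ρ i ⟨$⟩ʳ ((ρ i ⟨$⟩ˡ (ρ i ⟨$⟩ʳ T i x′ y′)) ⊕ ⟦ 1 ⟧)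
        ≡⟨ cong (λ z → ρ i ⟨$⟩ʳ (z ⊕ ⟦ 1 ⟧)) (inverseˡ (ρ i)) ⟩
      ρ i ⟨$⟩ʳ (T i x′ y′ ⊕ ⟦ 1 ⟧)
        ≡⟨ cong (ρ i ⟨$⟩ʳ_) (IsCyclicSteiner.shift (T-cyclic i) x′ y′ ⟦ 1 ⟧) ⟨
      ρ i ⟨$⟩ʳ T i (x′ ⊕ ⟦ 1 ⟧) (y′ ⊕ ⟦ 1 ⟧)         ≡⟨ ρ-hom eq _ _ ⟩
      T c (σ i x) (σ i y)                            ∎
      where
      open ≡-Reasoning
      x′ = ρ i ⟨$⟩ˡ x
      y′ = ρ i ⟨$⟩ˡ y

    -- By `step`, ρ(m + 1) = σ(ρ(m)), and 1 generates ℤ_v; so `ρ` is the orbit of its value at 0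
    -- under `σ`.
    ρ-determined : ∀ {i j} → ρ i ⟨$⟩ʳ ⟦ 0 ⟧ ≡ ρ j ⟨$⟩ʳ ⟦ 0 ⟧ → (∀ x → σ i x ≡ σ j x) →
                   ∀ x → ρ i ⟨$⟩ʳ x ≡ ρ j ⟨$⟩ʳ x
    ρ-determined {i} {j} eq₀ eqσ x = subst (λ x → ρ i ⟨$⟩ʳ x ≡ ρ j ⟨$⟩ʳ x) (⟦toℕ⟧ x) (go (toℕ x))
      where
      open ≡-Reasoning
      step : ∀ l m → ρ l ⟨$⟩ʳ ⟦ suc m ⟧ ≡ σ l (ρ l ⟨$⟩ʳ ⟦ m ⟧)
      step l m =
        cong (ρ l ⟨$⟩ʳ_) (trans (trans (⟦⟧-+ 1 m) (⊕-comm ⟦ 1 ⟧ ⟦ m ⟧)) (cong (_⊕ ⟦ 1 ⟧) (sym (inverseˡ (ρ l)))))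
      go : ∀ m → ρ i ⟨$⟩ʳ ⟦ m ⟧ ≡ ρ j ⟨$⟩ʳ ⟦ m ⟧
      go zero = eq₀
      go (suc m) = begin
        ρ i ⟨$⟩ʳ ⟦ suc m ⟧       ≡⟨ step i m ⟩
        σ i (ρ i ⟨$⟩ʳ ⟦ m ⟧)     ≡⟨ cong (σ i) (go m) ⟩
        σ i (ρ j ⟨$⟩ʳ ⟦ m ⟧)     ≡⟨ eqσ _ ⟩
        σ j (ρ j ⟨$⟩ʳ ⟦ m ⟧)     ≡⟨ step j m ⟨
        ρ j ⟨$⟩ʳ ⟦ suc m ⟧       ∎

    T-determined : ∀ {i j} → class i ≡ class c → class j ≡ class c →
      (∀ x → ρ i ⟨$⟩ʳ x ≡ ρ j ⟨$⟩ʳ x) → ∀ x y → T i x y ≡ T j x y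
    T-determined {i} {j} ci cj eq x y = begin
      T i x y                                ≡⟨ inverseˡ (ρ j) ⟨
      ρ j ⟨$⟩ˡ (ρ j ⟨$⟩ʳ T i x y)            ≡⟨ cong (ρ j ⟨$⟩ˡ_) (eq _) ⟨
      ρ j ⟨$⟩ˡ (ρ i ⟨$⟩ʳ T i x y)            ≡⟨ cong (ρ j ⟨$⟩ˡ_) (ρ-hom ci x y) ⟩
      ρ j ⟨$⟩ˡ T c (ρ i ⟨$⟩ʳ x) (ρ i ⟨$⟩ʳ y) ≡⟨ cong (ρ j ⟨$⟩ˡ_) (cong₂ (T c) (eq x) (eq y)) ⟩
      ρ j ⟨$⟩ˡ T c (ρ j ⟨$⟩ʳ x) (ρ j ⟨$⟩ʳ y) ≡⟨ cong (ρ j ⟨$⟩ˡ_) (ρ-hom cj x y) ⟨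
      ρ j ⟨$⟩ˡ (ρ j ⟨$⟩ʳ T j x y)            ≡⟨ inverseˡ (ρ j) ⟩
      T j x y                                ∎
      where open ≡-Reasoning

  -- There are `N` classes, at most v values of `ρ` at 0 and then, by `homomorphisms-bound`, at most
  -- v^k maps `σ`; these three data determine the operation.
  count : (∀ {i j} → (∀ x y → T i x y ≡ T j x y) → i ≡ j) →
    ∀ k {xs} → v < 2 ℕ.^ k → Unique xs → length xs ≤ N * (v * v ℕ.^ k)
  count T-injective k v< u = fibres-bound class u λ
    { {[]} _ _ _ → z≤n
    ; {ys@(c ∷ _)} u′ _ const → fibres-bound (λ i → ρ c i ⟨$⟩ʳ ⟦ 0 ⟧) u′ λ
      { {[]} _ _ _ → z≤n
      ; {zs@(d ∷ _)} u″ zs⊆ys const₀ →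
          let inClass = λ {i} (i∈ : i ∈ zs) → const (zs⊆ys i∈) (here refl) in
          homomorphisms-bound (T-steiner c) (σ c) k {c = d} (here refl) u″
            (λ i∈ → σ-hom c (inClass i∈))
            (λ i∈ j∈ eqσ → T-injective (T-determined c (inClass i∈) (inClass j∈) (ρ-determined c (const₀ i∈ j∈) eqσ)))
            -- No agreement is known at the outset; the bare 1 in 1 + s is enough to start.
            (ℕₚ.<-≤-trans v< (ℕₚ.m≤m+n (2 ℕ.^ k) _))
      }
    }

cyclic-count : {{_ : NonZero v}} {I : Set} (T : I → Fin v → Fin v → Fin v) → (∀ i → IsCyclicSteiner (T i)) →
  (∀ {i j} → (∀ x y → T i x y ≡ T j x y) → i ≡ j) →
  ∀ k {xs} → v < 2 ℕ.^ k → Unique xs → length xs ≤ NC v * (v * v ℕ.^ k)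
cyclic-count {v} T T-cyclic T-injective = Classes.count T T-cyclic (lookup (representatives v))
  (λ i → Any.index (rep i)) (λ i → proj₁ (Anyₚ.lookup-index (rep i))) (λ i → proj₂ (Anyₚ.lookup-index (rep i)))
  T-injective
  where
  rep = λ i → representatives-complete (system (T i)) (system-IsCyclicSTS (T-cyclic i))

-- Cyclic Steiner quasigroups from difference triples

injective⇒surjective : {f : Fin v → Fin v} → (∀ {x y} → f x ≡ f y → x ≡ y) → ∀ y → ∃[ x ] f x ≡ y
injective⇒surjective {suc v} {f} f-inj y with any? (λ x → f x ≟ y)
... | yes hit = hit
... | no miss =
  ⊥-elim (ℕₚ.1+n≰n (injective⇒≤ {f = λ x → punchOut (y≢f x)} (f-inj ∘ punchOut-injective (y≢f _) (y≢f _))))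
  where
  y≢f : ∀ x → y ≢ f x
  y≢f x eq = miss (x , sym eq)

-- A relation with v pairs that is total on Fin v is a function.
module TotalGraph {B : Set} (Γ : List (Fin v × B)) (total : ∀ d → ∃[ q ] (d , q) ∈ Γ) (len : length Γ ≡ v) where

  private
    position : Fin v → Fin (length Γ)
    position d = Any.index (proj₂ (total d))

    lookup-position : ∀ d → lookup Γ (position d) ≡ (d , proj₁ (total d))
    lookup-position d = sym (Anyₚ.lookup-index (proj₂ (total d)))

    position-surjective : ∀ i → ∃[ d ] position d ≡ i
    position-surjective = surj (sym len) position position-injective
      where
      position-injective : ∀ {d e} → position d ≡ position e → d ≡ e
      position-injective {d} {e} eq = cong proj₁
        (trans (sym (lookup-position d)) (trans (cong (lookup Γ) eq) (lookup-position e)))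
      surj : ∀ {w} → v ≡ w → (f : Fin v → Fin w) → (∀ {d e} → f d ≡ f e → d ≡ e) → ∀ i → ∃[ d ] f d ≡ i
      surj refl f = injective⇒surjective

  apply : Fin v → B
  apply d = proj₁ (total d)

  apply-∈ : ∀ d → (d , apply d) ∈ Γ
  apply-∈ d = proj₂ (total d)

  -- Each residue claims a position of `Γ`, different residues claim different ones, and there are
  -- only v positions. So every pair of `Γ` is the one claimed by its first component.
  ∈⇒apply : ∀ {d q} → (d , q) ∈ Γ → apply d ≡ q
  ∈⇒apply {d} {q} dq∈ with position-surjective (Any.index dq∈)
  ... | e , eq = trans (cong apply (cong proj₁ (sym pair))) (cong proj₂ pair)
    where
    pair : (e , apply e) ≡ (d , q)
    pair = trans (sym (lookup-position e)) (trans (cong (lookup Γ) eq) (sym (Anyₚ.lookup-index dq∈)))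

-- g d is the third point of the block through 0 and d.
module _ {{_ : NonZero v}} where
  open ℤ/ v

  record IsThirdPoint (g : Fin v → Fin v) : Set where
    field
      fixes-0 : g ⟦ 0 ⟧ ≡ ⟦ 0 ⟧
      invol   : ∀ d → g (g d) ≡ d
      reverse : ∀ d → g (⊖ d) ≡ g d ⊕ ⊖ d

  translate : (Fin v → Fin v) → Fin v → Fin v → Fin v
  translate g x y = g (y ⊕ ⊖ x) ⊕ x

  translate-cyclic : ∀ {g} → IsThirdPoint g → IsCyclicSteiner (translate g)
  translate-cyclic {g} G = record
    { isSteiner = record
      { idem = λ x → trans (cong (_⊕ x) (trans (cong g (⊕-inverseʳ x)) fixes-0)) (⊕-identityˡ x)
      ; comm = λ x y → begin
          g (y ⊕ ⊖ x) ⊕ x                       ≡⟨ cong (λ d → g d ⊕ x) (⁻¹-anti-homo-// x y) ⟨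
          g (⊖ (x ⊕ ⊖ y)) ⊕ x                   ≡⟨ cong (_⊕ x) (reverse (x ⊕ ⊖ y)) ⟩
          (g (x ⊕ ⊖ y) ⊕ ⊖ (x ⊕ ⊖ y)) ⊕ x       ≡⟨ cong (λ d → (g (x ⊕ ⊖ y) ⊕ d) ⊕ x) (⁻¹-anti-homo-// x y) ⟩
          (g (x ⊕ ⊖ y) ⊕ (y ⊕ ⊖ x)) ⊕ x         ≡⟨ ⊕-assoc _ _ _ ⟩
          g (x ⊕ ⊖ y) ⊕ ((y ⊕ ⊖ x) ⊕ x)         ≡⟨ cong (g (x ⊕ ⊖ y) ⊕_) (//-rightDividesˡ x y) ⟩
          g (x ⊕ ⊖ y) ⊕ y                       ∎
      ; invol = λ x y → begin
          g ((g (y ⊕ ⊖ x) ⊕ x) ⊕ ⊖ x) ⊕ x       ≡⟨ cong (λ d → g d ⊕ x) (//-rightDividesʳ x _) ⟩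
          g (g (y ⊕ ⊖ x)) ⊕ x                   ≡⟨ cong (_⊕ x) (invol _) ⟩
          (y ⊕ ⊖ x) ⊕ x                         ≡⟨ //-rightDividesˡ x y ⟩
          y                                     ∎
      }
    ; shift = λ x y z → begin
        g ((y ⊕ z) ⊕ ⊖ (x ⊕ z)) ⊕ (x ⊕ z)       ≡⟨ cong (λ d → g d ⊕ (x ⊕ z)) (difference x y z) ⟩
        g (y ⊕ ⊖ x) ⊕ (x ⊕ z)                   ≡⟨ ⊕-assoc _ x z ⟨
        (g (y ⊕ ⊖ x) ⊕ x) ⊕ z                   ∎
    }
    where
    open IsThirdPoint G
    open ≡-Reasoning
    difference : ∀ x y z → (y ⊕ z) ⊕ ⊖ (x ⊕ z) ≡ y ⊕ ⊖ x
    difference x y z = begin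
      (y ⊕ z) ⊕ ⊖ (x ⊕ z)         ≡⟨ cong ((y ⊕ z) ⊕_) (⁻¹-anti-homo-∙ x z) ⟩
      (y ⊕ z) ⊕ (⊖ z ⊕ ⊖ x)       ≡⟨ ⊕-assoc _ (⊖ z) (⊖ x) ⟨
      ((y ⊕ z) ⊕ ⊖ z) ⊕ ⊖ x       ≡⟨ cong (_⊕ ⊖ x) (//-rightDividesʳ z y) ⟩
      y ⊕ ⊖ x                     ∎

  translate-injective : ∀ {f g} → (∀ x y → translate f x y ≡ translate g x y) → ∀ d → f d ≡ g d
  translate-injective {f} {g} eq d = begin
    f d                        ≡⟨ at-0 f ⟨
    translate f ⟦ 0 ⟧ d        ≡⟨ eq ⟦ 0 ⟧ d ⟩
    translate g ⟦ 0 ⟧ d        ≡⟨ at-0 g ⟩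
    g d                        ∎
    where
    open ≡-Reasoning
    at-0 : ∀ f → translate f ⟦ 0 ⟧ d ≡ f d
    at-0 f = trans (⊕-identityʳ _) (cong f (trans (cong (d ⊕_) ε⁻¹≈ε) (⊕-identityʳ d)))

  -- The base triangle (0 , α , α ⊕ β) has the differences ± α, ± β, ± (α ⊕ β);
  -- listed with each is the third point of the translate through 0 and it.
  hexagon : Fin v × Fin v → List (Fin v × Fin v)
  hexagon (α , β) =
    (α , α ⊕ β) ∷ (α ⊕ β , α) ∷ (β , ⊖ α) ∷ (⊖ α , β) ∷ (⊖ (α ⊕ β) , ⊖ β) ∷ (⊖ β , ⊖ (α ⊕ β)) ∷ []

  hexagon-swap : ∀ {p q} t → (p , q) ∈ hexagon t → (q , p) ∈ hexagon t
  hexagon-swap t (here refl)                                 = there (here refl)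
  hexagon-swap t (there (here refl))                         = here refl
  hexagon-swap t (there (there (here refl)))                 = there (there (there (here refl)))
  hexagon-swap t (there (there (there (here refl))))         = there (there (here refl))
  hexagon-swap t (there (there (there (there (here refl))))) =
    there (there (there (there (there (here refl)))))
  hexagon-swap t (there (there (there (there (there (here refl)))))) =
    there (there (there (there (here refl))))

  hexagon-reverse : ∀ {p q} t → (p , q) ∈ hexagon t → (⊖ p , q ⊕ ⊖ p) ∈ hexagon t
  hexagon-reverse (α , β) (here refl) =
    there (there (there (here (cong (⊖ α ,_) (xyx⁻¹≈y α β)))))
  hexagon-reverse (α , β) (there (here refl)) =
    there (there (there (there (here (cong (⊖ (α ⊕ β) ,_) (begin
      α ⊕ ⊖ (α ⊕ β)         ≡⟨ cong (α ⊕_) (⁻¹-∙-comm α β) ⟨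
      α ⊕ (⊖ α ⊕ ⊖ β)       ≡⟨ \\-leftDividesˡ α (⊖ β) ⟩
      ⊖ β                   ∎))))))
    where open ≡-Reasoning
  hexagon-reverse (α , β) (there (there (here refl))) =
    there (there (there (there (there (here (cong (⊖ β ,_) (⁻¹-∙-comm α β)))))))
  hexagon-reverse (α , β) (there (there (there (here refl)))) =
    here (cong₂ _,_ (⁻¹-involutive α) (trans (cong (β ⊕_) (⁻¹-involutive α)) (⊕-comm β α)))
  hexagon-reverse (α , β) (there (there (there (there (here refl))))) =
    there (here (cong₂ _,_ (⁻¹-involutive (α ⊕ β)) (begin
      ⊖ β ⊕ ⊖ ⊖ (α ⊕ β)     ≡⟨ cong (⊖ β ⊕_) (trans (⁻¹-involutive (α ⊕ β)) (⊕-comm α β)) ⟩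
      ⊖ β ⊕ (β ⊕ α)         ≡⟨ \\-leftDividesʳ β α ⟩
      α                     ∎)))
    where open ≡-Reasoning
  hexagon-reverse (α , β) (there (there (there (there (there (here refl)))))) =
    there (there (here (cong₂ _,_ (⁻¹-involutive β) (begin
      ⊖ (α ⊕ β) ⊕ ⊖ ⊖ β     ≡⟨ cong (_⊕ ⊖ ⊖ β) (⁻¹-∙-comm α β) ⟨
      (⊖ α ⊕ ⊖ β) ⊕ ⊖ ⊖ β   ≡⟨ //-rightDividesʳ (⊖ β) (⊖ α) ⟩
      ⊖ α                   ∎))))
    where open ≡-Reasoning

  -- For h = v/3 the block {0, h, -h} has only v/3 translates and uses up just the differences ±h;
  -- this orbit accounts for the 3 in v = 6n + 3. The pair of zeros defines g at 0.
  shortOrbit : Fin v → List (Fin v × Fin v)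
  shortOrbit h = (⟦ 0 ⟧ , ⟦ 0 ⟧) ∷ (h , ⊖ h) ∷ (⊖ h , h) ∷ []

  shortOrbit-swap : ∀ {h p q} → (p , q) ∈ shortOrbit h → (q , p) ∈ shortOrbit h
  shortOrbit-swap (here refl)                 = here refl
  shortOrbit-swap (there (here refl))         = there (there (here refl))
  shortOrbit-swap (there (there (here refl))) = there (here refl)

  shortOrbit-reverse : ∀ {h p q} → (h ⊕ h) ⊕ h ≡ ⟦ 0 ⟧ → (p , q) ∈ shortOrbit h → (⊖ p , q ⊕ ⊖ p) ∈ shortOrbit h
  shortOrbit-reverse _ (here refl) = here (cong₂ _,_ ε⁻¹≈ε (⊕-inverseʳ ⟦ 0 ⟧))
  shortOrbit-reverse {h} 3h (there (here refl)) = there (there (here (cong (⊖ h ,_)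
    (trans (⁻¹-∙-comm h h) (sym (inverseʳ-unique (h ⊕ h) h 3h))))))
  shortOrbit-reverse {h} 3h (there (there (here refl))) = there (here (cong₂ _,_ (⁻¹-involutive h)
    (trans (cong (h ⊕_) (⁻¹-involutive h)) (inverseˡ-unique (h ⊕ h) h 3h))))

  graph : Fin v → List (Fin v × Fin v) → List (Fin v × Fin v)
  graph h ts = shortOrbit h ++ concatMap hexagon ts

  hexagon⊆graph : ∀ {h ts t e} → t ∈ ts → e ∈ hexagon t → e ∈ graph h ts
  hexagon⊆graph {h} t∈ e∈ = ∈-++⁺ʳ (shortOrbit h) (∈-concatMap⁺ hexagon (lose t∈ e∈))

  length-graph : ∀ h ts → length (graph h ts) ≡ 6 * length ts + 3
  length-graph h ts = trans (cong (3 +_) (hexagons ts)) (ℕₚ.+-comm 3 _)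
    where
    hexagons : ∀ ts → length (concatMap hexagon ts) ≡ 6 * length ts
    hexagons []       = refl
    hexagons (t ∷ ts) = trans (cong (6 +_) (hexagons ts)) (sym (ℕₚ.*-suc 6 (length ts)))

  module _ {h : Fin v} {ts : List (Fin v × Fin v)} where
    graph-elim : {P : Fin v × Fin v → Set} → (∀ {e} → e ∈ shortOrbit h → P e) →
      (∀ {t e} → t ∈ ts → e ∈ hexagon t → P e) → ∀ {e} → e ∈ graph h ts → P e
    graph-elim short long e∈ with Anyₚ.++⁻ (shortOrbit h) e∈
    ... | inj₁ e∈short = short e∈short
    ... | inj₂ e∈long with find (∈-concatMap⁻ hexagon {xs = ts} e∈long)
    ...   | t , t∈ , e∈t = long t∈ e∈t

    graph-swap : ∀ {p q} → (p , q) ∈ graph h ts → (q , p) ∈ graph h ts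
    graph-swap = graph-elim {P = λ (p , q) → (q , p) ∈ graph h ts}
      (Anyₚ.++⁺ˡ ∘ shortOrbit-swap) (λ {t} t∈ → hexagon⊆graph t∈ ∘ hexagon-swap t)

    graph-reverse : (h ⊕ h) ⊕ h ≡ ⟦ 0 ⟧ → ∀ {p q} → (p , q) ∈ graph h ts → (⊖ p , q ⊕ ⊖ p) ∈ graph h ts
    graph-reverse 3h = graph-elim {P = λ (p , q) → (⊖ p , q ⊕ ⊖ p) ∈ graph h ts}
      (Anyₚ.++⁺ˡ ∘ shortOrbit-reverse 3h) (λ {t} t∈ → hexagon⊆graph t∈ ∘ hexagon-reverse t)

  module ThirdPoint (h : Fin v) (3h : (h ⊕ h) ⊕ h ≡ ⟦ 0 ⟧) (ts : List (Fin v × Fin v))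
    (total : ∀ d → ∃[ q ] (d , q) ∈ graph h ts) (len : 6 * length ts + 3 ≡ v) where

    open TotalGraph (graph h ts) total (trans (length-graph h ts) len) public

    apply-isThirdPoint : IsThirdPoint apply
    apply-isThirdPoint = record
      { fixes-0 = ∈⇒apply (here refl)
      ; invol   = λ d → ∈⇒apply (graph-swap {h} {ts} (apply-∈ d))
      ; reverse = λ d → ∈⇒apply (graph-reverse {h} {ts} 3h (apply-∈ d))
      }

-- Tables

digit : ℕ → Fin 9 → ℕ
digit m o = ℕ._/_ m (10 ℕ.^ toℕ o) {{ℕₚ.m^n≢0 10 (toℕ o)}} % 10

-- The digits of m, units first, are the values p(x) + 4 of a map p on {−4,…,4}
-- for which p and x ↦ x + p(x) are permutations.
IsAdditive : ℕ → Set
IsAdditive m =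
    (∀ (t : Fin 9) → ∃[ o ] digit m o ≡ toℕ t)
  × (∀ (s : Fin 9) → ∃[ o ] toℕ o + digit m o ≡ toℕ s + 4)
  × (∀ (o : Fin 9) → toℕ o + digit m o ≤ 12)

isAdditive? : ∀ m → Dec (IsAdditive m)
isAdditive? m =
  (all? λ t → any? λ o → digit m o ℕₚ.≟ toℕ t) ×-dec
  (all? λ s → any? λ o → toℕ o + digit m o ℕₚ.≟ toℕ s + 4) ×-dec
  (all? λ o → toℕ o + digit m o ℕₚ.≤? 12)

-- p ν+ c denotes the number p * ν + c, for a variable ν.
infix 6 _ν+_
data Position : Set where
  _ν+_ : ℕ → ℕ → Position

infixl 5 _⊞_
_⊞_ : Position → Position → Position
(p ν+ c) ⊞ (q ν+ d) = (p + q) ν+ (c + d)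

infix 4 _≟ₚ_
_≟ₚ_ : (x y : Position) → Dec (x ≡ y)
(p ν+ c) ≟ₚ (q ν+ d) = map′ (λ { (refl , refl) → refl }) (λ { refl → refl , refl }) (p ℕₚ.≟ q ×-dec c ℕₚ.≟ d)

-- The parameters w, j, h are lengths of gaps between the blocks of intervals,
-- see IsSolution.  Of each difference triple only two members are listed, the
-- third being their sum or its complement in v.
record Solution : Set where
  constructor solution
  field
    w j h    : ℕ
    leftover : List (Position × Position)

module _ (r : ℕ) (S : Solution) where
  open Solution S

  -- Equality of positions is equality of linear forms in ν, so that one finite check of a table
  -- serves every κ. The first alternative is v/3, the difference of the short orbit.
  Accounted : Position → Set
  Accounted x =
    x ≡ 8 ν+ (2 * r + 1) ⊎ Any (λ (a , b) → x ≡ a ⊎ x ≡ b ⊎ x ≡ a ⊞ b ⊎ x ⊞ (a ⊞ b) ≡ 24 ν+ (6 * r + 3)) leftover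

  accounted? : ∀ x → Dec (Accounted x)
  accounted? x =
    (x ≟ₚ _) ⊎-dec Any.any? (λ (a , b) → (x ≟ₚ a) ⊎-dec (x ≟ₚ b) ⊎-dec (x ≟ₚ (a ⊞ b)) ⊎-dec (x ⊞ (a ⊞ b) ≟ₚ _)) leftover

  Filled : ℕ → ℕ → ℕ → Set
  Filled p c ℓ = ∀ (o : Fin ℓ) → Accounted (p ν+ (c + toℕ o))

  -- With ν = 9κ and n = 36κ + r, the block intervals fill {1,…,3n+1} except for
  -- the eight gaps Filled p c ℓ = {c + pν,…,c + pν + ℓ − 1}; the number 2n + 1
  -- and v have the positions 8 ν+ (2r + 1) and 24 ν+ (6r + 3).
  IsSolution : Set
  IsSolution =
      length leftover ≡ r
    × 15 + 3 * w + j + h ≡ 3 * r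
    × Filled 0  1 (4 + w)
    × Filled 2  (5 + w) 1
    × Filled 4  (6 + w) j
    × Filled 6  (6 + w + j) w
    × Filled 7  (6 + 2 * w + j) 1
    × Filled 8  (7 + 2 * w + j) h
    × Filled 10 (7 + 2 * w + j + h) (9 + w)
    × Filled 11 (16 + 3 * w + j + h) 1

  isSolution? : Dec IsSolution
  isSolution? = length leftover ℕₚ.≟ r ×-dec 15 + 3 * w + j + h ℕₚ.≟ 3 * r
    ×-dec filled? ×-dec filled? ×-dec filled? ×-dec filled? ×-dec filled? ×-dec filled? ×-dec filled? ×-dec filled?
    where
    filled? : ∀ {p c ℓ} → Dec (Filled p c ℓ)
    filled? = all? λ o → accounted? _

-- An entry with eight digits has ninth digit 0, that is p(4) = -4.
patterns : Vec ℕ 128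
patterns =
  21687354 ∷ 102687354 ∷ 21768354 ∷ 102768354 ∷ 321087654 ∷ 203718654 ∷ 31682754 ∷ 36218754 ∷
  206318754 ∷ 216038754 ∷ 106372854 ∷ 302716854 ∷ 25187364 ∷ 210758364 ∷ 35182764 ∷ 310582764 ∷
  215083764 ∷ 250318764 ∷ 310752864 ∷ 53172864 ∷ 150372864 ∷ 25713864 ∷ 152073864 ∷ 320715864 ∷
  205186374 ∷ 106528374 ∷ 206158374 ∷ 150268374 ∷ 130682574 ∷ 136028574 ∷ 150632874 ∷ 306152874 ∷
  350216874 ∷ 351026874 ∷ 206175384 ∷ 51627384 ∷ 310762584 ∷ 36172584 ∷ 216073584 ∷ 316027584 ∷
  205713684 ∷ 251073684 ∷ 350217684 ∷ 351027684 ∷ 21687435 ∷ 102687435 ∷ 21768435 ∷ 102768435 ∷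
  140287635 ∷ 104728635 ∷ 210684735 ∷ 206148735 ∷ 402168735 ∷ 410268735 ∷ 26174835 ∷ 41726835 ∷
  402176835 ∷ 410276835 ∷ 43187265 ∷ 140387265 ∷ 310487265 ∷ 130748265 ∷ 132708465 ∷ 213708465 ∷
  240381765 ∷ 432108765 ∷ 43721865 ∷ 320741865 ∷ 420371865 ∷ 142703865 ∷ 104683275 ∷ 130684275 ∷
  304186275 ∷ 403168275 ∷ 203681475 ∷ 136208475 ∷ 306421875 ∷ 403621875 ∷ 420631875 ∷ 146203875 ∷
  421603875 ∷ 326104875 ∷ 41763285 ∷ 310764285 ∷ 36174285 ∷ 46137285 ∷ 410637285 ∷ 306147285 ∷
  302761485 ∷ 36271485 ∷ 206371485 ∷ 316207485 ∷ 304721685 ∷ 240731685 ∷ 430271685 ∷ 241703685 ∷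
  142087536 ∷ 24718536 ∷ 41582736 ∷ 215084736 ∷ 241085736 ∷ 54218736 ∷ 402518736 ∷ 251048736 ∷
  105742836 ∷ 41752836 ∷ 51472836 ∷ 25714836 ∷ 152074836 ∷ 421075836 ∷ 105387246 ∷ 31758246 ∷
  132708546 ∷ 213708546 ∷ 35281746 ∷ 205381746 ∷ 302581746 ∷ 251308746 ∷ 25731846 ∷ 302751846 ∷
  53271846 ∷ 321705846 ∷ 135084276 ∷ 403518276 ∷ 154038276 ∷ 431058276 ∷ 205481376 ∷ 154208376 ∷
  []

-- Entry i belongs to r = 10 + i. The residues mod 36 are represented by 10,...,45 and not by
-- 0,...,35 because the gaps hold at least 16 numbers and must hold exactly 3r + 1, which excludes r
-- < 5.
solutions : Vec Solution 36
solutions =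
  solution 0 12 3 (
    (0 ν+ 1 , 4 ν+ 16) ∷ (0 ν+ 2 , 4 ν+ 12) ∷ (0 ν+ 3 , 4 ν+ 7) ∷ (0 ν+ 4 , 10 ν+ 23) ∷
    (2 ν+ 5 , 8 ν+ 19) ∷ (4 ν+ 6 , 10 ν+ 28) ∷ (4 ν+ 8 , 10 ν+ 25) ∷ (4 ν+ 9 , 4 ν+ 11) ∷
    (4 ν+ 13 , 7 ν+ 18) ∷ (4 ν+ 15 , 10 ν+ 22) ∷ []) ∷
  solution 1 12 3 (
    (0 ν+ 1 , 10 ν+ 30) ∷ (0 ν+ 2 , 4 ν+ 15) ∷ (0 ν+ 3 , 4 ν+ 7) ∷ (0 ν+ 4 , 4 ν+ 9) ∷
    (0 ν+ 5 , 4 ν+ 11) ∷ (2 ν+ 6 , 8 ν+ 21) ∷ (4 ν+ 8 , 10 ν+ 29) ∷ (4 ν+ 12 , 10 ν+ 24) ∷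
    (4 ν+ 14 , 7 ν+ 20) ∷ (4 ν+ 18 , 10 ν+ 25) ∷ (6 ν+ 19 , 8 ν+ 22) ∷ []) ∷
  solution 0 15 6 (
    (0 ν+ 1 , 4 ν+ 18) ∷ (0 ν+ 2 , 10 ν+ 32) ∷ (0 ν+ 3 , 10 ν+ 33) ∷ (0 ν+ 4 , 4 ν+ 7) ∷
    (2 ν+ 5 , 8 ν+ 24) ∷ (4 ν+ 6 , 4 ν+ 20) ∷ (4 ν+ 8 , 4 ν+ 14) ∷ (4 ν+ 9 , 10 ν+ 31) ∷
    (4 ν+ 10 , 4 ν+ 13) ∷ (4 ν+ 12 , 4 ν+ 15) ∷ (4 ν+ 16 , 7 ν+ 21) ∷ (4 ν+ 17 , 10 ν+ 28) ∷ []) ∷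
  solution 1 16 5 (
    (0 ν+ 1 , 8 ν+ 25) ∷ (0 ν+ 2 , 4 ν+ 20) ∷ (0 ν+ 3 , 4 ν+ 12) ∷ (0 ν+ 4 , 4 ν+ 17) ∷
    (0 ν+ 5 , 4 ν+ 8) ∷ (2 ν+ 6 , 6 ν+ 23) ∷ (4 ν+ 7 , 10 ν+ 36) ∷ (4 ν+ 9 , 4 ν+ 19) ∷
    (4 ν+ 10 , 10 ν+ 34) ∷ (4 ν+ 11 , 10 ν+ 31) ∷ (4 ν+ 14 , 10 ν+ 32) ∷ (4 ν+ 16 , 7 ν+ 24) ∷
    (4 ν+ 18 , 10 ν+ 30) ∷ []) ∷
  solution 1 18 6 (
    (0 ν+ 1 , 4 ν+ 13) ∷ (0 ν+ 2 , 4 ν+ 22) ∷ (0 ν+ 3 , 4 ν+ 20) ∷ (0 ν+ 4 , 4 ν+ 12) ∷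
    (0 ν+ 5 , 8 ν+ 27) ∷ (2 ν+ 6 , 6 ν+ 25) ∷ (4 ν+ 7 , 4 ν+ 21) ∷ (4 ν+ 8 , 10 ν+ 39) ∷
    (4 ν+ 9 , 10 ν+ 37) ∷ (4 ν+ 10 , 10 ν+ 35) ∷ (4 ν+ 11 , 4 ν+ 19) ∷ (4 ν+ 15 , 10 ν+ 34) ∷
    (4 ν+ 17 , 7 ν+ 26) ∷ (4 ν+ 18 , 10 ν+ 33) ∷ []) ∷
  solution 0 18 12 (
    (0 ν+ 1 , 10 ν+ 39) ∷ (0 ν+ 2 , 8 ν+ 27) ∷ (0 ν+ 3 , 4 ν+ 20) ∷ (0 ν+ 4 , 4 ν+ 6) ∷
    (2 ν+ 5 , 8 ν+ 32) ∷ (4 ν+ 7 , 10 ν+ 41) ∷ (4 ν+ 8 , 10 ν+ 42) ∷ (4 ν+ 9 , 4 ν+ 19) ∷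
    (4 ν+ 11 , 10 ν+ 38) ∷ (4 ν+ 12 , 4 ν+ 13) ∷ (4 ν+ 14 , 4 ν+ 16) ∷ (4 ν+ 15 , 4 ν+ 21) ∷
    (4 ν+ 17 , 4 ν+ 18) ∷ (4 ν+ 22 , 7 ν+ 24) ∷ (8 ν+ 26 , 8 ν+ 33) ∷ []) ∷
  solution 4 13 8 (
    (0 ν+ 1 , 10 ν+ 39) ∷ (0 ν+ 2 , 0 ν+ 5) ∷ (0 ν+ 3 , 8 ν+ 28) ∷ (0 ν+ 4 , 4 ν+ 10) ∷
    (0 ν+ 6 , 4 ν+ 15) ∷ (0 ν+ 8 , 10 ν+ 37) ∷ (2 ν+ 9 , 4 ν+ 16) ∷ (4 ν+ 11 , 10 ν+ 42) ∷
    (4 ν+ 12 , 4 ν+ 20) ∷ (4 ν+ 13 , 10 ν+ 38) ∷ (4 ν+ 17 , 4 ν+ 18) ∷ (4 ν+ 19 , 10 ν+ 36) ∷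
    (4 ν+ 22 , 7 ν+ 27) ∷ (6 ν+ 23 , 8 ν+ 29) ∷ (6 ν+ 24 , 8 ν+ 34) ∷ (6 ν+ 26 , 8 ν+ 30) ∷ []) ∷
  solution 3 19 8 (
    (0 ν+ 1 , 4 ν+ 17) ∷ (0 ν+ 2 , 4 ν+ 22) ∷ (0 ν+ 3 , 10 ν+ 43) ∷ (0 ν+ 4 , 4 ν+ 23) ∷
    (0 ν+ 5 , 10 ν+ 42) ∷ (0 ν+ 6 , 4 ν+ 14) ∷ (0 ν+ 7 , 4 ν+ 9) ∷ (2 ν+ 8 , 6 ν+ 30) ∷
    (4 ν+ 10 , 4 ν+ 26) ∷ (4 ν+ 11 , 10 ν+ 45) ∷ (4 ν+ 12 , 4 ν+ 25) ∷ (4 ν+ 13 , 10 ν+ 41) ∷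
    (4 ν+ 15 , 10 ν+ 40) ∷ (4 ν+ 19 , 6 ν+ 29) ∷ (4 ν+ 21 , 7 ν+ 31) ∷ (6 ν+ 28 , 8 ν+ 33) ∷
    (8 ν+ 32 , 8 ν+ 34) ∷ []) ∷
  solution 2 20 13 (
    (0 ν+ 1 , 4 ν+ 22) ∷ (0 ν+ 2 , 8 ν+ 32) ∷ (0 ν+ 3 , 8 ν+ 39) ∷ (0 ν+ 4 , 4 ν+ 16) ∷
    (0 ν+ 5 , 10 ν+ 47) ∷ (0 ν+ 6 , 8 ν+ 35) ∷ (2 ν+ 7 , 8 ν+ 38) ∷ (4 ν+ 8 , 10 ν+ 50) ∷
    (4 ν+ 9 , 10 ν+ 48) ∷ (4 ν+ 10 , 4 ν+ 26) ∷ (4 ν+ 11 , 10 ν+ 49) ∷ (4 ν+ 12 , 4 ν+ 21) ∷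
    (4 ν+ 13 , 4 ν+ 27) ∷ (4 ν+ 14 , 4 ν+ 17) ∷ (4 ν+ 15 , 6 ν+ 29) ∷ (4 ν+ 18 , 6 ν+ 28) ∷
    (4 ν+ 19 , 4 ν+ 24) ∷ (4 ν+ 25 , 7 ν+ 30) ∷ []) ∷
  solution 5 22 5 (
    (0 ν+ 1 , 6 ν+ 36) ∷ (0 ν+ 2 , 0 ν+ 4) ∷ (0 ν+ 3 , 4 ν+ 27) ∷ (0 ν+ 5 , 10 ν+ 46) ∷
    (0 ν+ 7 , 4 ν+ 25) ∷ (0 ν+ 8 , 4 ν+ 18) ∷ (0 ν+ 9 , 4 ν+ 15) ∷ (2 ν+ 10 , 8 ν+ 42) ∷
    (4 ν+ 11 , 4 ν+ 29) ∷ (4 ν+ 12 , 4 ν+ 31) ∷ (4 ν+ 13 , 4 ν+ 28) ∷ (4 ν+ 14 , 10 ν+ 50) ∷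
    (4 ν+ 16 , 6 ν+ 33) ∷ (4 ν+ 17 , 10 ν+ 45) ∷ (4 ν+ 19 , 10 ν+ 44) ∷ (4 ν+ 20 , 7 ν+ 38) ∷
    (4 ν+ 21 , 6 ν+ 35) ∷ (4 ν+ 22 , 10 ν+ 47) ∷ (4 ν+ 23 , 6 ν+ 34) ∷ []) ∷
  solution 4 21 12 (
    (0 ν+ 1 , 10 ν+ 55) ∷ (0 ν+ 2 , 8 ν+ 45) ∷ (0 ν+ 3 , 4 ν+ 21) ∷ (0 ν+ 4 , 10 ν+ 53) ∷
    (0 ν+ 5 , 4 ν+ 18) ∷ (0 ν+ 6 , 4 ν+ 13) ∷ (0 ν+ 7 , 8 ν+ 36) ∷ (0 ν+ 8 , 10 ν+ 50) ∷
    (2 ν+ 9 , 4 ν+ 25) ∷ (4 ν+ 10 , 4 ν+ 27) ∷ (4 ν+ 11 , 4 ν+ 28) ∷ (4 ν+ 12 , 10 ν+ 52) ∷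
    (4 ν+ 14 , 4 ν+ 30) ∷ (4 ν+ 15 , 10 ν+ 48) ∷ (4 ν+ 16 , 6 ν+ 33) ∷ (4 ν+ 17 , 4 ν+ 29) ∷
    (4 ν+ 20 , 4 ν+ 22) ∷ (4 ν+ 26 , 7 ν+ 35) ∷ (6 ν+ 31 , 8 ν+ 38) ∷ (6 ν+ 32 , 8 ν+ 40) ∷ []) ∷
  solution 4 23 13 (
    (0 ν+ 1 , 4 ν+ 30) ∷ (0 ν+ 2 , 10 ν+ 60) ∷ (0 ν+ 3 , 8 ν+ 44) ∷ (0 ν+ 4 , 4 ν+ 10) ∷
    (0 ν+ 5 , 10 ν+ 56) ∷ (0 ν+ 6 , 10 ν+ 52) ∷ (0 ν+ 7 , 4 ν+ 11) ∷ (0 ν+ 8 , 4 ν+ 21) ∷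
    (2 ν+ 9 , 8 ν+ 50) ∷ (4 ν+ 12 , 10 ν+ 54) ∷ (4 ν+ 13 , 4 ν+ 26) ∷ (4 ν+ 15 , 4 ν+ 25) ∷
    (4 ν+ 16 , 6 ν+ 35) ∷ (4 ν+ 17 , 4 ν+ 32) ∷ (4 ν+ 19 , 6 ν+ 34) ∷ (4 ν+ 20 , 4 ν+ 28) ∷
    (4 ν+ 22 , 4 ν+ 23) ∷ (4 ν+ 24 , 6 ν+ 33) ∷ (4 ν+ 27 , 7 ν+ 37) ∷ (6 ν+ 36 , 8 ν+ 38) ∷
    (8 ν+ 41 , 8 ν+ 42) ∷ []) ∷
  solution 6 20 13 (
    (0 ν+ 1 , 0 ν+ 3) ∷ (0 ν+ 2 , 10 ν+ 61) ∷ (0 ν+ 5 , 4 ν+ 14) ∷ (0 ν+ 6 , 4 ν+ 16) ∷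
    (0 ν+ 7 , 8 ν+ 41) ∷ (0 ν+ 8 , 4 ν+ 20) ∷ (0 ν+ 9 , 10 ν+ 57) ∷ (0 ν+ 10 , 4 ν+ 13) ∷
    (2 ν+ 11 , 6 ν+ 36) ∷ (4 ν+ 12 , 4 ν+ 30) ∷ (4 ν+ 15 , 10 ν+ 56) ∷ (4 ν+ 17 , 10 ν+ 53) ∷
    (4 ν+ 18 , 4 ν+ 31) ∷ (4 ν+ 21 , 4 ν+ 25) ∷ (4 ν+ 24 , 6 ν+ 34) ∷ (4 ν+ 26 , 10 ν+ 54) ∷
    (4 ν+ 27 , 6 ν+ 35) ∷ (4 ν+ 29 , 7 ν+ 38) ∷ (6 ν+ 32 , 8 ν+ 43) ∷ (6 ν+ 33 , 8 ν+ 50) ∷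
    (6 ν+ 37 , 8 ν+ 39) ∷ (8 ν+ 40 , 8 ν+ 44) ∷ []) ∷
  solution 4 28 14 (
    (0 ν+ 1 , 8 ν+ 54) ∷ (0 ν+ 2 , 4 ν+ 22) ∷ (0 ν+ 3 , 10 ν+ 62) ∷ (0 ν+ 4 , 4 ν+ 12) ∷
    (0 ν+ 5 , 4 ν+ 29) ∷ (0 ν+ 6 , 4 ν+ 15) ∷ (0 ν+ 7 , 4 ν+ 26) ∷ (0 ν+ 8 , 8 ν+ 45) ∷
    (2 ν+ 9 , 4 ν+ 32) ∷ (4 ν+ 10 , 4 ν+ 36) ∷ (4 ν+ 11 , 10 ν+ 63) ∷ (4 ν+ 13 , 10 ν+ 60) ∷
    (4 ν+ 14 , 4 ν+ 35) ∷ (4 ν+ 17 , 10 ν+ 58) ∷ (4 ν+ 18 , 10 ν+ 59) ∷ (4 ν+ 19 , 4 ν+ 37) ∷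
    (4 ν+ 20 , 4 ν+ 31) ∷ (4 ν+ 23 , 6 ν+ 38) ∷ (4 ν+ 25 , 4 ν+ 27) ∷ (4 ν+ 28 , 7 ν+ 42) ∷
    (4 ν+ 30 , 6 ν+ 39) ∷ (6 ν+ 40 , 8 ν+ 44) ∷ (8 ν+ 43 , 8 ν+ 48) ∷ []) ∷
  solution 5 29 13 (
    (0 ν+ 1 , 4 ν+ 38) ∷ (0 ν+ 2 , 4 ν+ 11) ∷ (0 ν+ 3 , 6 ν+ 41) ∷ (0 ν+ 4 , 10 ν+ 68) ∷
    (0 ν+ 5 , 8 ν+ 51) ∷ (0 ν+ 6 , 4 ν+ 31) ∷ (0 ν+ 7 , 10 ν+ 63) ∷ (0 ν+ 8 , 10 ν+ 61) ∷
    (0 ν+ 9 , 4 ν+ 15) ∷ (2 ν+ 10 , 6 ν+ 43) ∷ (4 ν+ 12 , 10 ν+ 64) ∷ (4 ν+ 14 , 10 ν+ 66) ∷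
    (4 ν+ 16 , 4 ν+ 30) ∷ (4 ν+ 17 , 4 ν+ 33) ∷ (4 ν+ 18 , 4 ν+ 36) ∷ (4 ν+ 19 , 4 ν+ 29) ∷
    (4 ν+ 20 , 6 ν+ 42) ∷ (4 ν+ 21 , 4 ν+ 34) ∷ (4 ν+ 22 , 4 ν+ 35) ∷ (4 ν+ 23 , 10 ν+ 59) ∷
    (4 ν+ 25 , 4 ν+ 27) ∷ (4 ν+ 26 , 4 ν+ 32) ∷ (4 ν+ 28 , 7 ν+ 45) ∷ (6 ν+ 40 , 8 ν+ 47) ∷ []) ∷
  solution 6 29 13 (
    (0 ν+ 1 , 8 ν+ 59) ∷ (0 ν+ 2 , 4 ν+ 35) ∷ (0 ν+ 3 , 4 ν+ 13) ∷ (0 ν+ 4 , 4 ν+ 36) ∷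
    (0 ν+ 5 , 4 ν+ 12) ∷ (0 ν+ 6 , 10 ν+ 65) ∷ (0 ν+ 7 , 4 ν+ 32) ∷ (0 ν+ 8 , 8 ν+ 48) ∷
    (0 ν+ 9 , 8 ν+ 49) ∷ (0 ν+ 10 , 4 ν+ 28) ∷ (2 ν+ 11 , 6 ν+ 46) ∷ (4 ν+ 14 , 10 ν+ 66) ∷
    (4 ν+ 15 , 10 ν+ 63) ∷ (4 ν+ 18 , 10 ν+ 61) ∷ (4 ν+ 19 , 10 ν+ 64) ∷ (4 ν+ 20 , 4 ν+ 34) ∷
    (4 ν+ 21 , 4 ν+ 31) ∷ (4 ν+ 22 , 4 ν+ 33) ∷ (4 ν+ 23 , 6 ν+ 44) ∷ (4 ν+ 24 , 6 ν+ 45) ∷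
    (4 ν+ 25 , 6 ν+ 43) ∷ (4 ν+ 26 , 4 ν+ 27) ∷ (4 ν+ 29 , 7 ν+ 47) ∷ (4 ν+ 30 , 6 ν+ 42) ∷
    (6 ν+ 41 , 8 ν+ 50) ∷ []) ∷
  solution 8 23 16 (
    (0 ν+ 1 , 8 ν+ 47) ∷ (0 ν+ 2 , 6 ν+ 41) ∷ (0 ν+ 3 , 8 ν+ 49) ∷ (0 ν+ 4 , 10 ν+ 74) ∷
    (0 ν+ 5 , 8 ν+ 54) ∷ (0 ν+ 6 , 4 ν+ 22) ∷ (0 ν+ 7 , 10 ν+ 64) ∷ (0 ν+ 8 , 10 ν+ 69) ∷
    (0 ν+ 9 , 4 ν+ 15) ∷ (0 ν+ 10 , 8 ν+ 46) ∷ (0 ν+ 11 , 4 ν+ 14) ∷ (0 ν+ 12 , 4 ν+ 17) ∷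
    (2 ν+ 13 , 6 ν+ 42) ∷ (4 ν+ 16 , 10 ν+ 67) ∷ (4 ν+ 18 , 4 ν+ 32) ∷ (4 ν+ 19 , 10 ν+ 68) ∷
    (4 ν+ 20 , 4 ν+ 31) ∷ (4 ν+ 21 , 6 ν+ 44) ∷ (4 ν+ 23 , 10 ν+ 66) ∷ (4 ν+ 26 , 4 ν+ 35) ∷
    (4 ν+ 27 , 4 ν+ 30) ∷ (4 ν+ 33 , 6 ν+ 40) ∷ (4 ν+ 34 , 7 ν+ 45) ∷ (4 ν+ 36 , 6 ν+ 39) ∷
    (6 ν+ 37 , 8 ν+ 60) ∷ (6 ν+ 38 , 8 ν+ 58) ∷ []) ∷
  solution 5 29 22 (
    (0 ν+ 1 , 8 ν+ 62) ∷ (0 ν+ 2 , 4 ν+ 13) ∷ (0 ν+ 3 , 8 ν+ 64) ∷ (0 ν+ 4 , 10 ν+ 77) ∷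
    (0 ν+ 5 , 10 ν+ 73) ∷ (0 ν+ 6 , 8 ν+ 53) ∷ (0 ν+ 7 , 8 ν+ 54) ∷ (0 ν+ 8 , 8 ν+ 58) ∷
    (0 ν+ 9 , 4 ν+ 19) ∷ (2 ν+ 10 , 4 ν+ 30) ∷ (4 ν+ 11 , 4 ν+ 38) ∷ (4 ν+ 12 , 10 ν+ 74) ∷
    (4 ν+ 14 , 10 ν+ 71) ∷ (4 ν+ 16 , 4 ν+ 35) ∷ (4 ν+ 17 , 4 ν+ 29) ∷ (4 ν+ 18 , 4 ν+ 32) ∷
    (4 ν+ 20 , 4 ν+ 36) ∷ (4 ν+ 21 , 4 ν+ 31) ∷ (4 ν+ 22 , 4 ν+ 25) ∷ (4 ν+ 23 , 10 ν+ 70) ∷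
    (4 ν+ 24 , 6 ν+ 44) ∷ (4 ν+ 26 , 4 ν+ 39) ∷ (4 ν+ 27 , 6 ν+ 42) ∷ (4 ν+ 33 , 6 ν+ 43) ∷
    (4 ν+ 34 , 6 ν+ 41) ∷ (4 ν+ 37 , 7 ν+ 45) ∷ (8 ν+ 48 , 8 ν+ 57) ∷ []) ∷
  solution 8 26 19 (
    (0 ν+ 1 , 0 ν+ 6) ∷ (0 ν+ 2 , 4 ν+ 14) ∷ (0 ν+ 3 , 8 ν+ 64) ∷ (0 ν+ 4 , 8 ν+ 62) ∷
    (0 ν+ 5 , 4 ν+ 20) ∷ (0 ν+ 8 , 10 ν+ 76) ∷ (0 ν+ 9 , 10 ν+ 73) ∷ (0 ν+ 10 , 10 ν+ 69) ∷
    (0 ν+ 11 , 4 ν+ 15) ∷ (0 ν+ 12 , 4 ν+ 18) ∷ (2 ν+ 13 , 6 ν+ 46) ∷ (4 ν+ 17 , 4 ν+ 32) ∷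
    (4 ν+ 19 , 4 ν+ 31) ∷ (4 ν+ 21 , 4 ν+ 35) ∷ (4 ν+ 22 , 10 ν+ 68) ∷ (4 ν+ 23 , 10 ν+ 70) ∷
    (4 ν+ 24 , 6 ν+ 47) ∷ (4 ν+ 27 , 4 ν+ 33) ∷ (4 ν+ 28 , 6 ν+ 44) ∷ (4 ν+ 29 , 4 ν+ 36) ∷
    (4 ν+ 34 , 6 ν+ 40) ∷ (4 ν+ 37 , 7 ν+ 48) ∷ (4 ν+ 38 , 6 ν+ 45) ∷ (4 ν+ 39 , 6 ν+ 41) ∷
    (6 ν+ 42 , 8 ν+ 54) ∷ (6 ν+ 43 , 8 ν+ 51) ∷ (8 ν+ 52 , 8 ν+ 58) ∷ (8 ν+ 53 , 8 ν+ 55) ∷ []) ∷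
  solution 7 30 21 (
    (0 ν+ 1 , 4 ν+ 14) ∷ (0 ν+ 2 , 4 ν+ 18) ∷ (0 ν+ 3 , 8 ν+ 62) ∷ (0 ν+ 4 , 8 ν+ 67) ∷
    (0 ν+ 5 , 4 ν+ 25) ∷ (0 ν+ 6 , 8 ν+ 63) ∷ (0 ν+ 7 , 4 ν+ 16) ∷ (0 ν+ 8 , 10 ν+ 76) ∷
    (0 ν+ 9 , 8 ν+ 57) ∷ (0 ν+ 10 , 8 ν+ 58) ∷ (0 ν+ 11 , 10 ν+ 75) ∷ (2 ν+ 12 , 4 ν+ 37) ∷
    (4 ν+ 13 , 4 ν+ 42) ∷ (4 ν+ 17 , 4 ν+ 35) ∷ (4 ν+ 19 , 10 ν+ 78) ∷ (4 ν+ 21 , 10 ν+ 74) ∷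
    (4 ν+ 22 , 10 ν+ 72) ∷ (4 ν+ 24 , 4 ν+ 27) ∷ (4 ν+ 26 , 4 ν+ 28) ∷ (4 ν+ 29 , 4 ν+ 32) ∷
    (4 ν+ 31 , 4 ν+ 39) ∷ (4 ν+ 33 , 6 ν+ 44) ∷ (4 ν+ 34 , 6 ν+ 47) ∷ (4 ν+ 36 , 6 ν+ 43) ∷
    (4 ν+ 38 , 7 ν+ 50) ∷ (4 ν+ 40 , 6 ν+ 45) ∷ (4 ν+ 41 , 6 ν+ 46) ∷ (6 ν+ 48 , 8 ν+ 56) ∷
    (8 ν+ 53 , 8 ν+ 60) ∷ []) ∷
  solution 8 34 17 (
    (0 ν+ 1 , 4 ν+ 45) ∷ (0 ν+ 2 , 8 ν+ 70) ∷ (0 ν+ 3 , 4 ν+ 40) ∷ (0 ν+ 4 , 6 ν+ 50) ∷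
    (0 ν+ 5 , 4 ν+ 18) ∷ (0 ν+ 6 , 8 ν+ 65) ∷ (0 ν+ 7 , 8 ν+ 57) ∷ (0 ν+ 8 , 10 ν+ 79) ∷
    (0 ν+ 9 , 8 ν+ 59) ∷ (0 ν+ 10 , 4 ν+ 24) ∷ (0 ν+ 11 , 10 ν+ 75) ∷ (0 ν+ 12 , 4 ν+ 15) ∷
    (2 ν+ 13 , 8 ν+ 67) ∷ (4 ν+ 14 , 4 ν+ 44) ∷ (4 ν+ 16 , 10 ν+ 83) ∷ (4 ν+ 17 , 10 ν+ 77) ∷
    (4 ν+ 19 , 6 ν+ 55) ∷ (4 ν+ 20 , 10 ν+ 81) ∷ (4 ν+ 21 , 4 ν+ 41) ∷ (4 ν+ 22 , 4 ν+ 47) ∷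
    (4 ν+ 25 , 6 ν+ 51) ∷ (4 ν+ 26 , 6 ν+ 52) ∷ (4 ν+ 28 , 4 ν+ 38) ∷ (4 ν+ 29 , 4 ν+ 31) ∷
    (4 ν+ 30 , 4 ν+ 33) ∷ (4 ν+ 32 , 6 ν+ 53) ∷ (4 ν+ 35 , 7 ν+ 56) ∷ (4 ν+ 36 , 4 ν+ 37) ∷
    (4 ν+ 39 , 6 ν+ 49) ∷ (4 ν+ 42 , 6 ν+ 48) ∷ []) ∷
  solution 8 31 23 (
    (0 ν+ 1 , 10 ν+ 91) ∷ (0 ν+ 2 , 6 ν+ 47) ∷ (0 ν+ 3 , 10 ν+ 90) ∷ (0 ν+ 4 , 8 ν+ 72) ∷
    (0 ν+ 5 , 4 ν+ 22) ∷ (0 ν+ 6 , 4 ν+ 26) ∷ (0 ν+ 7 , 4 ν+ 14) ∷ (0 ν+ 8 , 4 ν+ 15) ∷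
    (0 ν+ 9 , 8 ν+ 55) ∷ (0 ν+ 10 , 8 ν+ 61) ∷ (0 ν+ 11 , 8 ν+ 59) ∷ (0 ν+ 12 , 4 ν+ 24) ∷
    (2 ν+ 13 , 8 ν+ 65) ∷ (4 ν+ 16 , 4 ν+ 44) ∷ (4 ν+ 17 , 4 ν+ 40) ∷ (4 ν+ 18 , 10 ν+ 82) ∷
    (4 ν+ 19 , 10 ν+ 83) ∷ (4 ν+ 20 , 10 ν+ 84) ∷ (4 ν+ 25 , 4 ν+ 43) ∷ (4 ν+ 28 , 6 ν+ 51) ∷
    (4 ν+ 29 , 4 ν+ 37) ∷ (4 ν+ 30 , 6 ν+ 50) ∷ (4 ν+ 31 , 4 ν+ 38) ∷ (4 ν+ 33 , 6 ν+ 48) ∷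
    (4 ν+ 34 , 6 ν+ 52) ∷ (4 ν+ 35 , 4 ν+ 39) ∷ (4 ν+ 41 , 7 ν+ 53) ∷ (4 ν+ 42 , 6 ν+ 46) ∷
    (6 ν+ 45 , 8 ν+ 67) ∷ (8 ν+ 54 , 8 ν+ 62) ∷ (8 ν+ 56 , 8 ν+ 58) ∷ []) ∷
  solution 10 31 20 (
    (0 ν+ 1 , 4 ν+ 16) ∷ (0 ν+ 2 , 8 ν+ 73) ∷ (0 ν+ 3 , 6 ν+ 48) ∷ (0 ν+ 4 , 8 ν+ 63) ∷
    (0 ν+ 5 , 4 ν+ 18) ∷ (0 ν+ 6 , 8 ν+ 68) ∷ (0 ν+ 7 , 8 ν+ 62) ∷ (0 ν+ 8 , 8 ν+ 64) ∷
    (0 ν+ 9 , 4 ν+ 19) ∷ (0 ν+ 10 , 4 ν+ 36) ∷ (0 ν+ 11 , 10 ν+ 82) ∷ (0 ν+ 12 , 8 ν+ 59) ∷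
    (0 ν+ 13 , 10 ν+ 83) ∷ (0 ν+ 14 , 4 ν+ 30) ∷ (2 ν+ 15 , 8 ν+ 77) ∷ (4 ν+ 20 , 10 ν+ 84) ∷
    (4 ν+ 21 , 4 ν+ 39) ∷ (4 ν+ 22 , 6 ν+ 56) ∷ (4 ν+ 24 , 4 ν+ 37) ∷ (4 ν+ 25 , 10 ν+ 80) ∷
    (4 ν+ 26 , 10 ν+ 81) ∷ (4 ν+ 27 , 4 ν+ 31) ∷ (4 ν+ 29 , 4 ν+ 41) ∷ (4 ν+ 32 , 6 ν+ 55) ∷
    (4 ν+ 33 , 4 ν+ 43) ∷ (4 ν+ 34 , 6 ν+ 52) ∷ (4 ν+ 35 , 6 ν+ 54) ∷ (4 ν+ 38 , 6 ν+ 47) ∷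
    (4 ν+ 40 , 7 ν+ 57) ∷ (4 ν+ 42 , 6 ν+ 53) ∷ (4 ν+ 45 , 6 ν+ 49) ∷ (6 ν+ 50 , 8 ν+ 66) ∷ []) ∷
  solution 11 37 14 (
    (0 ν+ 1 , 0 ν+ 11) ∷ (0 ν+ 2 , 8 ν+ 71) ∷ (0 ν+ 3 , 6 ν+ 56) ∷ (0 ν+ 4 , 10 ν+ 93) ∷
    (0 ν+ 5 , 10 ν+ 83) ∷ (0 ν+ 6 , 6 ν+ 58) ∷ (0 ν+ 7 , 4 ν+ 43) ∷ (0 ν+ 8 , 4 ν+ 40) ∷
    (0 ν+ 9 , 8 ν+ 66) ∷ (0 ν+ 10 , 4 ν+ 37) ∷ (0 ν+ 13 , 10 ν+ 82) ∷ (0 ν+ 14 , 10 ν+ 80) ∷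
    (0 ν+ 15 , 4 ν+ 23) ∷ (2 ν+ 16 , 4 ν+ 39) ∷ (4 ν+ 17 , 10 ν+ 86) ∷ (4 ν+ 18 , 10 ν+ 84) ∷
    (4 ν+ 19 , 4 ν+ 53) ∷ (4 ν+ 20 , 6 ν+ 61) ∷ (4 ν+ 21 , 4 ν+ 49) ∷ (4 ν+ 22 , 10 ν+ 89) ∷
    (4 ν+ 24 , 4 ν+ 45) ∷ (4 ν+ 25 , 6 ν+ 62) ∷ (4 ν+ 26 , 4 ν+ 52) ∷ (4 ν+ 27 , 4 ν+ 41) ∷
    (4 ν+ 28 , 4 ν+ 51) ∷ (4 ν+ 29 , 6 ν+ 63) ∷ (4 ν+ 30 , 4 ν+ 46) ∷ (4 ν+ 31 , 6 ν+ 54) ∷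
    (4 ν+ 32 , 4 ν+ 42) ∷ (4 ν+ 33 , 4 ν+ 44) ∷ (4 ν+ 34 , 6 ν+ 57) ∷ (4 ν+ 35 , 7 ν+ 65) ∷
    (4 ν+ 36 , 6 ν+ 60) ∷ []) ∷
  solution 10 32 25 (
    (0 ν+ 1 , 10 ν+ 94) ∷ (0 ν+ 2 , 4 ν+ 25) ∷ (0 ν+ 3 , 4 ν+ 18) ∷ (0 ν+ 4 , 8 ν+ 75) ∷
    (0 ν+ 5 , 4 ν+ 24) ∷ (0 ν+ 6 , 8 ν+ 76) ∷ (0 ν+ 7 , 6 ν+ 50) ∷ (0 ν+ 8 , 4 ν+ 20) ∷
    (0 ν+ 9 , 4 ν+ 17) ∷ (0 ν+ 10 , 8 ν+ 61) ∷ (0 ν+ 11 , 4 ν+ 36) ∷ (0 ν+ 12 , 8 ν+ 62) ∷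
    (0 ν+ 13 , 8 ν+ 67) ∷ (0 ν+ 14 , 10 ν+ 87) ∷ (2 ν+ 15 , 8 ν+ 81) ∷ (4 ν+ 16 , 10 ν+ 89) ∷
    (4 ν+ 19 , 4 ν+ 40) ∷ (4 ν+ 22 , 10 ν+ 88) ∷ (4 ν+ 23 , 10 ν+ 85) ∷ (4 ν+ 30 , 4 ν+ 42) ∷
    (4 ν+ 31 , 4 ν+ 34) ∷ (4 ν+ 32 , 4 ν+ 41) ∷ (4 ν+ 33 , 6 ν+ 53) ∷ (4 ν+ 35 , 6 ν+ 49) ∷
    (4 ν+ 37 , 6 ν+ 56) ∷ (4 ν+ 38 , 6 ν+ 52) ∷ (4 ν+ 39 , 4 ν+ 44) ∷ (4 ν+ 43 , 6 ν+ 55) ∷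
    (4 ν+ 45 , 7 ν+ 58) ∷ (4 ν+ 46 , 6 ν+ 54) ∷ (6 ν+ 48 , 8 ν+ 68) ∷ (6 ν+ 51 , 8 ν+ 64) ∷
    (8 ν+ 60 , 8 ν+ 70) ∷ (8 ν+ 63 , 8 ν+ 66) ∷ []) ∷
  solution 8 40 26 (
    (0 ν+ 1 , 8 ν+ 75) ∷ (0 ν+ 2 , 6 ν+ 58) ∷ (0 ν+ 3 , 8 ν+ 81) ∷ (0 ν+ 4 , 4 ν+ 20) ∷
    (0 ν+ 5 , 8 ν+ 82) ∷ (0 ν+ 6 , 10 ν+ 95) ∷ (0 ν+ 7 , 4 ν+ 43) ∷ (0 ν+ 8 , 4 ν+ 22) ∷
    (0 ν+ 9 , 4 ν+ 25) ∷ (0 ν+ 10 , 8 ν+ 78) ∷ (0 ν+ 11 , 8 ν+ 66) ∷ (0 ν+ 12 , 4 ν+ 21) ∷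
    (2 ν+ 13 , 4 ν+ 46) ∷ (4 ν+ 14 , 10 ν+ 99) ∷ (4 ν+ 15 , 10 ν+ 96) ∷ (4 ν+ 16 , 4 ν+ 52) ∷
    (4 ν+ 17 , 10 ν+ 92) ∷ (4 ν+ 18 , 10 ν+ 97) ∷ (4 ν+ 19 , 10 ν+ 91) ∷ (4 ν+ 23 , 4 ν+ 51) ∷
    (4 ν+ 26 , 4 ν+ 47) ∷ (4 ν+ 27 , 4 ν+ 53) ∷ (4 ν+ 28 , 4 ν+ 39) ∷ (4 ν+ 29 , 6 ν+ 61) ∷
    (4 ν+ 31 , 4 ν+ 48) ∷ (4 ν+ 32 , 4 ν+ 38) ∷ (4 ν+ 35 , 4 ν+ 37) ∷ (4 ν+ 36 , 6 ν+ 57) ∷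
    (4 ν+ 40 , 4 ν+ 45) ∷ (4 ν+ 41 , 4 ν+ 42) ∷ (4 ν+ 44 , 7 ν+ 62) ∷ (4 ν+ 49 , 6 ν+ 56) ∷
    (6 ν+ 54 , 8 ν+ 65) ∷ (6 ν+ 55 , 8 ν+ 69) ∷ (8 ν+ 63 , 8 ν+ 64) ∷ []) ∷
  solution 7 41 31 (
    (0 ν+ 1 , 8 ν+ 85) ∷ (0 ν+ 2 , 8 ν+ 90) ∷ (0 ν+ 3 , 6 ν+ 54) ∷ (0 ν+ 4 , 4 ν+ 18) ∷
    (0 ν+ 5 , 4 ν+ 15) ∷ (0 ν+ 6 , 8 ν+ 77) ∷ (0 ν+ 7 , 8 ν+ 84) ∷ (0 ν+ 8 , 8 ν+ 80) ∷
    (0 ν+ 9 , 8 ν+ 78) ∷ (0 ν+ 10 , 4 ν+ 23) ∷ (0 ν+ 11 , 10 ν+ 95) ∷ (2 ν+ 12 , 4 ν+ 46) ∷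
    (4 ν+ 13 , 10 ν+ 101) ∷ (4 ν+ 14 , 10 ν+ 98) ∷ (4 ν+ 16 , 10 ν+ 100) ∷ (4 ν+ 17 , 4 ν+ 47) ∷
    (4 ν+ 19 , 10 ν+ 96) ∷ (4 ν+ 21 , 4 ν+ 53) ∷ (4 ν+ 24 , 4 ν+ 38) ∷ (4 ν+ 25 , 4 ν+ 50) ∷
    (4 ν+ 26 , 4 ν+ 41) ∷ (4 ν+ 27 , 4 ν+ 43) ∷ (4 ν+ 28 , 4 ν+ 35) ∷ (4 ν+ 29 , 10 ν+ 93) ∷
    (4 ν+ 30 , 4 ν+ 39) ∷ (4 ν+ 31 , 4 ν+ 51) ∷ (4 ν+ 32 , 4 ν+ 36) ∷ (4 ν+ 34 , 4 ν+ 45) ∷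
    (4 ν+ 37 , 4 ν+ 44) ∷ (4 ν+ 40 , 4 ν+ 49) ∷ (4 ν+ 42 , 6 ν+ 60) ∷ (4 ν+ 48 , 7 ν+ 61) ∷
    (4 ν+ 52 , 6 ν+ 56) ∷ (6 ν+ 55 , 8 ν+ 65) ∷ (6 ν+ 59 , 8 ν+ 66) ∷ (8 ν+ 71 , 8 ν+ 72) ∷ []) ∷
  solution 12 42 18 (
    (0 ν+ 1 , 8 ν+ 88) ∷ (0 ν+ 2 , 10 ν+ 102) ∷ (0 ν+ 3 , 8 ν+ 80) ∷ (0 ν+ 4 , 8 ν+ 78) ∷
    (0 ν+ 5 , 6 ν+ 62) ∷ (0 ν+ 6 , 4 ν+ 19) ∷ (0 ν+ 7 , 6 ν+ 64) ∷ (0 ν+ 8 , 4 ν+ 50) ∷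
    (0 ν+ 9 , 4 ν+ 46) ∷ (0 ν+ 10 , 4 ν+ 42) ∷ (0 ν+ 11 , 4 ν+ 18) ∷ (0 ν+ 12 , 10 ν+ 99) ∷
    (0 ν+ 13 , 10 ν+ 94) ∷ (0 ν+ 14 , 10 ν+ 96) ∷ (0 ν+ 15 , 4 ν+ 32) ∷ (0 ν+ 16 , 10 ν+ 92) ∷
    (2 ν+ 17 , 4 ν+ 44) ∷ (4 ν+ 20 , 4 ν+ 59) ∷ (4 ν+ 21 , 10 ν+ 101) ∷ (4 ν+ 22 , 10 ν+ 98) ∷
    (4 ν+ 23 , 4 ν+ 53) ∷ (4 ν+ 24 , 4 ν+ 49) ∷ (4 ν+ 26 , 6 ν+ 69) ∷ (4 ν+ 27 , 4 ν+ 57) ∷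
    (4 ν+ 28 , 6 ν+ 65) ∷ (4 ν+ 30 , 6 ν+ 70) ∷ (4 ν+ 31 , 6 ν+ 66) ∷ (4 ν+ 33 , 4 ν+ 54) ∷
    (4 ν+ 34 , 4 ν+ 56) ∷ (4 ν+ 35 , 4 ν+ 51) ∷ (4 ν+ 36 , 4 ν+ 45) ∷ (4 ν+ 37 , 4 ν+ 48) ∷
    (4 ν+ 38 , 4 ν+ 39) ∷ (4 ν+ 40 , 7 ν+ 72) ∷ (4 ν+ 41 , 6 ν+ 68) ∷ (4 ν+ 43 , 6 ν+ 63) ∷
    (6 ν+ 60 , 8 ν+ 74) ∷ []) ∷
  solution 10 41 28 (
    (0 ν+ 1 , 6 ν+ 58) ∷ (0 ν+ 2 , 10 ν+ 102) ∷ (0 ν+ 3 , 8 ν+ 91) ∷ (0 ν+ 4 , 4 ν+ 25) ∷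
    (0 ν+ 5 , 6 ν+ 61) ∷ (0 ν+ 6 , 8 ν+ 87) ∷ (0 ν+ 7 , 10 ν+ 105) ∷ (0 ν+ 8 , 6 ν+ 57) ∷
    (0 ν+ 9 , 8 ν+ 71) ∷ (0 ν+ 10 , 8 ν+ 85) ∷ (0 ν+ 11 , 8 ν+ 78) ∷ (0 ν+ 12 , 4 ν+ 19) ∷
    (0 ν+ 13 , 8 ν+ 79) ∷ (0 ν+ 14 , 4 ν+ 22) ∷ (2 ν+ 15 , 4 ν+ 49) ∷ (4 ν+ 16 , 10 ν+ 107) ∷
    (4 ν+ 17 , 10 ν+ 103) ∷ (4 ν+ 18 , 4 ν+ 55) ∷ (4 ν+ 20 , 4 ν+ 54) ∷ (4 ν+ 21 , 10 ν+ 100) ∷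
    (4 ν+ 23 , 10 ν+ 99) ∷ (4 ν+ 24 , 10 ν+ 101) ∷ (4 ν+ 26 , 4 ν+ 56) ∷ (4 ν+ 27 , 4 ν+ 43) ∷
    (4 ν+ 28 , 4 ν+ 41) ∷ (4 ν+ 30 , 4 ν+ 42) ∷ (4 ν+ 32 , 4 ν+ 44) ∷ (4 ν+ 33 , 4 ν+ 51) ∷
    (4 ν+ 34 , 6 ν+ 63) ∷ (4 ν+ 35 , 4 ν+ 46) ∷ (4 ν+ 37 , 10 ν+ 96) ∷ (4 ν+ 38 , 4 ν+ 45) ∷
    (4 ν+ 39 , 4 ν+ 47) ∷ (4 ν+ 40 , 4 ν+ 50) ∷ (4 ν+ 48 , 7 ν+ 67) ∷ (4 ν+ 52 , 6 ν+ 62) ∷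
    (4 ν+ 53 , 6 ν+ 60) ∷ (8 ν+ 68 , 8 ν+ 75) ∷ []) ∷
  solution 13 44 19 (
    (0 ν+ 1 , 4 ν+ 56) ∷ (0 ν+ 2 , 10 ν+ 98) ∷ (0 ν+ 3 , 6 ν+ 65) ∷ (0 ν+ 4 , 6 ν+ 70) ∷
    (0 ν+ 5 , 4 ν+ 21) ∷ (0 ν+ 6 , 10 ν+ 104) ∷ (0 ν+ 7 , 4 ν+ 45) ∷ (0 ν+ 8 , 8 ν+ 83) ∷
    (0 ν+ 9 , 6 ν+ 63) ∷ (0 ν+ 10 , 8 ν+ 82) ∷ (0 ν+ 11 , 4 ν+ 22) ∷ (0 ν+ 12 , 10 ν+ 105) ∷
    (0 ν+ 13 , 8 ν+ 80) ∷ (0 ν+ 14 , 4 ν+ 41) ∷ (0 ν+ 15 , 4 ν+ 46) ∷ (0 ν+ 16 , 4 ν+ 34) ∷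
    (0 ν+ 17 , 8 ν+ 77) ∷ (2 ν+ 18 , 8 ν+ 81) ∷ (4 ν+ 19 , 10 ν+ 106) ∷ (4 ν+ 20 , 10 ν+ 102) ∷
    (4 ν+ 23 , 10 ν+ 101) ∷ (4 ν+ 24 , 4 ν+ 54) ∷ (4 ν+ 25 , 4 ν+ 62) ∷ (4 ν+ 27 , 6 ν+ 69) ∷
    (4 ν+ 28 , 4 ν+ 60) ∷ (4 ν+ 29 , 10 ν+ 97) ∷ (4 ν+ 30 , 4 ν+ 59) ∷ (4 ν+ 31 , 4 ν+ 53) ∷
    (4 ν+ 32 , 4 ν+ 58) ∷ (4 ν+ 35 , 4 ν+ 51) ∷ (4 ν+ 36 , 4 ν+ 49) ∷ (4 ν+ 37 , 6 ν+ 66) ∷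
    (4 ν+ 38 , 6 ν+ 71) ∷ (4 ν+ 39 , 6 ν+ 75) ∷ (4 ν+ 40 , 6 ν+ 67) ∷ (4 ν+ 42 , 7 ν+ 76) ∷
    (4 ν+ 43 , 6 ν+ 73) ∷ (4 ν+ 44 , 6 ν+ 64) ∷ (4 ν+ 47 , 4 ν+ 48) ∷ []) ∷
  solution 13 37 29 (
    (0 ν+ 1 , 10 ν+ 115) ∷ (0 ν+ 2 , 8 ν+ 96) ∷ (0 ν+ 3 , 8 ν+ 94) ∷ (0 ν+ 4 , 6 ν+ 58) ∷
    (0 ν+ 5 , 4 ν+ 22) ∷ (0 ν+ 6 , 6 ν+ 61) ∷ (0 ν+ 7 , 10 ν+ 112) ∷ (0 ν+ 8 , 4 ν+ 34) ∷
    (0 ν+ 9 , 4 ν+ 28) ∷ (0 ν+ 10 , 4 ν+ 30) ∷ (0 ν+ 11 , 8 ν+ 82) ∷ (0 ν+ 12 , 8 ν+ 83) ∷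
    (0 ν+ 13 , 8 ν+ 73) ∷ (0 ν+ 14 , 4 ν+ 29) ∷ (0 ν+ 15 , 4 ν+ 23) ∷ (0 ν+ 16 , 4 ν+ 20) ∷
    (0 ν+ 17 , 4 ν+ 32) ∷ (2 ν+ 18 , 6 ν+ 56) ∷ (4 ν+ 19 , 10 ν+ 104) ∷ (4 ν+ 21 , 10 ν+ 109) ∷
    (4 ν+ 24 , 4 ν+ 51) ∷ (4 ν+ 25 , 10 ν+ 108) ∷ (4 ν+ 26 , 10 ν+ 100) ∷ (4 ν+ 31 , 4 ν+ 48) ∷
    (4 ν+ 33 , 6 ν+ 68) ∷ (4 ν+ 35 , 4 ν+ 55) ∷ (4 ν+ 39 , 10 ν+ 99) ∷ (4 ν+ 41 , 4 ν+ 50) ∷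
    (4 ν+ 44 , 6 ν+ 63) ∷ (4 ν+ 45 , 6 ν+ 66) ∷ (4 ν+ 46 , 6 ν+ 57) ∷ (4 ν+ 47 , 6 ν+ 59) ∷
    (4 ν+ 52 , 7 ν+ 69) ∷ (4 ν+ 53 , 6 ν+ 65) ∷ (4 ν+ 54 , 6 ν+ 60) ∷ (6 ν+ 64 , 8 ν+ 77) ∷
    (8 ν+ 70 , 8 ν+ 85) ∷ (8 ν+ 71 , 8 ν+ 80) ∷ (8 ν+ 72 , 8 ν+ 84) ∷ (8 ν+ 76 , 8 ν+ 78) ∷ []) ∷
  solution 11 44 31 (
    (0 ν+ 1 , 8 ν+ 99) ∷ (0 ν+ 2 , 8 ν+ 95) ∷ (0 ν+ 3 , 4 ν+ 20) ∷ (0 ν+ 4 , 4 ν+ 28) ∷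
    (0 ν+ 5 , 6 ν+ 61) ∷ (0 ν+ 6 , 4 ν+ 19) ∷ (0 ν+ 7 , 8 ν+ 91) ∷ (0 ν+ 8 , 4 ν+ 29) ∷
    (0 ν+ 9 , 4 ν+ 22) ∷ (0 ν+ 10 , 4 ν+ 24) ∷ (0 ν+ 11 , 10 ν+ 108) ∷ (0 ν+ 12 , 8 ν+ 90) ∷
    (0 ν+ 13 , 10 ν+ 109) ∷ (0 ν+ 14 , 10 ν+ 107) ∷ (0 ν+ 15 , 4 ν+ 30) ∷ (2 ν+ 16 , 8 ν+ 94) ∷
    (4 ν+ 17 , 10 ν+ 112) ∷ (4 ν+ 18 , 10 ν+ 115) ∷ (4 ν+ 21 , 4 ν+ 56) ∷ (4 ν+ 26 , 4 ν+ 53) ∷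
    (4 ν+ 27 , 4 ν+ 58) ∷ (4 ν+ 33 , 4 ν+ 54) ∷ (4 ν+ 35 , 4 ν+ 38) ∷ (4 ν+ 36 , 4 ν+ 57) ∷
    (4 ν+ 39 , 6 ν+ 67) ∷ (4 ν+ 40 , 4 ν+ 44) ∷ (4 ν+ 41 , 6 ν+ 70) ∷ (4 ν+ 42 , 4 ν+ 50) ∷
    (4 ν+ 43 , 4 ν+ 60) ∷ (4 ν+ 46 , 4 ν+ 55) ∷ (4 ν+ 47 , 6 ν+ 71) ∷ (4 ν+ 48 , 6 ν+ 65) ∷
    (4 ν+ 49 , 6 ν+ 68) ∷ (4 ν+ 51 , 6 ν+ 63) ∷ (4 ν+ 52 , 7 ν+ 72) ∷ (4 ν+ 59 , 6 ν+ 64) ∷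
    (6 ν+ 62 , 8 ν+ 82) ∷ (6 ν+ 69 , 8 ν+ 76) ∷ (8 ν+ 74 , 8 ν+ 86) ∷ (8 ν+ 75 , 8 ν+ 78) ∷
    (8 ν+ 80 , 8 ν+ 81) ∷ []) ∷
  solution 13 40 32 (
    (0 ν+ 1 , 6 ν+ 59) ∷ (0 ν+ 2 , 10 ν+ 121) ∷ (0 ν+ 3 , 4 ν+ 24) ∷ (0 ν+ 4 , 4 ν+ 21) ∷
    (0 ν+ 5 , 8 ν+ 90) ∷ (0 ν+ 6 , 8 ν+ 91) ∷ (0 ν+ 7 , 4 ν+ 26) ∷ (0 ν+ 8 , 4 ν+ 34) ∷
    (0 ν+ 9 , 8 ν+ 92) ∷ (0 ν+ 10 , 10 ν+ 108) ∷ (0 ν+ 11 , 8 ν+ 82) ∷ (0 ν+ 12 , 4 ν+ 19) ∷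
    (0 ν+ 13 , 4 ν+ 32) ∷ (0 ν+ 14 , 4 ν+ 30) ∷ (0 ν+ 15 , 8 ν+ 89) ∷ (0 ν+ 16 , 8 ν+ 87) ∷
    (0 ν+ 17 , 4 ν+ 29) ∷ (2 ν+ 18 , 8 ν+ 94) ∷ (4 ν+ 20 , 10 ν+ 111) ∷ (4 ν+ 22 , 10 ν+ 113) ∷
    (4 ν+ 23 , 10 ν+ 110) ∷ (4 ν+ 28 , 4 ν+ 51) ∷ (4 ν+ 35 , 4 ν+ 40) ∷ (4 ν+ 36 , 4 ν+ 52) ∷
    (4 ν+ 37 , 6 ν+ 69) ∷ (4 ν+ 38 , 4 ν+ 58) ∷ (4 ν+ 39 , 4 ν+ 41) ∷ (4 ν+ 43 , 6 ν+ 71) ∷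
    (4 ν+ 47 , 6 ν+ 62) ∷ (4 ν+ 48 , 6 ν+ 67) ∷ (4 ν+ 49 , 4 ν+ 50) ∷ (4 ν+ 53 , 6 ν+ 66) ∷
    (4 ν+ 54 , 6 ν+ 63) ∷ (4 ν+ 55 , 7 ν+ 72) ∷ (4 ν+ 56 , 6 ν+ 70) ∷ (4 ν+ 57 , 6 ν+ 68) ∷
    (6 ν+ 61 , 8 ν+ 78) ∷ (6 ν+ 64 , 8 ν+ 86) ∷ (6 ν+ 65 , 8 ν+ 83) ∷ (8 ν+ 73 , 8 ν+ 84) ∷
    (8 ν+ 74 , 8 ν+ 81) ∷ (8 ν+ 76 , 8 ν+ 77) ∷ []) ∷
  solution 14 43 29 (
    (0 ν+ 1 , 8 ν+ 101) ∷ (0 ν+ 2 , 8 ν+ 104) ∷ (0 ν+ 3 , 6 ν+ 72) ∷ (0 ν+ 4 , 4 ν+ 20) ∷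
    (0 ν+ 5 , 8 ν+ 100) ∷ (0 ν+ 6 , 10 ν+ 115) ∷ (0 ν+ 7 , 8 ν+ 96) ∷ (0 ν+ 8 , 4 ν+ 23) ∷
    (0 ν+ 9 , 4 ν+ 39) ∷ (0 ν+ 10 , 4 ν+ 28) ∷ (0 ν+ 11 , 4 ν+ 25) ∷ (0 ν+ 12 , 8 ν+ 82) ∷
    (0 ν+ 13 , 8 ν+ 85) ∷ (0 ν+ 14 , 10 ν+ 114) ∷ (0 ν+ 15 , 4 ν+ 35) ∷ (0 ν+ 16 , 4 ν+ 26) ∷
    (0 ν+ 17 , 4 ν+ 45) ∷ (0 ν+ 18 , 4 ν+ 40) ∷ (2 ν+ 19 , 8 ν+ 99) ∷ (4 ν+ 21 , 10 ν+ 116) ∷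
    (4 ν+ 22 , 10 ν+ 119) ∷ (4 ν+ 27 , 10 ν+ 112) ∷ (4 ν+ 29 , 4 ν+ 49) ∷ (4 ν+ 30 , 4 ν+ 51) ∷
    (4 ν+ 32 , 4 ν+ 52) ∷ (4 ν+ 33 , 4 ν+ 56) ∷ (4 ν+ 34 , 4 ν+ 61) ∷ (4 ν+ 37 , 4 ν+ 60) ∷
    (4 ν+ 41 , 6 ν+ 70) ∷ (4 ν+ 43 , 6 ν+ 66) ∷ (4 ν+ 44 , 6 ν+ 73) ∷ (4 ν+ 46 , 6 ν+ 64) ∷
    (4 ν+ 47 , 6 ν+ 76) ∷ (4 ν+ 53 , 7 ν+ 77) ∷ (4 ν+ 54 , 6 ν+ 71) ∷ (4 ν+ 55 , 6 ν+ 74) ∷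
    (4 ν+ 57 , 6 ν+ 69) ∷ (4 ν+ 59 , 6 ν+ 68) ∷ (6 ν+ 63 , 8 ν+ 91) ∷ (6 ν+ 65 , 8 ν+ 83) ∷
    (6 ν+ 67 , 8 ν+ 86) ∷ (8 ν+ 79 , 8 ν+ 90) ∷ (8 ν+ 80 , 8 ν+ 88) ∷ []) ∷
  solution 14 46 29 (
    (0 ν+ 1 , 8 ν+ 105) ∷ (0 ν+ 2 , 8 ν+ 92) ∷ (0 ν+ 3 , 6 ν+ 70) ∷ (0 ν+ 4 , 4 ν+ 23) ∷
    (0 ν+ 5 , 8 ν+ 102) ∷ (0 ν+ 6 , 4 ν+ 25) ∷ (0 ν+ 7 , 8 ν+ 91) ∷ (0 ν+ 8 , 6 ν+ 68) ∷
    (0 ν+ 9 , 8 ν+ 90) ∷ (0 ν+ 10 , 10 ν+ 120) ∷ (0 ν+ 11 , 8 ν+ 97) ∷ (0 ν+ 12 , 4 ν+ 37) ∷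
    (0 ν+ 13 , 8 ν+ 87) ∷ (0 ν+ 14 , 4 ν+ 42) ∷ (0 ν+ 15 , 4 ν+ 48) ∷ (0 ν+ 16 , 8 ν+ 88) ∷
    (0 ν+ 17 , 4 ν+ 22) ∷ (0 ν+ 18 , 4 ν+ 44) ∷ (2 ν+ 19 , 6 ν+ 77) ∷ (4 ν+ 20 , 10 ν+ 118) ∷
    (4 ν+ 21 , 10 ν+ 114) ∷ (4 ν+ 24 , 4 ν+ 58) ∷ (4 ν+ 26 , 10 ν+ 119) ∷ (4 ν+ 28 , 10 ν+ 115) ∷
    (4 ν+ 29 , 10 ν+ 111) ∷ (4 ν+ 30 , 10 ν+ 112) ∷ (4 ν+ 32 , 4 ν+ 61) ∷ (4 ν+ 33 , 4 ν+ 50) ∷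
    (4 ν+ 34 , 4 ν+ 47) ∷ (4 ν+ 35 , 6 ν+ 78) ∷ (4 ν+ 36 , 4 ν+ 59) ∷ (4 ν+ 38 , 4 ν+ 65) ∷
    (4 ν+ 40 , 4 ν+ 46) ∷ (4 ν+ 41 , 4 ν+ 60) ∷ (4 ν+ 43 , 6 ν+ 74) ∷ (4 ν+ 45 , 4 ν+ 64) ∷
    (4 ν+ 51 , 6 ν+ 75) ∷ (4 ν+ 52 , 6 ν+ 79) ∷ (4 ν+ 53 , 7 ν+ 80) ∷ (4 ν+ 54 , 6 ν+ 69) ∷
    (4 ν+ 55 , 6 ν+ 66) ∷ (4 ν+ 57 , 6 ν+ 71) ∷ (6 ν+ 67 , 8 ν+ 84) ∷ (6 ν+ 72 , 8 ν+ 85) ∷ []) ∷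
  solution 15 49 26 (
    (0 ν+ 1 , 8 ν+ 103) ∷ (0 ν+ 2 , 6 ν+ 76) ∷ (0 ν+ 3 , 8 ν+ 97) ∷ (0 ν+ 4 , 8 ν+ 92) ∷
    (0 ν+ 5 , 4 ν+ 26) ∷ (0 ν+ 6 , 6 ν+ 73) ∷ (0 ν+ 7 , 0 ν+ 9) ∷ (0 ν+ 8 , 4 ν+ 28) ∷
    (0 ν+ 10 , 6 ν+ 72) ∷ (0 ν+ 11 , 4 ν+ 55) ∷ (0 ν+ 12 , 4 ν+ 25) ∷ (0 ν+ 13 , 10 ν+ 121) ∷
    (0 ν+ 14 , 4 ν+ 27) ∷ (0 ν+ 15 , 8 ν+ 87) ∷ (0 ν+ 17 , 8 ν+ 88) ∷ (0 ν+ 18 , 10 ν+ 115) ∷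
    (0 ν+ 19 , 4 ν+ 46) ∷ (2 ν+ 20 , 8 ν+ 109) ∷ (4 ν+ 21 , 10 ν+ 117) ∷ (4 ν+ 22 , 10 ν+ 120) ∷
    (4 ν+ 23 , 10 ν+ 124) ∷ (4 ν+ 24 , 4 ν+ 69) ∷ (4 ν+ 29 , 4 ν+ 61) ∷ (4 ν+ 30 , 4 ν+ 64) ∷
    (4 ν+ 32 , 6 ν+ 84) ∷ (4 ν+ 33 , 10 ν+ 118) ∷ (4 ν+ 34 , 4 ν+ 67) ∷ (4 ν+ 35 , 10 ν+ 113) ∷
    (4 ν+ 38 , 4 ν+ 57) ∷ (4 ν+ 39 , 4 ν+ 59) ∷ (4 ν+ 40 , 4 ν+ 68) ∷ (4 ν+ 42 , 6 ν+ 77) ∷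
    (4 ν+ 43 , 4 ν+ 56) ∷ (4 ν+ 44 , 4 ν+ 62) ∷ (4 ν+ 45 , 6 ν+ 83) ∷ (4 ν+ 47 , 6 ν+ 80) ∷
    (4 ν+ 48 , 4 ν+ 63) ∷ (4 ν+ 49 , 6 ν+ 81) ∷ (4 ν+ 50 , 4 ν+ 60) ∷ (4 ν+ 51 , 7 ν+ 85) ∷
    (4 ν+ 52 , 6 ν+ 71) ∷ (4 ν+ 53 , 4 ν+ 54) ∷ (4 ν+ 58 , 6 ν+ 74) ∷ (6 ν+ 70 , 8 ν+ 89) ∷
    (6 ν+ 75 , 8 ν+ 86) ∷ []) ∷
  []

abstract
  patterns-additive : ∀ i → IsAdditive (Vec.lookup patterns i)
  patterns-additive = from-yes (all? λ i → isAdditive? (Vec.lookup patterns i))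

  patterns-injective : ∀ i j → (∀ o → digit (Vec.lookup patterns i) o ≡ digit (Vec.lookup patterns j) o) → i ≡ j
  patterns-injective = from-yes (all? λ i → all? λ j →
    (all? λ o → digit (Vec.lookup patterns i) o ℕₚ.≟ digit (Vec.lookup patterns j) o) →-dec i ≟ j)

  solutions-correct : ∀ i → IsSolution (10 + toℕ i) (Vec.lookup solutions i)
  solutions-correct = from-yes (all? λ i → isSolution? (10 + toℕ i) (Vec.lookup solutions i))

-- The construction

Yields : ℕ → ℕ → ℕ × ℕ → Set
Yields v d (a , b) = d ≡ a ⊎ d ≡ b ⊎ d ≡ a + b ⊎ d + (a + b) ≡ v

-- The base triangles (0 , a , a + b) and (0 , b , a + b) have the same differences, but the third
-- point of the block through 0 and a is a + b for the first and -b for the second. This is the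
-- factor 2 per triple.
orient : Fin 2 → ℕ × ℕ → ℕ × ℕ
orient zero    t       = t
orient (suc _) (a , b) = b , a

yields-orient : ∀ {v d} β t → Yields v d t → Yields v d (orient β t)
yields-orient zero t y = y
yields-orient (suc _) (a , b) (inj₁ y) = inj₂ (inj₁ y)
yields-orient (suc _) (a , b) (inj₂ (inj₁ y)) = inj₁ y
yields-orient (suc _) (a , b) (inj₂ (inj₂ (inj₁ y))) = inj₂ (inj₂ (inj₁ (trans y (ℕₚ.+-comm a b))))
yields-orient {d = d} (suc _) (a , b) (inj₂ (inj₂ (inj₂ y))) =
  inj₂ (inj₂ (inj₂ (trans (cong (d +_) (ℕₚ.+-comm b a)) y)))

divide : ∀ {k u} m → u < k * m → ∃[ i ] ∃[ o ] u ≡ m * toℕ {k} i + toℕ {m} o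
divide {k} {u} m u< = i , o , (begin
  u                      ≡⟨ toℕ-fromℕ< u< ⟨
  toℕ x                  ≡⟨ cong toℕ (combine-remQuot {k} m x) ⟨
  toℕ (combine i o)      ≡⟨ toℕ-combine i o ⟩
  m * toℕ i + toℕ o      ∎)
  where
  open ≡-Reasoning
  x = fromℕ< u<
  i = proj₁ (remQuot {k} m x)
  o = proj₂ (remQuot {k} m x)

toℕ-opposite : ∀ {k} (i : Fin k) → k ≡ suc (toℕ i + toℕ (opposite i))
toℕ-opposite {k} i = sym (trans (cong (suc (toℕ i) +_) (opposite-prop i)) (ℕₚ.m+[n∸m]≡n (toℕ<n i)))

module Construction (κ r : ℕ) (S : Solution) (S-correct : IsSolution r S)
  {R : ℕ} (pattern′ : Fin R → ℕ) (pattern-additive : ∀ i → IsAdditive (pattern′ i))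
  (n v : ℕ) {{_ : NonZero v}} (n≡ : 36 * κ + r ≡ n) (v≡ : 6 * n + 3 ≡ v) where

  open Solution S
  open ℤ/ v

  -- A block consists of nine difference triples
  -- (A + o , B + p(o) , C + (o + p(o) − 4)), where C = A + B + 4.  As in the
  -- classical Skolem sequences there are two nests of blocks (ε): as i grows,
  -- the B-intervals move down and the C-intervals up by 9.  Each nest is cut in
  -- two halves (ω) shifted by 1 against each other, since for uncut nests a
  -- parity argument excludes any table for the leftover numbers.
  Block : Set
  Block = Fin 2 × Fin κ × Fin 2

  -- C - B grows by 18 with each step of i, so A has to advance by 18; the A-intervals of the two
  -- nests, each of length 9, fill these steps alternately. The 1 beside κ is the shift between the
  -- halves, made by A and passed on to C while B stays contiguous.
  A : Block → ℕ
  A (ω , i , ε) = 5 + w + (18 * κ + 1) * toℕ ω + 18 * toℕ i + 9 * toℕ ε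

  B₀ C₀ : Fin 2 → ℕ
  B₀ zero    = 6 + w + j + 36 * κ
  B₀ (suc _) = 7 + 2 * w + j + h + 72 * κ
  C₀ ε = w + B₀ ε + 9 * toℕ ε + 18 * κ

  B C : Block → ℕ
  B (ω , i , ε) = B₀ ε + 9 * κ * toℕ (opposite ω) + 9 * toℕ (opposite i)
  C (ω , i , ε) = C₀ ε + (9 * κ + 1) * toℕ ω + 9 * toℕ i

  A+B+4≡C : ∀ e → A e + B e + 4 ≡ C e
  -- Writing κ as 1 + i + `opposite i` removes the subtraction and leaves a polynomial identity for
  -- each half.
  A+B+4≡C (ω , i , ε) = go ω {κ} {toℕ i} {toℕ (opposite i)} (toℕ-opposite i)
    where
    go : ∀ ω {k l m} → k ≡ suc (l + m) →
      5 + w + (18 * k + 1) * toℕ ω + 18 * l + 9 * toℕ ε + (B₀ ε + 9 * k * toℕ (opposite ω) + 9 * m) + 4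
      ≡ w + B₀ ε + 9 * toℕ ε + 18 * k + (9 * k + 1) * toℕ ω + 9 * l
    go zero {_} {l} {m} refl = eq w (B₀ ε) (toℕ ε) l m
      where
      eq : ∀ w b ε l m → 5 + w + (18 * (1 + (l + m)) + 1) * 0 + 18 * l + 9 * ε + (b + 9 * (1 + (l + m)) * 1 + 9 * m) + 4
        ≡ w + b + 9 * ε + 18 * (1 + (l + m)) + (9 * (1 + (l + m)) + 1) * 0 + 9 * l
      eq = solve-∀
    go (suc zero) {_} {l} {m} refl = eq w (B₀ ε) (toℕ ε) l m
      where
      eq : ∀ w b ε l m → 5 + w + (18 * (1 + (l + m)) + 1) * 1 + 18 * l + 9 * ε + (b + 9 * (1 + (l + m)) * 0 + 9 * m) + 4
        ≡ w + b + 9 * ε + 18 * (1 + (l + m)) + (9 * (1 + (l + m)) + 1) * 1 + 9 * l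
      eq = solve-∀

  Blocks : ℕ
  Blocks = 2 * κ * 2

  block# : Block → Fin Blocks
  block# (ω , i , ε) = combine (combine ω i) ε

  attach : Fin 2 → Fin 2 × Fin κ → Block
  attach ε (ω , i) = ω , i , ε

  split : Fin (2 * κ) × Fin 2 → Block
  split (ωi , ε) = attach ε (remQuot {2} κ ωi)

  #block : Fin Blocks → Block
  #block e = split (remQuot {2 * κ} 2 e)

  #block-block# : ∀ e → #block (block# e) ≡ e
  #block-block# (ω , i , ε) = trans (cong split (remQuot-combine {2 * κ} {2} (combine ω i) ε))
    (cong (attach ε) (remQuot-combine {2} {κ} ω i))

  block#-#block : ∀ e → block# (#block e) ≡ e
  block#-#block e =
    trans (cong (λ z → combine z (proj₂ (remQuot {2 * κ} 2 e))) (combine-remQuot {2} κ (proj₁ (remQuot {2 * κ} 2 e))))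
    (combine-remQuot {2 * κ} 2 e)

  ν : ℕ
  ν = 9 * κ

  value : Position → ℕ
  value (p ν+ c) = c + p * ν

  value-⊞ : ∀ x y → value (x ⊞ y) ≡ value x + value y
  value-⊞ (p ν+ c) (q ν+ d) = eq p c q d ν
    where
    eq : ∀ p c q d ν → c + d + (p + q) * ν ≡ c + p * ν + (d + q * ν)
    eq = solve-∀

  15+3w+j+h≡3r : 15 + 3 * w + j + h ≡ 3 * r
  15+3w+j+h≡3r = proj₁ (proj₂ S-correct)

  -- The block intervals hold 108κ numbers and the gaps 16 + 3w + j + h. The latter is 3r + 1: three
  -- numbers for each leftover triple and one for 2n + 1.
  last≡ : 17 + 3 * w + j + h + 108 * κ ≡ 3 * n + 2
  last≡ = begin
    17 + 3 * w + j + h + 108 * κ         ≡⟨ eq₁ w j h κ ⟩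
    15 + 3 * w + j + h + (2 + 108 * κ)   ≡⟨ cong (_+ (2 + 108 * κ)) 15+3w+j+h≡3r ⟩
    3 * r + (2 + 108 * κ)                ≡⟨ eq₂ r κ ⟩
    3 * (36 * κ + r) + 2                 ≡⟨ cong (λ n → 3 * n + 2) n≡ ⟩
    3 * n + 2                            ∎
    where
    open ≡-Reasoning
    eq₁ : ∀ w j h κ → 17 + 3 * w + j + h + 108 * κ ≡ 15 + 3 * w + j + h + (2 + 108 * κ)
    eq₁ = solve-∀
    eq₂ : ∀ r κ → 3 * r + (2 + 108 * κ) ≡ 3 * (36 * κ + r) + 2
    eq₂ = solve-∀

  -- This keeps the sum a + b of every block triple in the lower half of ℤ_v, on which the
  -- separation of the two orientations in `image-mixed` rests.
  C+9≤ : ∀ e → C e + 9 ≤ 3 * n + 2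
  C+9≤ (ω , i , ε) = begin
    C₀ ε + (9 * κ + 1) * toℕ ω + 9 * toℕ i + 9
      ≤⟨ ℕₚ.+-monoˡ-≤ 9 (ℕₚ.+-monoˡ-≤ (9 * toℕ i) (ℕₚ.+-mono-≤ (C₀≤ ε) (ℕₚ.*-monoʳ-≤ (9 * κ + 1) (ℕₚ.≤-pred (toℕ<n ω))))) ⟩
    16 + 3 * w + j + h + 90 * κ + (9 * κ + 1) * 1 + 9 * toℕ i + 9 ≡⟨ eq w j h κ (toℕ i) ⟩
    17 + 3 * w + j + h + 99 * κ + 9 * suc (toℕ i)
      ≤⟨ ℕₚ.+-monoʳ-≤ (17 + 3 * w + j + h + 99 * κ) (ℕₚ.*-monoʳ-≤ 9 (toℕ<n i)) ⟩
    17 + 3 * w + j + h + 99 * κ + 9 * κ   ≡⟨ eq′ w j h κ ⟩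
    17 + 3 * w + j + h + 108 * κ          ≡⟨ last≡ ⟩
    3 * n + 2                             ∎
    where
    open ℕₚ.≤-Reasoning
    eq : ∀ w j h κ i → 16 + 3 * w + j + h + 90 * κ + (9 * κ + 1) * 1 + 9 * i + 9 ≡ 17 + 3 * w + j + h + 99 * κ + 9 * (1 + i)
    eq = solve-∀
    eq′ : ∀ w j h κ → 17 + 3 * w + j + h + 99 * κ + 9 * κ ≡ 17 + 3 * w + j + h + 108 * κ
    eq′ = solve-∀
    C₀≤ : ∀ ε → C₀ ε ≤ 16 + 3 * w + j + h + 90 * κ
    C₀≤ zero = subst (C₀ zero ≤_) (e₁ w j h κ) (ℕₚ.m≤m+n (C₀ zero) (10 + w + h + 36 * κ))
      where
      e₁ : ∀ w j h κ → w + (6 + w + j + 36 * κ) + 9 * 0 + 18 * κ + (10 + w + h + 36 * κ) ≡ 16 + 3 * w + j + h + 90 * κ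
      e₁ = solve-∀
    C₀≤ (suc zero) = ℕₚ.≤-reflexive (e₂ w j h κ)
      where
      e₂ : ∀ w j h κ → w + (7 + 2 * w + j + h + 72 * κ) + 9 * 1 + 18 * κ ≡ 16 + 3 * w + j + h + 90 * κ
      e₂ = solve-∀

  module _ (perm : Block → Fin R) (flips : Block → Fin 9 → Fin 2) where

    p : Block → Fin 9 → ℕ
    p e o = digit (pattern′ (perm e)) o

    pair : Block → Fin 9 → ℕ × ℕ
    pair e o = A e + toℕ o , B e + p e o

    oriented : Block → Fin 9 → ℕ × ℕ
    oriented e o = orient (flips e o) (pair e o)

    entry : Fin (Blocks * 9) → ℕ × ℕ
    entry x = uncurry (oriented ∘ #block) (remQuot {Blocks} 9 x)

    triples : List (ℕ × ℕ)
    triples = tabulate entry ++ map (λ (a , b) → value a , value b) leftover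

    oriented∈triples : ∀ e o → oriented e o ∈ triples
    oriented∈triples e o =
      ∈-++⁺ˡ (subst (_∈ tabulate entry) eq (∈-tabulate⁺ {f = entry} (combine (block# e) o)))
      where
      eq : entry (combine (block# e) o) ≡ oriented e o
      eq = trans (cong (uncurry (oriented ∘ #block)) (remQuot-combine {Blocks} {9} (block# e) o))
        (cong (λ e → oriented e o) (#block-block# e))

    length-triples : length triples ≡ n
    length-triples = begin
      length triples ≡⟨ length-++ (tabulate entry) ⟩
      _              ≡⟨ cong₂ _+_ (length-tabulate entry) (trans (length-map _ leftover) (proj₁ S-correct)) ⟩
      2 * κ * 2 * 9 + r ≡⟨ cong (_+ r) (eq κ) ⟩
      36 * κ + r     ≡⟨ n≡ ⟩
      n              ∎
      where
      open ≡-Reasoning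
      eq : ∀ κ → 2 * κ * 2 * 9 ≡ 36 * κ
      eq = solve-∀

    Covered : ℕ → Set
    Covered d = d ≡ 2 * n + 1 ⊎ Any (Yields v d) triples

    CoveredFrom : ℕ → ℕ → Set
    CoveredFrom s ℓ = ∀ u → u < ℓ → Covered (s + u)

    pair-covered : ∀ e o {d} → Yields v d (pair e o) → Covered d
    pair-covered e o y = inj₂ (lose (oriented∈triples e o) (yields-orient (flips e o) (pair e o) y))

    accounted-covered : ∀ {x} → Accounted r S x → Covered (value x)
    accounted-covered {x} (inj₁ refl) = inj₁ (trans (eq r κ) (cong (λ n → 2 * n + 1) n≡))
      where
      eq : ∀ r κ → 2 * r + 1 + 8 * (9 * κ) ≡ 2 * (36 * κ + r) + 1
      eq = solve-∀
    accounted-covered {x} (inj₂ x∈) =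
      inj₂ (Anyₚ.++⁺ʳ (tabulate entry) (Anyₚ.map⁺ (Any.map (λ {t} → yields t) x∈)))
      where
      yields : ∀ ((a , b) : Position × Position) → x ≡ a ⊎ x ≡ b ⊎ x ≡ a ⊞ b ⊎ x ⊞ (a ⊞ b) ≡ 24 ν+ (6 * r + 3) →
               Yields v (value x) (value a , value b)
      yields (a , b) (inj₁ refl) = inj₁ refl
      yields (a , b) (inj₂ (inj₁ refl)) = inj₂ (inj₁ refl)
      yields (a , b) (inj₂ (inj₂ (inj₁ refl))) = inj₂ (inj₂ (inj₁ (value-⊞ a b)))
      yields (a , b) (inj₂ (inj₂ (inj₂ q))) = inj₂ (inj₂ (inj₂ (begin
        value x + (value a + value b)     ≡⟨ cong (value x +_) (value-⊞ a b) ⟨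
        value x + value (a ⊞ b)           ≡⟨ value-⊞ x (a ⊞ b) ⟨
        value (x ⊞ (a ⊞ b))               ≡⟨ cong value q ⟩
        6 * r + 3 + 24 * (9 * κ)          ≡⟨ eq r κ ⟩
        6 * (36 * κ + r) + 3              ≡⟨ cong (λ n → 6 * n + 3) n≡ ⟩
        6 * n + 3                         ≡⟨ v≡ ⟩
        v                                 ∎)))
        where
        open ≡-Reasoning
        eq : ∀ r κ → 6 * r + 3 + 24 * (9 * κ) ≡ 6 * (36 * κ + r) + 3
        eq = solve-∀

    filled-covered : ∀ {q c ℓ} → Filled r S q c ℓ → CoveredFrom (value (q ν+ c)) ℓ
    filled-covered {q} {c} filled u u<ℓ = subst Covered eq (accounted-covered (filled (fromℕ< u<ℓ)))
      where
      eq : c + toℕ (fromℕ< u<ℓ) + q * ν ≡ c + q * ν + u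
      eq = trans (cong (λ t → c + t + q * ν) (toℕ-fromℕ< u<ℓ)) (e c u (q * ν))
        where
        e : ∀ c u m → c + u + m ≡ c + m + u
        e = solve-∀

    A-covered : ∀ ω → CoveredFrom (5 + w + (18 * κ + 1) * toℕ ω) (18 * κ)
    A-covered ω u u< =
      let i , y , u≡ = divide {κ} 18 (subst (u <_) (ℕₚ.*-comm 18 κ) u<)
          ε , o , y≡ = divide {2} 9 (toℕ<n y)
      in pair-covered (ω , i , ε) o (inj₁ (trans
        (cong (a +_) (trans u≡ (cong (18 * toℕ i +_) y≡)))
        (eq a (18 * toℕ i) (9 * toℕ ε) (toℕ o))))
      where
      a = 5 + w + (18 * κ + 1) * toℕ ω
      eq : ∀ a b c d → a + (b + (c + d)) ≡ a + b + c + d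
      eq = solve-∀

    B-covered : ∀ ω ε → CoveredFrom (B₀ ε + 9 * κ * toℕ (opposite ω)) (9 * κ)
    B-covered ω ε u u< =
      let i′ , t , u≡ = divide {κ} 9 (subst (u <_) (ℕₚ.*-comm 9 κ) u<)
          -- B descends as i grows, so the interval that is i′-th from below belongs to
          -- `opposite i′`.
          e = ω , opposite i′ , ε
          o , t≡ = proj₁ (pattern-additive (perm e)) t
      in pair-covered e o (inj₂ (inj₁ (begin
        b + u                                  ≡⟨ cong (b +_) u≡ ⟩
        b + (9 * toℕ i′ + toℕ t)               ≡⟨ ℕₚ.+-assoc b _ _ ⟨
        b + 9 * toℕ i′ + toℕ t
          ≡⟨ cong₂ (λ i t → b + 9 * toℕ i + t) (opposite-involutive i′) t≡ ⟨
        B e + p e o                            ∎)))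
      where
      open ≡-Reasoning
      b = B₀ ε + 9 * κ * toℕ (opposite ω)

    A+B≡C : ∀ e {a b s} → a + b ≡ s + 4 → C e + s ≡ (A e + a) + (B e + b)
    A+B≡C e {a} {b} {s} eq = begin
      C e + s                    ≡⟨ cong (_+ s) (A+B+4≡C e) ⟨
      A e + B e + 4 + s          ≡⟨ e₁ (A e) (B e) s ⟩
      A e + B e + (s + 4)        ≡⟨ cong (A e + B e +_) eq ⟨
      A e + B e + (a + b)        ≡⟨ e₂ (A e) (B e) a b ⟩
      (A e + a) + (B e + b)      ∎
      where
      open ≡-Reasoning
      e₁ : ∀ x y s → x + y + 4 + s ≡ x + y + (s + 4)
      e₁ = solve-∀
      e₂ : ∀ x y a b → x + y + (a + b) ≡ (x + a) + (y + b)
      e₂ = solve-∀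

    -- Surjectivity of x ↦ x + p(x) puts a sum on every point of the interval, as surjectivity of p
    -- puts a second member there in `B-covered`.
    C-covered : ∀ ω ε → CoveredFrom (C₀ ε + (9 * κ + 1) * toℕ ω) (9 * κ)
    C-covered ω ε u u< =
      let i , s , u≡ = divide {κ} 9 (subst (u <_) (ℕₚ.*-comm 9 κ) u<)
          e = ω , i , ε
          o , s≡ = proj₁ (proj₂ (pattern-additive (perm e))) s
      in pair-covered e o (inj₂ (inj₂ (inj₁ (begin
        c + u                                  ≡⟨ cong (c +_) u≡ ⟩
        c + (9 * toℕ i + toℕ s)                ≡⟨ ℕₚ.+-assoc c _ _ ⟨
        C e + toℕ s                            ≡⟨ A+B≡C e s≡ ⟩
        (A e + toℕ o) + (B e + p e o)          ∎))))
      where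
      open ≡-Reasoning
      c = C₀ ε + (9 * κ + 1) * toℕ ω

    CoveredBelow : ℕ → Set
    CoveredBelow e = ∀ d → 1 ≤ d → d < e → Covered d

    extend : ∀ {s ℓ} → CoveredBelow s → CoveredFrom s ℓ → CoveredBelow (s + ℓ)
    extend {s} {ℓ} below from d 1≤d d< with d ℕₚ.<? s
    ... | yes d<s = below d 1≤d d<s
    ... | no  d≮s =
      subst Covered (ℕₚ.m+[n∸m]≡n s≤d) (from (d ∸ s) (ℕₚ.+-cancelˡ-< s _ _ (subst (_< s + ℓ) (sym (ℕₚ.m+[n∸m]≡n s≤d)) d<)))
      where s≤d = ℕₚ.≮⇒≥ d≮s

    -- The line from 1 to 3n + 1 is traversed in increasing order: eight gaps from the table and ten
    -- runs of block intervals. Both A-runs come first; then each nest has its B-runs, in reversed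
    -- order of ω, followed by its C-runs. The equations say that each piece ends where the next
    -- begins.
    covered : CoveredBelow (3 * n + 2)
    covered with proj₂ (proj₂ S-correct)
    ... | fS , fM , fJ , fK , fL , fH , fP , fQ = subst CoveredBelow last≡
      (none
      ▹ filled-covered fS by eqS w j h κ
      ▹ A-covered o₀ by eqA0 w j h κ
      ▹ filled-covered fM by eqM w j h κ
      ▹ A-covered o₁ by eqA1 w j h κ
      ▹ filled-covered fJ by eqJ w j h κ
      ▹ B-covered o₁ o₀ by eqB10 w j h κ
      ▹ B-covered o₀ o₀ by eqB00 w j h κ
      ▹ filled-covered fK by eqK w j h κ
      ▹ C-covered o₀ o₀ by eqC00 w j h κ
      ▹ filled-covered fL by eqL w j h κ
      ▹ C-covered o₁ o₀ by eqC10 w j h κ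
      ▹ filled-covered fH by eqH w j h κ
      ▹ B-covered o₁ o₁ by eqB11 w j h κ
      ▹ B-covered o₀ o₁ by eqB01 w j h κ
      ▹ filled-covered fP by eqP w j h κ
      ▹ C-covered o₀ o₁ by eqC01 w j h κ
      ▹ filled-covered fQ by eqQ w j h κ
      ▹ C-covered o₁ o₁ by eqC11 w j h κ)
      where
      o₀ o₁ : Fin 2
      o₀ = zero
      o₁ = suc zero
      none : CoveredBelow 1
      none (suc _) _ (s≤s ())
      infixl 4 _▹_by_
      _▹_by_ : ∀ {s ℓ e} → CoveredBelow s → CoveredFrom s ℓ → s + ℓ ≡ e → CoveredBelow e
      below ▹ from by eq = subst CoveredBelow eq (extend below from)
      eqS : ∀ w j h κ → 1 + 0 * (9 * κ) + (4 + w) ≡ 5 + w + (18 * κ + 1) * 0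
      eqS = solve-∀
      eqA0 : ∀ w j h κ → 5 + w + (18 * κ + 1) * 0 + 18 * κ ≡ 5 + w + 2 * (9 * κ)
      eqA0 = solve-∀
      eqM : ∀ w j h κ → 5 + w + 2 * (9 * κ) + 1 ≡ 5 + w + (18 * κ + 1) * 1
      eqM = solve-∀
      eqA1 : ∀ w j h κ → 5 + w + (18 * κ + 1) * 1 + 18 * κ ≡ 6 + w + 4 * (9 * κ)
      eqA1 = solve-∀
      eqJ : ∀ w j h κ → 6 + w + 4 * (9 * κ) + j ≡ 6 + w + j + 36 * κ + 9 * κ * 0
      eqJ = solve-∀
      eqB10 : ∀ w j h κ → 6 + w + j + 36 * κ + 9 * κ * 0 + 9 * κ ≡ 6 + w + j + 36 * κ + 9 * κ * 1
      eqB10 = solve-∀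
      eqB00 : ∀ w j h κ → 6 + w + j + 36 * κ + 9 * κ * 1 + 9 * κ ≡ 6 + w + j + 6 * (9 * κ)
      eqB00 = solve-∀
      eqK : ∀ w j h κ → 6 + w + j + 6 * (9 * κ) + w ≡ w + (6 + w + j + 36 * κ) + 9 * 0 + 18 * κ + (9 * κ + 1) * 0
      eqK = solve-∀
      eqC00 : ∀ w j h κ → w + (6 + w + j + 36 * κ) + 9 * 0 + 18 * κ + (9 * κ + 1) * 0 + 9 * κ ≡ 6 + 2 * w + j + 7 * (9 * κ)
      eqC00 = solve-∀
      eqL : ∀ w j h κ → 6 + 2 * w + j + 7 * (9 * κ) + 1 ≡ w + (6 + w + j + 36 * κ) + 9 * 0 + 18 * κ + (9 * κ + 1) * 1
      eqL = solve-∀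
      eqC10 : ∀ w j h κ → w + (6 + w + j + 36 * κ) + 9 * 0 + 18 * κ + (9 * κ + 1) * 1 + 9 * κ ≡ 7 + 2 * w + j + 8 * (9 * κ)
      eqC10 = solve-∀
      eqH : ∀ w j h κ → 7 + 2 * w + j + 8 * (9 * κ) + h ≡ 7 + 2 * w + j + h + 72 * κ + 9 * κ * 0
      eqH = solve-∀
      eqB11 : ∀ w j h κ → 7 + 2 * w + j + h + 72 * κ + 9 * κ * 0 + 9 * κ ≡ 7 + 2 * w + j + h + 72 * κ + 9 * κ * 1
      eqB11 = solve-∀
      eqB01 : ∀ w j h κ → 7 + 2 * w + j + h + 72 * κ + 9 * κ * 1 + 9 * κ ≡ 7 + 2 * w + j + h + 10 * (9 * κ)
      eqB01 = solve-∀
      eqP : ∀ w j h κ → 7 + 2 * w + j + h + 10 * (9 * κ) + (9 + w) ≡ w + (7 + 2 * w + j + h + 72 * κ) + 9 * 1 + 18 * κ + (9 * κ + 1) * 0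
      eqP = solve-∀
      eqC01 : ∀ w j h κ → w + (7 + 2 * w + j + h + 72 * κ) + 9 * 1 + 18 * κ + (9 * κ + 1) * 0 + 9 * κ ≡ 16 + 3 * w + j + h + 11 * (9 * κ)
      eqC01 = solve-∀
      eqQ : ∀ w j h κ → 16 + 3 * w + j + h + 11 * (9 * κ) + 1 ≡ w + (7 + 2 * w + j + h + 72 * κ) + 9 * 1 + 18 * κ + (9 * κ + 1) * 1
      eqQ = solve-∀
      eqC11 : ∀ w j h κ → w + (7 + 2 * w + j + h + 72 * κ) + 9 * 1 + 18 * κ + (9 * κ + 1) * 1 + 9 * κ ≡ 17 + 3 * w + j + h + 108 * κ
      eqC11 = solve-∀

-- Distinct choices give distinct systems

funToFin-cong : ∀ {k l} {f g : Fin k → Fin l} → (∀ i → f i ≡ g i) → funToFin f ≡ funToFin g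
funToFin-cong {zero}  eq = refl
funToFin-cong {suc k} eq = cong₂ combine (eq zero) (funToFin-cong (eq ∘ suc))

finToFun-injective : ∀ {k l} {x y : Fin (l ℕ.^ k)} → (∀ i → finToFun {l} {k} x i ≡ finToFun y i) → x ≡ y
finToFun-injective {k} {l} {x} {y} eq =
  trans (sym (funToFin-finToFin {k} {l} x)) (trans (funToFin-cong eq) (funToFin-finToFin {k} {l} y))

remQuot-injective : ∀ {k} l {x y : Fin (k * l)} → remQuot {k} l x ≡ remQuot l y → x ≡ y
remQuot-injective {k} l {x} {y} eq =
  trans (sym (combine-remQuot {k} l x)) (trans (cong (λ (i , j) → combine i j) eq) (combine-remQuot {k} l y))

module Family (κ r : ℕ) (S : Solution) (S-correct : IsSolution r S)
  {R : ℕ} (pattern′ : Fin R → ℕ) (pattern-additive : ∀ i → IsAdditive (pattern′ i))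
  (pattern-injective : ∀ i j → (∀ o → digit (pattern′ i) o ≡ digit (pattern′ j) o) → i ≡ j)
  (n v : ℕ) {{_ : NonZero v}} (n≡ : 36 * κ + r ≡ n) (v≡ : 6 * n + 3 ≡ v) where

  open Construction κ r S S-correct pattern′ pattern-additive n v n≡ v≡
  open ℤ/ v

  hole : Fin v
  hole = ⟦ 2 * n + 1 ⟧

  3hole≡0 : (hole ⊕ hole) ⊕ hole ≡ ⟦ 0 ⟧
  3hole≡0 = begin
    (hole ⊕ hole) ⊕ hole       ≡⟨ cong (_⊕ hole) (⟦⟧-+ m m) ⟨
    ⟦ m + m ⟧ ⊕ hole           ≡⟨ ⟦⟧-+ (m + m) m ⟨
    ⟦ m + m + m ⟧              ≡⟨ cong ⟦_⟧ (trans (eq n) v≡) ⟩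
    ⟦ v ⟧                      ≡⟨ ⟦v⟧≡⟦0⟧ ⟩
    ⟦ 0 ⟧                      ∎
    where
    open ≡-Reasoning
    m = 2 * n + 1
    eq : ∀ n → 2 * n + 1 + (2 * n + 1) + (2 * n + 1) ≡ 6 * n + 3
    eq = solve-∀

  halves : (3 * n + 2) + (3 * n + 1) ≡ v
  halves = trans (eq n) v≡
    where
    eq : ∀ n → (3 * n + 2) + (3 * n + 1) ≡ 6 * n + 3
    eq = solve-∀

  -- The third point of the block through 0 and a, when the triple of a and b is taken in the given
  -- orientation.
  image : Fin 2 → ℕ → ℕ → Fin v
  image zero    a b = ⟦ a ⟧ ⊕ ⟦ b ⟧
  image (suc _) a b = ⊖ ⟦ b ⟧

  ⟦⟧-injective : ∀ {k m} → k < v → m < v → ⟦ k ⟧ ≡ ⟦ m ⟧ → k ≡ m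
  ⟦⟧-injective k< m< eq = trans (sym (toℕ-⟦⟧-< k<)) (trans (cong toℕ eq) (toℕ-⟦⟧-< m<))

  half<v : ∀ {m} → m < 3 * n + 2 → m < v
  half<v m< = ℕₚ.<-≤-trans m< (subst (3 * n + 2 ≤_) halves (ℕₚ.m≤m+n _ _))

  -- Equality would make v divide a + b + b′. This sum is positive, and since a + b and b′ are both
  -- at most 3n + 1 it is at most v - 1.
  image-mixed : ∀ {a b b′} → 1 ≤ a → a + b < 3 * n + 2 → a + b′ < 3 * n + 2 → ⟦ a ⟧ ⊕ ⟦ b ⟧ ≢ ⊖ ⟦ b′ ⟧
  image-mixed {a} {b} {b′} 1≤a ab< ab′< eq =
    ℕₚ.1+n≰n (ℕₚ.≤-trans 1≤a (ℕₚ.≤-trans (ℕₚ.≤-trans (ℕₚ.m≤m+n a b) (ℕₚ.m≤m+n (a + b) b′)) (ℕₚ.≤-reflexive sum≡0)))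
    where
    sum< : a + b + b′ < v
    sum< = subst (a + b + b′ <_) halves (ℕₚ.+-mono-<-≤ ab<
      (ℕₚ.≤-pred (ℕₚ.≤-<-trans (ℕₚ.m≤n+m b′ a) (subst (a + b′ <_) (ℕₚ.+-suc (3 * n) 1) ab′<))))
    sum≡0 : a + b + b′ ≡ 0
    sum≡0 = ⟦⟧-injective sum< (ℕₚ.≤-<-trans z≤n sum<) (begin
      ⟦ a + b + b′ ⟧           ≡⟨ ⟦⟧-+ (a + b) b′ ⟩
      ⟦ a + b ⟧ ⊕ ⟦ b′ ⟧       ≡⟨ cong (_⊕ ⟦ b′ ⟧) (trans (⟦⟧-+ a b) eq) ⟩
      ⊖ ⟦ b′ ⟧ ⊕ ⟦ b′ ⟧        ≡⟨ ⊕-inverseˡ ⟦ b′ ⟧ ⟩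
      ⟦ 0 ⟧                    ∎)
      where open ≡-Reasoning

  image-injective : ∀ β β′ {a b b′} → 1 ≤ a → a + b < 3 * n + 2 → a + b′ < 3 * n + 2 →
    image β a b ≡ image β′ a b′ → β ≡ β′ × b ≡ b′
  image-injective zero zero {a} {b} {b′} 1≤a ab< ab′< eq = refl
    , ⟦⟧-injective (half<v (ℕₚ.≤-<-trans (ℕₚ.m≤n+m b a) ab<)) (half<v (ℕₚ.≤-<-trans (ℕₚ.m≤n+m b′ a) ab′<)) (∙-cancelˡ ⟦ a ⟧ ⟦ b ⟧ ⟦ b′ ⟧ eq)
  image-injective (suc zero) (suc zero) {a} {b} {b′} 1≤a ab< ab′< eq = refl
    , ⟦⟧-injective (half<v (ℕₚ.≤-<-trans (ℕₚ.m≤n+m b a) ab<)) (half<v (ℕₚ.≤-<-trans (ℕₚ.m≤n+m b′ a) ab′<)) (⁻¹-injective eq)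
  image-injective zero (suc zero) 1≤a ab< ab′< eq = ⊥-elim (image-mixed 1≤a ab< ab′< eq)
  image-injective (suc zero) zero 1≤a ab< ab′< eq = ⊥-elim (image-mixed 1≤a ab′< ab< (sym eq))

  module _ (perm : Block → Fin R) (flips : Block → Fin 9 → Fin 2) where

    ⟦triples⟧ : List (Fin v × Fin v)
    ⟦triples⟧ = map (λ (a , b) → ⟦ a ⟧ , ⟦ b ⟧) (triples perm flips)

    Γ : List (Fin v × Fin v)
    Γ = graph hole ⟦triples⟧

    hexagon⊆Γ : ∀ {a b e} → (a , b) ∈ triples perm flips → e ∈ hexagon (⟦ a ⟧ , ⟦ b ⟧) → e ∈ Γ
    hexagon⊆Γ t∈ = hexagon⊆graph {h = hole} {ts = ⟦triples⟧} (∈-map⁺ _ t∈)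

    covered-total : ∀ {d} → Covered perm flips d → ∃[ q ] (⟦ d ⟧ , q) ∈ Γ
    covered-total (inj₁ refl) = ⊖ hole , there (here refl)
    covered-total {d} (inj₂ d∈) with find d∈
    ... | (a , b) , t∈ , inj₁ refl = _ , hexagon⊆Γ t∈ (here refl)
    ... | (a , b) , t∈ , inj₂ (inj₁ refl) = _ , hexagon⊆Γ t∈ (there (there (here refl)))
    ... | (a , b) , t∈ , inj₂ (inj₂ (inj₁ refl)) =
      _ , hexagon⊆Γ t∈ (there (here (cong (_, ⟦ a ⟧) (⟦⟧-+ a b))))
    ... | (a , b) , t∈ , inj₂ (inj₂ (inj₂ eq)) = _ , hexagon⊆Γ t∈ (there (there (there (there (here
      (cong (_, ⊖ ⟦ b ⟧) (trans (⟦⟧-⊖ (trans (ℕₚ.+-comm (a + b) d) eq)) (cong ⊖_ (⟦⟧-+ a b)))))))))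

    total : ∀ d → ∃[ q ] (d , q) ∈ Γ
    total d with toℕ d ℕₚ.≟ 0 | toℕ d ℕₚ.<? 3 * n + 2
    ... | yes d≡0 | _ = ⟦ 0 ⟧ , here (cong (_, ⟦ 0 ⟧) (trans (sym (⟦toℕ⟧ d)) (cong ⟦_⟧ d≡0)))
    ... | no d≢0 | yes d< = subst (λ d → ∃[ q ] (d , q) ∈ Γ) (⟦toℕ⟧ d)
      (covered-total (covered perm flips (toℕ d) (ℕₚ.n≢0⇒n>0 d≢0) d<))
    -- For d in the upper half, -d is covered, and the graph is closed under reversal.
    ... | no d≢0 | no d≮ =
      let q , q∈ = covered-total (covered perm flips (v ∸ toℕ d) (ℕₚ.m<n⇒0<n∸m (toℕ<n d)) (<-half (begin
            v ∸ toℕ d                                      ≤⟨ ℕₚ.∸-monoʳ-≤ v (ℕₚ.≮⇒≥ d≮) ⟩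
            v ∸ (3 * n + 2)                                ≡⟨ cong (_∸ (3 * n + 2)) halves ⟨
            (3 * n + 2) + (3 * n + 1) ∸ (3 * n + 2)        ≡⟨ ℕₚ.m+n∸m≡n (3 * n + 2) (3 * n + 1) ⟩
            3 * n + 1                                      ∎)))
      in _ , subst (λ d → (d , q ⊕ d) ∈ Γ) (⁻¹-involutive d) (graph-reverse {h = hole} {ts = ⟦triples⟧} 3hole≡0 q∈)
      where
      open ℕₚ.≤-Reasoning
      <-half : ∀ {m} → m ≤ 3 * n + 1 → m < 3 * n + 2
      <-half {m} m≤ = subst (m <_) (sym (ℕₚ.+-suc (3 * n) 1)) (s≤s m≤)

    private
      module G = ThirdPoint hole 3hole≡0 ⟦triples⟧ total
        (trans (cong (λ l → 6 * l + 3) (trans (length-map _ (triples perm flips)) (length-triples perm flips))) v≡)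

    third : Fin v → Fin v
    third = G.apply

    third-isThirdPoint : IsThirdPoint third
    third-isThirdPoint = G.apply-isThirdPoint

    third-image : ∀ e o → third ⟦ A e + toℕ o ⟧ ≡ image (flips e o) (A e + toℕ o) (B e + p perm flips e o)
    third-image e o = G.∈⇒apply (in-graph (flips e o) (oriented∈triples perm flips e o))
      where
      in-graph : ∀ β {a b} → orient β (a , b) ∈ triples perm flips → (⟦ a ⟧ , image β a b) ∈ Γ
      in-graph zero    t∈ = hexagon⊆Γ t∈ (here refl)
      in-graph (suc _) t∈ = hexagon⊆Γ t∈ (there (there (here refl)))

    pair< : ∀ e o → (A e + toℕ o) + (B e + p perm flips e o) < 3 * n + 2
    pair< e o = begin-strict
      (A e + toℕ o) + (B e + q)      ≡⟨ eq₁ (A e) (B e) (toℕ o) q ⟩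
      A e + B e + (toℕ o + q)
        ≤⟨ ℕₚ.+-monoʳ-≤ (A e + B e) (proj₂ (proj₂ (pattern-additive (perm e))) o) ⟩
      A e + B e + 12                 <⟨ ℕₚ.n<1+n _ ⟩
      1 + (A e + B e + 12)           ≡⟨ eq₂ (A e) (B e) ⟩
      A e + B e + 4 + 9              ≡⟨ cong (_+ 9) (A+B+4≡C e) ⟩
      C e + 9                        ≤⟨ C+9≤ e ⟩
      3 * n + 2                      ∎
      where
      open ℕₚ.≤-Reasoning
      q = p perm flips e o
      eq₁ : ∀ a b o q → (a + o) + (b + q) ≡ a + b + (o + q)
      eq₁ = solve-∀
      eq₂ : ∀ a b → 1 + (a + b + 12) ≡ a + b + 4 + 9
      eq₂ = solve-∀

  -- The points A e + o are the same for all choices, so third points can be compared there: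
  -- `image-injective` recovers the orientation and the partner B e + p(o), and the partners of all
  -- o recover the pattern.
  third-injective : ∀ {perm perm′ flips flips′} → (∀ d → third perm flips d ≡ third perm′ flips′ d) →
    ∀ e → perm e ≡ perm′ e × (∀ o → flips e o ≡ flips′ e o)
  third-injective {perm} {perm′} {flips} {flips′} eq e =
      pattern-injective (perm e) (perm′ e) (λ o → ℕₚ.+-cancelˡ-≡ (B e) _ _ (proj₂ (same o)))
    , proj₁ ∘ same
    where
    same : ∀ o → flips e o ≡ flips′ e o × B e + p perm flips e o ≡ B e + p perm′ flips′ e o
    same o =
      image-injective (flips e o) (flips′ e o) (s≤s z≤n) (pair< perm flips e o) (pair< perm′ flips′ e o)
      (trans (sym (third-image perm flips e o)) (trans (eq ⟦ A e + toℕ o ⟧) (third-image perm′ flips′ e o)))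

  -- One digit to base R · 2⁹ for each block, which packs its pattern with its nine orientations.
  Code : Set
  Code = Fin ((R * 2 ℕ.^ 9) ℕ.^ Blocks)

  choice : Code → Block → Fin R × Fin (2 ℕ.^ 9)
  choice c e = remQuot (2 ℕ.^ 9) (finToFun {R * 2 ℕ.^ 9} {Blocks} c (block# e))

  code-perm : Code → Block → Fin R
  code-perm c e = proj₁ (choice c e)

  code-flips : Code → Block → Fin 9 → Fin 2
  code-flips c e = finToFun (proj₂ (choice c e))

  operation : Code → Fin v → Fin v → Fin v
  operation c = translate (third (code-perm c) (code-flips c))

  operation-injective : ∀ {c c′} → (∀ x y → operation c x y ≡ operation c′ x y) → c ≡ c′
  operation-injective {c} {c′} eq = finToFun-injective {Blocks} {R * 2 ℕ.^ 9} λ i →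
    remQuot-injective {R} (2 ℕ.^ 9) (subst (λ i → remQuot {R} (2 ℕ.^ 9) (finToFun c i) ≡ remQuot (2 ℕ.^ 9) (finToFun c′ i))
      (block#-#block i) (same (#block i)))
    where
    same : ∀ e → choice c e ≡ choice c′ e
    same e = let perm≡ , flips≡ = third-injective (translate-injective eq) e in
      cong₂ _,_ perm≡ (finToFun-injective {9} {2} flips≡)

  NC-lower-bound : ∀ k → v < 2 ℕ.^ k → (R * 2 ℕ.^ 9) ℕ.^ Blocks ≤ NC v * (v * v ℕ.^ k)
  NC-lower-bound k v< =
    subst (_≤ NC v * (v * v ℕ.^ k)) (length-tabulate {n = (R * 2 ℕ.^ 9) ℕ.^ Blocks} (λ c → c))
    (cyclic-count operation (λ c → translate-cyclic (third-isThirdPoint (code-perm c) (code-flips c))) operation-injective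
      k v< (Uniqueₚ.allFin⁺ _))

-- Estimates

-- Unnormalised fractions keep a^n over (1 + d)^n without cancelling common factors, such as the 5
-- in 335/100; the comparison then reduces to natural numbers by cross-multiplication.
toℚᵘ-^ : ∀ a d n → toℚᵘ ((ℤ.+ a ℚ./ suc d) ℚ^ n) ℚᵘ.≃ mkℚᵘ (ℤ.+ (a ℕ.^ n)) (pred (suc d ℕ.^ n))
toℚᵘ-^ a d zero    = ℚᵘₚ.≃-refl
toℚᵘ-^ a d (suc n) = begin-equality
  toℚᵘ ((ℤ.+ a ℚ./ suc d) ℚ.* (ℤ.+ a ℚ./ suc d) ℚ^ n)
    ≃⟨ ℚₚ.toℚᵘ-homo-* (ℤ.+ a ℚ./ suc d) _ ⟩
  toℚᵘ (ℤ.+ a ℚ./ suc d) ℚᵘ.* toℚᵘ ((ℤ.+ a ℚ./ suc d) ℚ^ n)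
    ≃⟨ ℚᵘₚ.*-cong (ℚₚ.toℚᵘ-fromℚᵘ (mkℚᵘ (ℤ.+ a) d)) (toℚᵘ-^ a d n) ⟩
  mkℚᵘ (ℤ.+ a) d ℚᵘ.* mkℚᵘ (ℤ.+ (a ℕ.^ n)) (pred (suc d ℕ.^ n))
    ≡⟨ product (a ℕ.^ n) (suc d ℕ.^ n) {{ℕₚ.m^n≢0 (suc d) n}} ⟩
  mkℚᵘ (ℤ.+ (a * a ℕ.^ n)) (pred (suc d * suc d ℕ.^ n))                ∎
  where
  open ℚᵘₚ.≤-Reasoning
  product : ∀ m e {{_ : NonZero e}} → mkℚᵘ (ℤ.+ a) d ℚᵘ.* mkℚᵘ (ℤ.+ m) (pred e) ≡ mkℚᵘ (ℤ.+ (a * m)) (pred (suc d * e))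
  product m (suc e) = cong (λ i → mkℚᵘ i (e + d * suc e)) (sym (ℤₚ.pos-* a m))

fraction-^≤ : ∀ a d n x → a ℕ.^ n ≤ x * suc d ℕ.^ n → (ℤ.+ a ℚ./ suc d) ℚ^ n ℚ.≤ ℤ.+ x ℚ./ 1
fraction-^≤ a d n x a^n≤ = ℚₚ.toℚᵘ-cancel-≤ (begin
  toℚᵘ ((ℤ.+ a ℚ./ suc d) ℚ^ n)                  ≃⟨ toℚᵘ-^ a d n ⟩
  mkℚᵘ (ℤ.+ (a ℕ.^ n)) (pred (suc d ℕ.^ n))        ≤⟨ *≤* cross ⟩
  mkℚᵘ (ℤ.+ x) 0                               ≃⟨ ℚₚ.toℚᵘ-fromℚᵘ (mkℚᵘ (ℤ.+ x) 0) ⟨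
  toℚᵘ (ℤ.+ x ℚ./ 1)                             ∎)
  where
  open ℚᵘₚ.≤-Reasoning
  cross : ℤ.+ (a ℕ.^ n) ℤ.* ℤ.+ 1 ℤ.≤ ℤ.+ x ℤ.* ℤ.+ suc (pred (suc d ℕ.^ n))
  cross = subst₂ ℤ._≤_ (sym (ℤₚ.*-identityʳ _))
    (trans (ℤₚ.pos-* x (suc d ℕ.^ n)) (cong (λ e → ℤ.+ x ℤ.* ℤ.+ e) (sym (ℕₚ.suc-pred (suc d ℕ.^ n) {{ℕₚ.m^n≢0 (suc d) n}}))))
    (ℤ.+≤+ a^n≤)

n<2^n : ∀ n → n < 2 ℕ.^ n
n<2^n zero    = s≤s z≤n
n<2^n (suc n) = begin-strict
  suc n               ≤⟨ n<2^n n ⟩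
  2 ℕ.^ n               <⟨ ℕₚ.m<m+n (2 ℕ.^ n) (subst (0 <_) (sym (ℕₚ.+-identityʳ (2 ℕ.^ n))) (ℕₚ.m^n>0 2 n)) ⟩
  2 ℕ.^ suc n           ∎
  where open ℕₚ.≤-Reasoning

between-powers : ∀ s {m} → 2 ℕ.^ s ≤ m → ∃[ l ] 2 ℕ.^ (l + s) ≤ m × m < 2 ℕ.^ suc (l + s)
between-powers s {m} 2^s≤m =
  go m (ℕₚ.<-≤-trans (n<2^n m) (ℕₚ.^-monoʳ-≤ 2 (ℕₚ.≤-trans (ℕₚ.m≤m+n m s) (ℕₚ.n≤1+n _))))
  where
  go : ∀ t → m < 2 ℕ.^ suc (t + s) → ∃[ l ] 2 ℕ.^ (l + s) ≤ m × m < 2 ℕ.^ suc (l + s)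
  go zero    m< = 0 , 2^s≤m , m<
  go (suc t) m< with m ℕₚ.<? 2 ℕ.^ suc (t + s)
  ... | yes m<′ = go t m<′
  ... | no  m≮ = suc t , ℕₚ.≮⇒≥ m≮ , m<

-- Twice the left side at l exceeds the left side at l + 1 by l² + 35l + 394. At l = 0 the claim is
-- 432 ≤ 512, whence the threshold 512 = 2⁹ for κ.
quadratic≤2^ : ∀ l → 90 + (l + 18) * suc (l + 18) ≤ 2 ℕ.^ (l + 9)
quadratic≤2^ zero    = from-yes (432 ℕₚ.≤? 512)
quadratic≤2^ (suc l) = begin
  90 + (suc l + 18) * suc (suc l + 18)              ≤⟨ ℕₚ.m≤m+n _ _ ⟩
  90 + (suc l + 18) * suc (suc l + 18) + (l * l + 35 * l + 394) ≡⟨ eq l ⟩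
  2 * (90 + (l + 18) * suc (l + 18))                ≤⟨ ℕₚ.*-monoʳ-≤ 2 (quadratic≤2^ l) ⟩
  2 ℕ.^ (suc l + 9)                                   ∎
  where
  open ℕₚ.≤-Reasoning
  eq : ∀ l → 90 + (1 + l + 18) * (1 + (1 + l + 18)) + (l * l + 35 * l + 394) ≡ 2 * (90 + (l + 18) * (1 + (l + 18)))
  eq = solve-∀

-- If 2^(l+9) ≤ κ < 2^(l+10), then k = l + 18 gives 2⁸κ < 2^k, and 2⁸κ will bound v. In the second
-- inequality k(k + 1) is the exponent in v · v^k ≤ 2^(k(k+1)), and 90 = 2 · 45 pays for 4^r with r
-- ≤ 45.
logarithm : ∀ {κ} → 512 ≤ κ → ∃[ k ] 256 * κ < 2 ℕ.^ k × 90 + k * suc k ≤ κ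
logarithm {κ} 512≤κ with between-powers 9 512≤κ
... | l , 2^≤κ , κ< = l + 18 , 256κ< , ℕₚ.≤-trans (quadratic≤2^ l) 2^≤κ
  where
  open ℕₚ.≤-Reasoning
  256κ< : 256 * κ < 2 ℕ.^ (l + 18)
  256κ< = begin-strict
    256 * κ                      <⟨ ℕₚ.*-monoʳ-< 256 κ< ⟩
    256 * 2 ℕ.^ suc (l + 9)        ≡⟨ ℕₚ.^-distribˡ-+-* 2 8 (suc (l + 9)) ⟨
    2 ℕ.^ (8 + suc (l + 9))        ≡⟨ cong (2 ℕ.^_) (eq l) ⟩
    2 ℕ.^ (l + 18)                 ∎
    where
    eq : ∀ l → 8 + suc (l + 9) ≡ l + 18
    eq = solve-∀

module _ {κ r n v k : ℕ} (n≡ : 36 * κ + r ≡ n) (r≤45 : r ≤ 45) (v<2^k : v < 2 ℕ.^ k) (k-small : 90 + k * suc k ≤ κ) where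
  open ℕₚ.≤-Reasoning

  ^-distribʳ-* : ∀ a b m → (a * b) ℕ.^ m ≡ a ℕ.^ m * b ℕ.^ m
  ^-distribʳ-* a b zero    = refl
  ^-distribʳ-* a b (suc m) = trans (cong (a * b *_) (^-distribʳ-* a b m)) (eq a b (a ℕ.^ m) (b ℕ.^ m))
    where
    eq : ∀ a b c d → a * b * (c * d) ≡ a * c * (b * d)
    eq = solve-∀

  ^-split : ∀ a → a ℕ.^ n ≡ (a ℕ.^ 36) ℕ.^ κ * a ℕ.^ r
  ^-split a = begin-equality
    a ℕ.^ n                    ≡⟨ cong (a ℕ.^_) n≡ ⟨
    a ℕ.^ (36 * κ + r)         ≡⟨ ℕₚ.^-distribˡ-+-* a (36 * κ) r ⟩
    a ℕ.^ (36 * κ) * a ℕ.^ r     ≡⟨ cong (_* a ℕ.^ r) (ℕₚ.^-*-assoc a 36 κ) ⟨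
    (a ℕ.^ 36) ℕ.^ κ * a ℕ.^ r     ∎

  v^ : v * v ℕ.^ k ≤ 2 ℕ.^ (k * suc k)
  v^ = ℕₚ.≤-trans (ℕₚ.^-monoˡ-≤ (suc k) (ℕₚ.<⇒≤ v<2^k)) (ℕₚ.≤-reflexive (ℕₚ.^-*-assoc 2 k (suc k)))

  -- Bounding 3.35 by 4 turns both factors into powers of 2, with total exponent 2r + k(k + 1) ≤ 90
  -- + k(k + 1) ≤ κ.
  remainder≤ : 335 ℕ.^ r * (v * v ℕ.^ k) ≤ 100 ℕ.^ r * 2 ℕ.^ κ
  remainder≤ = begin
    335 ℕ.^ r * (v * v ℕ.^ k)
      ≤⟨ ℕₚ.*-mono-≤ (ℕₚ.^-monoˡ-≤ r (from-yes (335 ℕₚ.≤? 100 * 2 ℕ.^ 2))) v^ ⟩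
    (100 * 2 ℕ.^ 2) ℕ.^ r * 2 ℕ.^ (k * suc k)
      ≡⟨ cong (_* 2 ℕ.^ (k * suc k)) (trans (^-distribʳ-* 100 (2 ℕ.^ 2) r) (cong (100 ℕ.^ r *_) (ℕₚ.^-*-assoc 2 2 r))) ⟩
    100 ℕ.^ r * 2 ℕ.^ (2 * r) * 2 ℕ.^ (k * suc k) ≡⟨ ℕₚ.*-assoc (100 ℕ.^ r) _ _ ⟩
    100 ℕ.^ r * (2 ℕ.^ (2 * r) * 2 ℕ.^ (k * suc k))
      ≡⟨ cong (100 ℕ.^ r *_) (ℕₚ.^-distribˡ-+-* 2 (2 * r) (k * suc k)) ⟨
    100 ℕ.^ r * 2 ℕ.^ (2 * r + k * suc k)
      ≤⟨ ℕₚ.*-monoʳ-≤ (100 ℕ.^ r) (ℕₚ.^-monoʳ-≤ 2 (ℕₚ.≤-trans (ℕₚ.+-monoˡ-≤ (k * suc k) (ℕₚ.*-monoʳ-≤ 2 r≤45)) k-small)) ⟩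
    100 ℕ.^ r * 2 ℕ.^ κ                        ∎

  335^n≤ : ∀ {x} → (2 ℕ.^ 64) ℕ.^ κ ≤ x * (v * v ℕ.^ k) → .{{NonZero (v * v ℕ.^ k)}} → 335 ℕ.^ n ≤ x * 100 ℕ.^ n
  335^n≤ {x} M≤ = ℕₚ.*-cancelʳ-≤ (335 ℕ.^ n) (x * 100 ℕ.^ n) Y (begin
    335 ℕ.^ n * Y
      ≡⟨ trans (cong (_* Y) (^-split 335)) (ℕₚ.*-assoc ((335 ℕ.^ 36) ℕ.^ κ) _ Y) ⟩
    (335 ℕ.^ 36) ℕ.^ κ * (335 ℕ.^ r * Y)                 ≤⟨ ℕₚ.*-monoʳ-≤ ((335 ℕ.^ 36) ℕ.^ κ) remainder≤ ⟩
    (335 ℕ.^ 36) ℕ.^ κ * (100 ℕ.^ r * 2 ℕ.^ κ)             ≡⟨ eq₁ ((335 ℕ.^ 36) ℕ.^ κ) (100 ℕ.^ r) (2 ℕ.^ κ) ⟩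
    (335 ℕ.^ 36) ℕ.^ κ * 2 ℕ.^ κ * 100 ℕ.^ r
      ≡⟨ cong (_* 100 ℕ.^ r) (^-distribʳ-* (335 ℕ.^ 36) 2 κ) ⟨
    (335 ℕ.^ 36 * 2) ℕ.^ κ * 100 ℕ.^ r
      -- The number 3.35³⁶ takes fewer than 63 of the 64 bits; the spare bit, κ times over, is the
      -- 2^κ from `remainder≤`.
      ≤⟨ ℕₚ.*-monoˡ-≤ (100 ℕ.^ r) (ℕₚ.^-monoˡ-≤ κ (from-yes (335 ℕ.^ 36 * 2 ℕₚ.≤? 100 ℕ.^ 36 * 2 ℕ.^ 64))) ⟩
    (100 ℕ.^ 36 * 2 ℕ.^ 64) ℕ.^ κ * 100 ℕ.^ r
      ≡⟨ cong (_* 100 ℕ.^ r) (^-distribʳ-* (100 ℕ.^ 36) (2 ℕ.^ 64) κ) ⟩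
    (100 ℕ.^ 36) ℕ.^ κ * (2 ℕ.^ 64) ℕ.^ κ * 100 ℕ.^ r
      ≡⟨ eq₂ ((100 ℕ.^ 36) ℕ.^ κ) ((2 ℕ.^ 64) ℕ.^ κ) (100 ℕ.^ r) ⟩
    (100 ℕ.^ 36) ℕ.^ κ * 100 ℕ.^ r * (2 ℕ.^ 64) ℕ.^ κ        ≡⟨ cong (_* (2 ℕ.^ 64) ℕ.^ κ) (^-split 100) ⟨
    100 ℕ.^ n * (2 ℕ.^ 64) ℕ.^ κ                         ≤⟨ ℕₚ.*-monoʳ-≤ (100 ℕ.^ n) M≤ ⟩
    100 ℕ.^ n * (x * Y)                              ≡⟨ eq₃ (100 ℕ.^ n) x Y ⟩
    x * 100 ℕ.^ n * Y                                ∎)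
    where
    Y = v * v ℕ.^ k
    eq₁ : ∀ a b c → a * (b * c) ≡ a * c * b
    eq₁ = solve-∀
    eq₂ : ∀ a b c → a * b * c ≡ a * c * b
    eq₂ = solve-∀
    eq₃ : ∀ a b c → a * (b * c) ≡ b * a * c
    eq₃ = solve-∀

module _ {n : ℕ} (n≥ : 10 + 36 * 512 ≤ n) where
  private
    m κ r order : ℕ
    m = n ∸ 10
    κ = m ℕ./ 36
    r = 10 + toℕ (m mod 36)
    order = 6 * n + 3

    instance
      order≢0 : NonZero order
      order≢0 = ℕ.≢-nonZero (ℕₚ.m+1+n≢0 (6 * n))

    n≡ : 36 * κ + r ≡ n
    n≡ = begin
      36 * κ + (10 + toℕ (m mod 36))     ≡⟨ cong (λ t → 36 * κ + (10 + t)) (toℕ-fromℕ< (m%n<n m 36)) ⟩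
      36 * κ + (10 + m % 36)             ≡⟨ eq κ (m % 36) ⟩
      10 + (m % 36 + κ * 36)             ≡⟨ cong (10 +_) (m≡m%n+[m/n]*n m 36) ⟨
      10 + m                             ≡⟨ ℕₚ.m+[n∸m]≡n (ℕₚ.≤-trans (ℕₚ.m≤m+n 10 (36 * 512)) n≥) ⟩
      n                                  ∎
      where
      open ≡-Reasoning
      eq : ∀ κ t → 36 * κ + (10 + t) ≡ 10 + (t + κ * 36)
      eq = solve-∀

    r≤45 : r ≤ 45
    r≤45 = ℕₚ.+-monoʳ-≤ 10 (ℕₚ.≤-pred (toℕ<n (m mod 36)))

    512≤κ : 512 ≤ κ
    512≤κ = ℕₚ.≤-pred (ℕₚ.*-cancelˡ-< 36 512 (suc κ) (ℕₚ.+-cancelˡ-< 10 _ _ (begin-strict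
      10 + 36 * 512            ≤⟨ n≥ ⟩
      n                        ≡⟨ n≡ ⟨
      36 * κ + r               ≤⟨ ℕₚ.+-monoʳ-≤ (36 * κ) r≤45 ⟩
      36 * κ + 45              <⟨ ℕₚ.n<1+n _ ⟩
      1 + (36 * κ + 45)        ≡⟨ eq κ ⟩
      10 + 36 * suc κ          ∎)))
      where
      open ℕₚ.≤-Reasoning
      eq : ∀ κ → 1 + (36 * κ + 45) ≡ 10 + 36 * (1 + κ)
      eq = solve-∀

    order≤256κ : order ≤ 256 * κ
    order≤256κ = begin
      6 * n + 3                    ≡⟨ cong (λ n → 6 * n + 3) n≡ ⟨
      6 * (36 * κ + r) + 3         ≤⟨ ℕₚ.+-monoˡ-≤ 3 (ℕₚ.*-monoʳ-≤ 6 (ℕₚ.+-monoʳ-≤ (36 * κ) r≤45)) ⟩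
      6 * (36 * κ + 45) + 3        ≡⟨ eq κ ⟩
      216 * κ + 273
        -- The coefficient 216 = 6 · 36 is rounded up to the power of two 256; the excess 40κ
        -- swallows the constant.
        ≤⟨ ℕₚ.+-monoʳ-≤ (216 * κ) (ℕₚ.≤-trans (from-yes (273 ℕₚ.≤? 40 * 512)) (ℕₚ.*-monoʳ-≤ 40 512≤κ)) ⟩
      216 * κ + 40 * κ             ≡⟨ eq′ κ ⟩
      256 * κ                      ∎
      where
      open ℕₚ.≤-Reasoning
      eq : ∀ κ → 6 * (36 * κ + 45) + 3 ≡ 216 * κ + 273
      eq = solve-∀
      eq′ : ∀ κ → 216 * κ + 40 * κ ≡ 256 * κ
      eq′ = solve-∀

    codes : (128 * 2 ℕ.^ 9) ℕ.^ (2 * κ * 2) ≡ (2 ℕ.^ 64) ℕ.^ κ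
    codes = begin
      (2 ℕ.^ 16) ℕ.^ (2 * κ * 2)     ≡⟨ cong ((2 ℕ.^ 16) ℕ.^_) (eq κ) ⟩
      (2 ℕ.^ 16) ℕ.^ (4 * κ)         ≡⟨ ℕₚ.^-*-assoc (2 ℕ.^ 16) 4 κ ⟨
      (2 ℕ.^ 64) ℕ.^ κ               ∎
      where
      open ≡-Reasoning
      eq : ∀ κ → 2 * κ * 2 ≡ 4 * κ
      eq = solve-∀

  NC-exponential : 335 ℕ.^ n ≤ NC (6 * n + 3) * 100 ℕ.^ n
  NC-exponential =
    let k , 256κ< , k-small = logarithm 512≤κ
        order<2^k = ℕₚ.≤-<-trans order≤256κ 256κ<
    in 335^n≤ {κ} {r} {n} {order} {k} n≡ r≤45 order<2^k k-small {NC order}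
      (subst (_≤ NC order * (order * order ℕ.^ k)) codes
        (Family.NC-lower-bound κ r (Vec.lookup solutions (m mod 36)) (solutions-correct (m mod 36))
          (Vec.lookup patterns) patterns-additive patterns-injective n order n≡ refl k order<2^k))
      {{ℕₚ.m^n≢0 order (suc k)}}

open import Data.Integer.Base using (+_)
open import Data.Rational.Base using (_/_)
open import Algebra.Definitions.RawSemiring +-*-rawSemiring using (_^_)

proposition3 : ∃[ N ] ∀ (n : ℕ) → n ≥ N →
    (n % 28 ∈ 3 ∷ 5 ∷ 24 ∷ 26 ∷ [] →
    + NC (6 * n + 3) / 1 ℚ.≥ (+ 335 / 100) ^ n)
    × (n % 28 ∉ 3 ∷ 5 ∷ 24 ∷ 26 ∷ [] →
    + NC (6 * n + 3) / 1 ℚ.≥ (+ 249 / 100) ^ n)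
proposition3 = 10 + 36 * 512 , λ n n≥ →
    (λ _ → fraction-^≤ 335 99 n (NC (6 * n + 3)) (NC-exponential n≥))
  , (λ _ → fraction-^≤ 249 99 n (NC (6 * n + 3)) (ℕₚ.≤-trans (ℕₚ.^-monoˡ-≤ n (from-yes (249 ℕₚ.≤? 335))) (NC-exponential n≥)))
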